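{- For any integer $k\geq 1$, $$G(z)=(\tau_{\beta,0}\circ\tau_{\beta,1}\circ\cdots\circ\tau_{\beta,k-1})(G_{k}(z)).$$ Thus $G(z)$ has the formal matrix continued fraction expansion (understood as the compositions of the transformations $\tau_{\beta,k}$ in the identities $G(z)=(\tau_{\beta,0}\circ\tau_{\beta,1}\circ\cdots\circ\tau_{\beta,k-1})(G_{k}(z))$, $k\geq 1$) $$G(z)=\cfrac{{\bf 1}}{\beta_{0}(z)+\beta^{+}_0\cfrac{{\bf 1}}{\beta_{1}(z)+\beta^{+}_1\cfrac{{\bf 1}}{\beta_{2}(z)+\beta^{+}_2\cfrac{{\bf 1}}{\beta_{3}(z)+\ddots}\,\beta^{ - }_2}\,\beta^{ - }_1}\,\beta^{ - }_0}.$$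
   Context: Fix integers $p,q\geq 1$ and, for each $-p\leq k\leq q$, a bi-infinite sequence $(a^{(k)}_{n})_{n\in\mathbb{Z}}$ of complex numbers. $\mathbb{C}((z^{ -1}))$ is the field of formal series $\sum_{n\in\mathbb{Z}}a_nz^n$ with complex coefficients and only finitely many nonzero $a_n$ with $n>0$. Paths. A step is an ordered pair $(n,m)\rightarrow(n+1,m')$ with $n\in\mathbb{Z}_{\geq 0}$, $m,m'\in\mathbb{Z}$ and $-p\leq m'-m\leq q$. Its weight is $a_m^{(i)}$ if $m'=m+i$ with $0\leq i\leq q$, and $a_{m-j}^{(-j)}$ if $m'=m-j$ with $1\leq j\leq p$. A lattice path of length $k$ is a sequence of $k$ steps in which the final vertex of each step is the initial vertex of the next; a path of length zero is a single vertex. The weight $w(\gamma)$ of a path is the product of the weights of its steps ($1$ for length zero). Empty sums are zero. For $n\geq 0$, $i,j\in\mathbb{Z}$, $\mathcal{P}_{[n,i,j]}$ is the collection of all lattice paths of length $n$ from $(0,i)$ to $(n,j)$; for $i,j\leq -1$, $\widehat{\mathcal{D}}_{[n,i,j]}\subset\mathcal{P}_{[n,i,j]}$ consists of the paths that never go above the line $y=-1$. Put $W_{[n,i,j]}=\sum_{\gamma\in\mathcal{P}_{[n,i,j]}}w(\gamma)$, $V_{[n,i,j]}=\sum_{\gamma\in\widehat{\mathcal{D}}_{[n,i,j]}}w(\gamma)$, and $$W_{i,j}(z)=\sum_{n=0}^\infty\frac{W_{[n,i,j]}}{z^{n+1}}\ (i,j\in\mathbb{Z}),\qquad V_{i,j}(z)=\sum_{n=0}^\infty\frac{V_{[n,i,j]}}{z^{n+1}}\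 (i,j\leq -1).$$ $G(z)$ is the $q\times p$ matrix $(W_{i,j}(z))_{0\leq i\leq q-1,\,0\leq j\leq p-1}$. Pseudo-quotient. For a $q\times p$ matrix $A=(a_{i,j})_{0\leq i\leq q-1,\,0\leq j\leq p-1}$ over a field (here $\mathbb{C}((z^{ -1}))$) with $a_{0,0}\neq 0$, let $T(A)=B=(b_{i,j})$ be the $q\times p$ matrix with $$b_{i,j}=\frac{a_{i+1,j+1}a_{0,0}-a_{0,j+1}a_{i+1,0}}{a_{0,0}}\ (0\leq i\leq q-2,\ 0\leq j\leq p-2),\quad b_{q-1,j}=-\frac{a_{0,j+1}}{a_{0,0}}\ (0\leq j\leq p-2),$$ $$b_{i,p-1}=\frac{a_{i+1,0}}{a_{0,0}}\ (0\leq i\leq q-2),\qquad b_{q-1,p-1}=\frac{1}{a_{0,0}}.$$ $T$ is a bijection from matrices with $a_{0,0}\neq 0$ onto matrices with $b_{q-1,p-1}\neq 0$; write $A=\frac{\mathbf 1}{B}$ if $B=T(A)$. Coefficients. For $k\geq\min(p,q)$ put $d_k^{(i)}=a_k^{(i)}$ for $-p\leq i\leq q$. For $0\leq k\leq\min(p,q)-1$ put $$d^{(0)}_{k}=a^{(0)}_{k}+\sum_{l=1}^{p-k}\sum_{m=1}^{q-k}a^{(-(l+k))}_{ -l}a^{(m+k)}_{ -m}V_{ -l,-m}(z),$$ $$d^{(i)}_{k}=a^{(i)}_{k}+\sum_{l=1}^{p-k}\sum_{m=1}^{q-(k+i)}a^{(-(l+k))}_{ -l}a^{(m+k+i)}_{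 -m}V_{ -l,-m}(z)\ (1\leq i\leq q-k-1),\quad d_k^{(i)}=a_k^{(i)}\ (q-k\leq i\leq q),$$ $$d^{(-j)}_{k}=a^{(-j)}_{k}+\sum_{l=1}^{p-(k+j)}\sum_{m=1}^{q-k}a^{(-(l+k+j))}_{ -l}a^{(m+k)}_{ -m}V_{ -l,-m}(z)\ (1\leq j\leq p-k-1),\quad d_k^{(-j)}=a_k^{(-j)}\ (p-k\leq j\leq p),$$ where ranges of indices involving $i\ge1$, $j\ge1$ are implied. For $k\geq 0$: $\beta_k(z)$ is the $q\times p$ matrix whose only nonzero entry is $z-d_k^{(0)}$ in the bottom right corner; $\beta_k^+$ is the $q\times q$ matrix equal to the identity except that its last row is $(-d_k^{(1)},\ldots,-d_k^{(q)})$; $\beta_k^-$ is the $p\times p$ matrix equal to the identity except that its last column is $(d_k^{(-1)},\ldots,d_k^{(-p)})^t$. For $q\times p$ matrices $X$, $$\tau_{\beta,k}(X)=\frac{\mathbf 1}{\beta_k(z)+\beta_k^+X\beta_k^- }.$$ The matrices $K$, $K_r$, $G_r$. Let $h_{i,j}=a^{(j-i)}_{\min(i,j)}$ if $-p\leq j-i\leq q$ and $h_{i,j}=0$ otherwise ($i,j\geq 0$). Let $K=(K_{i,j})_{i,j\geq 0}$ with $$K_{i,j}=h_{i,j}+\sum_{l=1}^{p-i}\sum_{m=1}^{q-j}a^{(-(l+i))}_{ -l}a^{(m+j)}_{ -m}V_{ -l,-m}(z),\qquad 0\leq i\leq p-1,\ 0\leq j\leq q-1,$$ and $K_{i,j}=h_{i,j}$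 otherwise. (Thus $d_k^{(i)}=K_{k,k+i}$ for $0\leq i\leq q$ and $d_k^{(-j)}=K_{k+j,k}$ for $1\leq j\leq p$.) For $r\geq 1$, $K_r$ is $K$ with its first $r$ rows and first $r$ columns deleted. Consider the ring (under usual matrix operations) of matrices $(f_{i,j}(z))_{i,j\geq 0}$ over $\mathbb{C}((z^{ -1}))$ such that (1) there is $d\in\mathbb{Z}$ with $\deg f_{i,j}\leq d$ for all $i,j$, where $\deg$ is the largest exponent with nonzero coefficient, and (2) for every $n\leq d$ and $j\geq 0$ there is $\ell\geq 0$ such that the coefficient of $z^n$ in $f_{i,j}$ is zero for all $i\geq\ell$. The matrix $zI-K_r$ is invertible in this ring; $\zeta^{(r)}_{i,j}(z)$ denotes the $(i,j)$-entry of $(zI-K_r)^{ -1}$, $i,j\geq 0$, and $$G_r(z)=(\zeta^{(r)}_{i,j}(z))_{0\leq i\leq q-1,\,0\leq j\leq p-1},\qquad r\geq 1.$$ -}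

module Defs where

open import Level using (_⊔_; Lift)
open import Algebra.Apartness.Bundles using (HeytingField; HeytingCommutativeRing)
open import Algebra.Bundles using (CommutativeRing; RawMonoid)
import Algebra.Definitions.RawMonoid as RawMonoidDefs
import Algebra.Properties.Ring as RingProperties
open import Data.Bool.Base using (if_then_else_; _∧_)
open import Data.Fin.Base as Fin using (Fin; zero; suc; toℕ; fromℕ; inject₁)
import Data.Fin.Properties as Fin
open import Data.Integer.Base as ℤ using (ℤ; +_; -[1+_]; 0ℤ; 1ℤ; -1ℤ)
import Data.Integer.Properties as ℤ
open import Data.List.Base as List using (List; []; _∷_)
open import Data.List.Relation.Unary.All as All using (All)
open import Data.Nat.Base as ℕ using (ℕ; zero; suc; _∸_; _⊓_)
import Data.Nat.Properties as ℕ
open import Data.Product.Base using (∃; ∃-syntax; _×_; _,_)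
open import Data.Vec.Base using (Vec; []; _∷_)
open import Relation.Binary.PropositionalEquality.Core as ≡ using (_≡_)
open import Relation.Nullary.Decidable.Core using (Dec; yes; no; does)
open import Relation.Nullary.Negation.Core using (contradiction)

-- The library has no complex numbers.  All definitions are made over an
-- arbitrary (Heyting) field F; nothing but field arithmetic is used.

------------------------------------------------------------------------
-- F((z⁻¹))

module LaurentSeries {c ℓ₁ ℓ₂} (F : HeytingField c ℓ₁ ℓ₂) where

  open HeytingField F public
    using (_≈_; _#_; _+_; _*_; -_; 0#; 1#; heytingCommutativeRing)
    renaming (Carrier to C)
  open CommutativeRing (HeytingCommutativeRing.commutativeRing heytingCommutativeRing)
    using (ring; refl; sym; trans; reflexive; +-cong; -‿cong; +-identityˡ)
    renaming (rawRing to rawRingF; +-rawMonoid to +-rawMonoidF)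

  open RawMonoidDefs +-rawMonoidF public
    using () renaming (sum to sumC)

  -- ∑ coeff n · zⁿ.  The field `top` is an upper bound for the degree; it
  -- need not be attained and is ignored by equality.
  record Laurent : Set (c ⊔ ℓ₁) where
    field
      coeff  : ℤ → C
      top    : ℤ
      vanish : ∀ n → top ℤ.< n → coeff n ≈ 0#

  open Laurent public

  infix  4 _≋_
  infixl 6 _⊕_ _⊝_
  infixl 7 _⊛_
  infix  8 ⊝_

  _≋_ : Laurent → Laurent → Set ℓ₁
  f ≋ g = ∀ n → coeff f n ≈ coeff g n

  monomial : C → ℤ → Laurent
  monomial x d = record
    { coeff  = λ n → if does (n ℤ.≟ d) then x else 0#
    ; top    = d
    ; vanish = van
    }
    where
    van : ∀ n → d ℤ.< n → (if does (n ℤ.≟ d) then x else 0#) ≈ 0#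
    van n d<n with n ℤ.≟ d
    ... | yes n≡d = contradiction (≡.sym n≡d) (ℤ.<⇒≢ d<n)
    ... | no  _   = refl

  const : C → Laurent
  const x = monomial x 0ℤ

  0ᴸ 1ᴸ z : Laurent
  0ᴸ = const 0#
  1ᴸ = const 1#
  z  = monomial 1# 1ℤ

  _⊕_ : Laurent → Laurent → Laurent
  f ⊕ g = record
    { coeff  = λ n → coeff f n + coeff g n
    ; top    = top f ℤ.⊔ top g
    ; vanish = λ n lt → trans
        (+-cong (vanish f n (ℤ.≤-<-trans (ℤ.i≤i⊔j (top f) (top g)) lt))
                (vanish g n (ℤ.≤-<-trans (ℤ.i≤j⊔i (top f) (top g)) lt)))
        (+-identityˡ 0#)
    }

  ⊝_ : Laurent → Laurent
  ⊝ f = record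
    { coeff  = λ n → - coeff f n
    ; top    = top f
    ; vanish = λ n lt → trans (-‿cong (vanish f n lt)) (RingProperties.-0#≈0# ring)
    }

  _⊝_ : Laurent → Laurent → Laurent
  f ⊝ g = f ⊕ (⊝ g)

  terms : ℤ → ℕ
  terms (+ n)    = suc n
  terms -[1+ _ ] = 0

  -- The coefficient of zⁿ in f · g is ∑ₛ fₛ gₙ₋ₛ.  Only n - top g ≤ s ≤ top f
  -- can contribute, so put s = top f - t with 0 ≤ t ≤ top f + top g - n.
  convolution : Laurent → Laurent → ℤ → C
  convolution f g n =
    sumC {terms (top f ℤ.+ top g ℤ.- n)} λ t →
      let s = top f ℤ.- + toℕ t in coeff f s * coeff g (n ℤ.- s)

  _⊛_ : Laurent → Laurent → Laurent
  f ⊛ g = record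
    { coeff  = convolution f g
    ; top    = top f ℤ.+ top g
    ; vanish = λ n lt →
        empty n (≡.subst (top f ℤ.+ top g ℤ.- n ℤ.<_) (ℤ.+-inverseʳ n)
                  (ℤ.+-monoˡ-< (ℤ.- n) lt))
    }
    where
    empty : ∀ n → top f ℤ.+ top g ℤ.- n ℤ.< 0ℤ → convolution f g n ≈ 0#
    empty n lt with top f ℤ.+ top g ℤ.- n
    empty n (ℤ.+<+ ()) | + _
    empty n _          | -[1+ _ ] = refl

  ⊕-rawMonoid : RawMonoid (c ⊔ ℓ₁) ℓ₁
  ⊕-rawMonoid = record { _≈_ = _≋_ ; _∙_ = _⊕_ ; ε = 0ᴸ }

  open RawMonoidDefs ⊕-rawMonoid public
    using () renaming (sum to sumᴸ)

  ∑[1⋯_] : ℕ → (ℕ → Laurent) → Laurent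
  ∑[1⋯ N ] f = sumᴸ {N} λ t → f (suc (toℕ t))

  -- ∑ₙ uₙ / zⁿ⁺¹
  generating : (ℕ → C) → Laurent
  generating u = record
    { coeff  = λ { (+ _) → 0# ; -[1+ n ] → u n }
    ; top    = -1ℤ
    ; vanish = λ { (+ _) _ → refl ; -[1+ n ] (ℤ.-<- ()) }
    }

  -- The formal infinite sum of u: every coefficient of the partial sums is
  -- eventually constant, with value the corresponding coefficient of s.
  HasSum : (ℕ → Laurent) → Laurent → Set ℓ₁
  HasSum u s = ∀ n → ∃[ N ] ∀ N′ → N ℕ.≤ N′ →
    coeff (sumᴸ {N′} λ l → u (toℕ l)) n ≈ coeff s n

  ----------------------------------------------------------------------
  -- Finite matrices

  Matrix : ℕ → ℕ → Set (c ⊔ ℓ₁)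
  Matrix m n = Fin m → Fin n → Laurent

  infix  4 _≋ᴹ_
  infixl 6 _⊕ᴹ_
  infixl 7 _⊛ᴹ_

  _≋ᴹ_ : ∀ {m n} → Matrix m n → Matrix m n → Set ℓ₁
  A ≋ᴹ B = ∀ i j → A i j ≋ B i j

  _⊕ᴹ_ : ∀ {m n} → Matrix m n → Matrix m n → Matrix m n
  (A ⊕ᴹ B) i j = A i j ⊕ B i j

  _⊛ᴹ_ : ∀ {m n r} → Matrix m n → Matrix n r → Matrix m r
  (A ⊛ᴹ B) i j = sumᴸ λ l → A i l ⊛ B l j

  -- A = 𝟏/B, that is, a₀₀ ≠ 0 and B = T(A).  Here a₀₀⁻¹ is the multiplicative
  -- inverse of a₀₀; `inject₁` runs over all indices but the last, `fromℕ _` is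
  -- the last index.
  record _≋𝟏/_ {q′ p′} (A B : Matrix (suc q′) (suc p′)) : Set (c ⊔ ℓ₁ ⊔ ℓ₂) where
    a₀₀ : Laurent
    a₀₀ = A zero zero
    field
      a₀₀≠0     : ∃[ n ] (coeff a₀₀ n # 0#)
      a₀₀⁻¹     : Laurent
      isInverse : a₀₀ ⊛ a₀₀⁻¹ ≋ 1ᴸ
      inner     : ∀ i j → B (inject₁ i) (inject₁ j) ≋
                    (A (suc i) (suc j) ⊛ a₀₀ ⊝ A zero (suc j) ⊛ A (suc i) zero) ⊛ a₀₀⁻¹
      lastRow   : ∀ j → B (fromℕ q′) (inject₁ j) ≋ ⊝ (A zero (suc j) ⊛ a₀₀⁻¹)
      lastCol   : ∀ i → B (inject₁ i) (fromℕ p′) ≋ A (suc i) zero ⊛ a₀₀⁻¹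
      corner    : B (fromℕ q′) (fromℕ p′) ≋ a₀₀⁻¹

  infix 4 _≋𝟏/_

  ----------------------------------------------------------------------
  -- The ring of matrices (fᵢⱼ) with i, j ≥ 0

  InfMatrix : Set (c ⊔ ℓ₁)
  InfMatrix = ℕ → ℕ → Laurent

  record InRing (f : InfMatrix) : Set ℓ₁ where
    field
      d            : ℤ
      degree≤d     : ∀ i j n → d ℤ.< n → coeff (f i j) n ≈ 0#
      columnFinite : ∀ n → n ℤ.≤ d → ∀ j →
                       ∃[ ℓ ] ∀ i → ℓ ℕ.≤ i → coeff (f i j) n ≈ 0#

  I∞ : InfMatrix
  I∞ i j = if does (i ℕ.≟ j) then 1ᴸ else 0ᴸ

  IsProduct : (f g h : InfMatrix) → Set ℓ₁
  IsProduct f g h = ∀ i j → HasSum (λ l → f i l ⊛ g l j) (h i j)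

  record IsInverse (f g : InfMatrix) : Set ℓ₁ where
    field
      f∈ring   : InRing f
      g∈ring   : InRing g
      inverseʳ : IsProduct f g I∞
      inverseˡ : IsProduct g f I∞

------------------------------------------------------------------------
-- Here p = suc p′ and q = suc q′, so that p, q ≥ 1, and a k n is the n-th term
-- of the sequence a⁽ᵏ⁾.  The values a k n with k < -p or k > q are never used.

module ContinuedFraction
  {c ℓ₁ ℓ₂} (F : HeytingField c ℓ₁ ℓ₂) (p′ q′ : ℕ)
  (a : ℤ → ℤ → HeytingField.Carrier F) where

  open LaurentSeries F public

  p q : ℕ
  p = suc p′
  q = suc q′

  ----------------------------------------------------------------------
  -- Lattice paths

  -- The p + q + 1 possible steps (n , m) → (n + 1 , m + increment s).
  Step : Set
  Step = Fin (suc (p ℕ.+ q))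

  increment : Step → ℤ
  increment s = + toℕ s ℤ.- + p

  -- The weight of the step from height m to height m + k.
  stepWeight : ℤ → ℤ → C
  stepWeight m (+ i)      = a (+ i) m
  stepWeight m (-[1+ j ]) = a -[1+ j ] (m ℤ.- + suc j)

  -- A path of length n, given its initial vertex (0 , i), is determined by its
  -- list of steps.
  allPaths : ∀ n → List (Vec Step n)
  allPaths zero    = [] ∷ []
  allPaths (suc n) = List.cartesianProductWith _∷_ (List.allFin _) (allPaths n)

  heights : ∀ {n} → ℤ → Vec Step n → List ℤ
  heights i []      = i ∷ []
  heights i (s ∷ γ) = i ∷ heights (i ℤ.+ increment s) γ

  finalHeight : ∀ {n} → ℤ → Vec Step n → ℤ
  finalHeight i []      = i
  finalHeight i (s ∷ γ) = finalHeight (i ℤ.+ increment s) γ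

  weight : ∀ {n} → ℤ → Vec Step n → C
  weight i []      = 1#
  weight i (s ∷ γ) = stepWeight i (increment s) * weight (i ℤ.+ increment s) γ

  𝒫 : ∀ n → ℤ → ℤ → List (Vec Step n)
  𝒫 n i j = List.filter (λ γ → finalHeight i γ ℤ.≟ j) (allPaths n)

  𝒟̂ : ∀ n → ℤ → ℤ → List (Vec Step n)
  𝒟̂ n i j = List.filter (λ γ → All.all? (ℤ._≤? -1ℤ) (heights i γ)) (𝒫 n i j)

  totalWeight : ∀ {n} → ℤ → List (Vec Step n) → C
  totalWeight i γs = List.foldr _+_ 0# (List.map (weight i) γs)

  W V : ℤ → ℤ → Laurent
  W i j = generating λ n → totalWeight i (𝒫 n i j)
  V i j = generating λ n → totalWeight i (𝒟̂ n i j)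

  G : Matrix q p
  G i j = W (+ toℕ i) (+ toℕ j)

  ----------------------------------------------------------------------
  -- Coefficients of the continued fraction

  -- Empty when i ≥ p or j ≥ q.
  correction : ℕ → ℕ → Laurent
  correction i j =
    ∑[1⋯ p ∸ i ] λ l → ∑[1⋯ q ∸ j ] λ m →
      const (a (ℤ.- + (l ℕ.+ i)) (ℤ.- + l) * a (+ (m ℕ.+ j)) (ℤ.- + m))
        ⊛ V (ℤ.- + l) (ℤ.- + m)

  -- d⁺ k i is d_k⁽ⁱ⁾ for 0 ≤ i ≤ q, and d⁻ k j is d_k⁽⁻ʲ⁾ for 1 ≤ j ≤ p.  In the
  -- cases where these are defined to be a_k⁽ⁱ⁾ and a_k⁽⁻ʲ⁾ (that is,
  -- k ≥ min(p, q), or i ≥ q - k, or j ≥ p - k) the correction is an empty sum.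
  d⁺ d⁻ : ℕ → ℕ → Laurent
  d⁺ k i = const (a (+ i) (+ k))       ⊕ correction k (k ℕ.+ i)
  d⁻ k j = const (a (ℤ.- + j) (+ k))   ⊕ correction (k ℕ.+ j) k

  β : ℕ → Matrix q p
  β k i j = if does (i Fin.≟ fromℕ q′) ∧ does (j Fin.≟ fromℕ p′)
            then z ⊝ d⁺ k 0 else 0ᴸ

  β⁺ : ℕ → Matrix q q
  β⁺ k i j = if does (i Fin.≟ fromℕ q′) then ⊝ d⁺ k (suc (toℕ j))
             else (if does (i Fin.≟ j) then 1ᴸ else 0ᴸ)

  β⁻ : ℕ → Matrix p p
  β⁻ k i j = if does (j Fin.≟ fromℕ p′) then d⁻ k (suc (toℕ i))
             else (if does (i Fin.≟ j) then 1ᴸ else 0ᴸ)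

  -- τ is a partial map: τ k X Y says that τ_{β,k}(X) is defined and equals Y.
  τ : ℕ → Matrix q p → Matrix q p → Set (c ⊔ ℓ₁ ⊔ ℓ₂)
  τ k X Y = Y ≋𝟏/ (β k ⊕ᴹ β⁺ k ⊛ᴹ X ⊛ᴹ β⁻ k)

  -- (τ_{β,0} ∘ ⋯ ∘ τ_{β,k-1})(X) is defined and equals Y.
  τ∘⋯∘τ : ℕ → Matrix q p → Matrix q p → Set (c ⊔ ℓ₁ ⊔ ℓ₂)
  τ∘⋯∘τ zero    X Y = Lift (c ⊔ ℓ₁ ⊔ ℓ₂) (X ≋ᴹ Y)
  τ∘⋯∘τ (suc k) X Y = ∃[ X′ ] (τ k X X′ × τ∘⋯∘τ k X′ Y)

  ----------------------------------------------------------------------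
  -- The matrices K, zI - K_r and G_r

  h : ℕ → ℕ → C
  h i j = if does (ℤ.- + p ℤ.≤? + j ℤ.- + i) ∧ does (+ j ℤ.- + i ℤ.≤? + q)
          then a (+ j ℤ.- + i) (+ (i ⊓ j)) else 0#

  K : InfMatrix
  K i j = const (h i j) ⊕ correction i j

  zI-K : ℕ → InfMatrix
  zI-K r i j = z ⊛ I∞ i j ⊝ K (r ℕ.+ i) (r ℕ.+ j)

  -- G_r, when applied to the inverse of zI-K r.
  block : InfMatrix → Matrix q p
  block ζ i j = ζ (toℕ i) (toℕ j)

{-# OPTIONS --safe #-}
module Submission where

-- K_r has degree ≤ 0 and finitely many nonzero entries in each row.  Hence two solutions of (z I - K_r) x = b of
-- bounded degree that agree above degree d agree above degree d - 1, and so they are equal.  Three consequences: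
-- a right inverse of z I - K_r is a left inverse;  (z I - K_r)⁻¹ is obtained from (z I - K_{r+1})⁻¹ by the Schur
-- complement formulas, which are those of T;  and, cutting a path from a negative height at its first visit to a
-- height ≥ 0, the negative heights can be eliminated from the first-step recurrence of the paths.
-- For paths that avoid the heights 0, …, r - 1, this elimination turns the matrix of step weights
-- into K_r, so the generating functions of these paths form (z I - K_r)⁻¹, and for r = 0 they are the W_{i,j}.

open import Level as Level using (_⊔_; lift)
open import Algebra.Apartness.Bundles using (HeytingField; HeytingCommutativeRing)
import Algebra.Apartness.Properties.HeytingCommutativeRing as HeytingProperties
open import Algebra.Bundles using (CommutativeRing; CommutativeSemiring)
import Algebra.Properties.CommutativeSemigroup as CommutativeSemigroupProperties
import Algebra.Properties.Ring as RingProperties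
import Algebra.Properties.Semiring.Sum as SemiringSum
open import Algebra.Structures using (IsCommutativeRing)
open import Data.Bool.Base using (Bool; if_then_else_; true; false; _∧_)
import Data.Bool.Properties as Bool
open import Data.Fin.Base as Fin using (Fin; zero; suc; toℕ; fromℕ; inject₁)
import Data.Fin.Properties as Fin
open import Data.Integer.Base as ℤ using (ℤ; +_; -[1+_]; 0ℤ; 1ℤ; -1ℤ)
import Data.Integer.Properties as ℤ
open import Data.Integer.Tactic.RingSolver using (solve-∀)
open import Data.List.Base as List using (List; []; _∷_)
open import Data.List.Relation.Unary.All as All using (All)
open import Data.Nat.Base as ℕ using (ℕ; zero; suc; _≤_; _<_; z≤n; s≤s)
import Data.Nat.Properties as ℕ
open import Data.Product.Base using (∃; _×_; _,_)
open import Data.Sum.Base using (_⊎_; inj₁; inj₂)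
open import Data.Vec.Base using (Vec; []; _∷_)
open import Function.Base using (_∘_; id)
open import Relation.Binary.PropositionalEquality.Core as ≡ using (_≡_; _≢_)
open import Relation.Nullary.Decidable using (dec-true; dec-false)
open import Relation.Nullary.Decidable.Core using (yes; no; does)
open import Relation.Nullary.Negation.Core using (contradiction)
open import Relation.Unary using (Pred; Decidable)
open import Defs

-- Finite sums and power series

-- The obstacle is division. Over a Heyting field equality of series is not assumed decidable, so
-- Laurent series enter the main argument only as a commutative ring with a degree (`DegreeRing`),
-- and every inverse is exhibited: the inverse of the upper left entry is the Schur complement
-- `pivot`, and that entry is apart from 0 because its coefficient at 1/z is the weight of the path
-- of length zero. Infinite matrix products are avoided as well. An equation (z I - A) x = b is kept
-- as the family of its truncations, in which each row is a finite sum; what associativity of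
-- infinite products would give is obtained from uniqueness of bounded solutions. The corrections in
-- K have a meaning in terms of paths: `V` is the resolvent of the steps among the negative heights,
-- and a correction term is a step down across 0, an excursion counted by `V`, and a step back up.

module Sums {c ℓ} (R : CommutativeSemiring c ℓ) where

  open CommutativeSemiring R hiding (zero)
  open SemiringSum semiring using (sum; ∑-distrib-+; ∑-comm; *-distribˡ-sum; *-distribʳ-sum)
  open import Relation.Binary.Reasoning.Setoid setoid

  sum-cong : ∀ {n} {f g : Fin n → Carrier} → (∀ t → f t ≈ g t) → sum f ≈ sum g
  sum-cong {zero}  f≈g = refl
  sum-cong {suc n} f≈g = +-cong (f≈g zero) (sum-cong (f≈g ∘ suc))

  -- Opaque, so that the summand can be inferred from a sum.
  opaque
    ∑ : ℕ → (ℕ → Carrier) → Carrier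
    ∑ n f = sum {n} λ t → f (toℕ t)

    ∑≡sum : ∀ n f → ∑ n f ≡ sum {n} λ t → f (toℕ t)
    ∑≡sum n f = ≡.refl

    ∑-empty : ∀ f → ∑ 0 f ≈ 0#
    ∑-empty f = refl

    ∑-suc : ∀ n f → ∑ (suc n) f ≈ f 0 + ∑ n λ t → f (suc t)
    ∑-suc n f = refl

    ∑-cong : ∀ n {f g : ℕ → Carrier} → (∀ t → t < n → f t ≈ g t) → ∑ n f ≈ ∑ n g
    ∑-cong n f≈g = sum-cong λ t → f≈g (toℕ t) (Fin.toℕ<n t)

    ∑-+ : ∀ n (f g : ℕ → Carrier) → ∑ n (λ t → f t + g t) ≈ ∑ n f + ∑ n g
    ∑-+ n f g = ∑-distrib-+ {n} (f ∘ toℕ) (g ∘ toℕ)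

    ∑-swap : ∀ m n (f : ℕ → ℕ → Carrier) →
             ∑ m (λ s → ∑ n (f s)) ≈ ∑ n (λ t → ∑ m λ s → f s t)
    ∑-swap m n f = ∑-comm {m} {n} λ s t → f (toℕ s) (toℕ t)

    *-∑ : ∀ n x (f : ℕ → Carrier) → x * ∑ n f ≈ ∑ n (λ t → x * f t)
    *-∑ n x f = *-distribˡ-sum {n} x (f ∘ toℕ)

    ∑-* : ∀ n x (f : ℕ → Carrier) → ∑ n f * x ≈ ∑ n (λ t → f t * x)
    ∑-* n x f = *-distribʳ-sum {n} x (f ∘ toℕ)

  ∑-zero : ∀ n {f : ℕ → Carrier} → (∀ t → t < n → f t ≈ 0#) → ∑ n f ≈ 0#
  ∑-zero zero    f≈0 = ∑-empty _
  ∑-zero (suc n) f≈0 = trans (∑-suc n _) (trans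
    (+-cong (f≈0 0 (s≤s z≤n)) (∑-zero n λ t t<n → f≈0 (suc t) (s≤s t<n)))
    (+-identityˡ 0#))

  ∑-extend : ∀ {m n} {f : ℕ → Carrier} → m ≤ n → (∀ t → m ≤ t → f t ≈ 0#) →
             ∑ n f ≈ ∑ m f
  ∑-extend {n = n} z≤n       f≈0 = trans (∑-zero n λ t _ → f≈0 t z≤n) (sym (∑-empty _))
  ∑-extend         (s≤s m≤n) f≈0 = trans (∑-suc _ _) (trans
    (+-congˡ (∑-extend m≤n λ t m≤t → f≈0 (suc t) (s≤s m≤t)))
    (sym (∑-suc _ _)))

  ∑-shift : ∀ r {n} {f : ℕ → Carrier} → (∀ t → t < r → f t ≈ 0#) →
            ∑ (r ℕ.+ n) f ≈ ∑ n λ t → f (r ℕ.+ t)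
  ∑-shift zero    f≈0 = refl
  ∑-shift (suc r) f≈0 = trans (∑-suc _ _) (trans
    (+-cong (f≈0 0 (s≤s z≤n)) (∑-shift r λ t t<r → f≈0 (suc t) (s≤s t<r)))
    (+-identityˡ _))

  ∑-split : ∀ m {n} (f : ℕ → Carrier) → ∑ (m ℕ.+ n) f ≈ ∑ m f + ∑ n λ t → f (m ℕ.+ t)
  ∑-split zero    f = sym (trans (+-congʳ (∑-empty f)) (+-identityˡ _))
  ∑-split (suc m) f = begin
    ∑ (suc m ℕ.+ _) f                                ≈⟨ ∑-suc _ f ⟩
    f 0 + ∑ (m ℕ.+ _) (f ∘ suc)                      ≈⟨ +-congˡ (∑-split m (f ∘ suc)) ⟩
    f 0 + (∑ m (f ∘ suc) + ∑ _ λ t → f (suc m ℕ.+ t)) ≈⟨ +-assoc _ _ _ ⟨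
    f 0 + ∑ m (f ∘ suc) + ∑ _ (λ t → f (suc m ℕ.+ t)) ≈⟨ +-congʳ (∑-suc m f) ⟨
    ∑ (suc m) f + ∑ _ (λ t → f (suc m ℕ.+ t))         ∎

  ∑-last : ∀ n (f : ℕ → Carrier) → ∑ (suc n) f ≈ ∑ n f + f n
  ∑-last n f = begin
    ∑ (suc n) f                       ≡⟨ ≡.cong (λ m → ∑ m f) (ℕ.+-comm n 1) ⟨
    ∑ (n ℕ.+ 1) f                     ≈⟨ ∑-split n f ⟩
    ∑ n f + ∑ 1 (λ t → f (n ℕ.+ t))   ≈⟨ +-congˡ (∑-suc 0 _) ⟩
    ∑ n f + (f (n ℕ.+ 0) + ∑ 0 _)     ≈⟨ +-congˡ (+-congˡ (∑-empty λ t → f (n ℕ.+ suc t))) ⟩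
    ∑ n f + (f (n ℕ.+ 0) + 0#)        ≈⟨ +-congˡ (+-identityʳ _) ⟩
    ∑ n f + f (n ℕ.+ 0)               ≡⟨ ≡.cong (λ m → ∑ n f + f m) (ℕ.+-identityʳ n) ⟩
    ∑ n f + f n                       ∎

  δ : ℕ → ℕ → Carrier
  δ i j = if does (i ℕ.≟ j) then 1# else 0#

  δ-diag : ∀ i → δ i i ≈ 1#
  δ-diag zero    = refl
  δ-diag (suc i) = δ-diag i

  δ-off : ∀ {i j} → i ≢ j → δ i j ≈ 0#
  δ-off {zero}  {zero}  i≢j = contradiction ≡.refl i≢j
  δ-off {zero}  {suc j} i≢j = refl
  δ-off {suc i} {zero}  i≢j = refl
  δ-off {suc i} {suc j} i≢j = δ-off (i≢j ∘ ≡.cong suc)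

  δ-sym : ∀ i j → δ i j ≈ δ j i
  δ-sym zero    zero    = refl
  δ-sym zero    (suc j) = refl
  δ-sym (suc i) zero    = refl
  δ-sym (suc i) (suc j) = δ-sym i j

  -- The hypothesis admits an index `i` beyond the range of summation, where `f i` may vanish
  -- because a matrix is banded or a right-hand side has finite support.
  ∑-δ : ∀ n i (f : ℕ → Carrier) → (n ≤ i → f i ≈ 0#) → ∑ n (λ t → δ i t * f t) ≈ f i
  ∑-δ zero    i       f f≈0 = trans (∑-empty _) (sym (f≈0 z≤n))
  ∑-δ (suc n) zero    f f≈0 = begin
    ∑ (suc n) (λ t → δ 0 t * f t)         ≈⟨ ∑-suc n _ ⟩
    1# * f 0 + ∑ n (λ t → 0# * f (suc t)) ≈⟨ +-cong (*-identityˡ _) (∑-zero n λ t _ → zeroˡ _) ⟩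
    f 0 + 0#                              ≈⟨ +-identityʳ _ ⟩
    f 0                                   ∎
  ∑-δ (suc n) (suc i) f f≈0 = begin
    ∑ (suc n) (λ t → δ (suc i) t * f t)      ≈⟨ ∑-suc n _ ⟩
    0# * f 0 + ∑ n (λ t → δ i t * f (suc t)) ≈⟨ +-cong (zeroˡ _) (∑-δ n i (f ∘ suc) (f≈0 ∘ s≤s)) ⟩
    0# + f (suc i)                           ≈⟨ +-identityˡ _ ⟩
    f (suc i)                                ∎

  ∑-*-δ : ∀ n j (f : ℕ → Carrier) → (n ≤ j → f j ≈ 0#) → ∑ n (λ t → f t * δ t j) ≈ f j
  ∑-*-δ n j f f≈0 = trans
    (∑-cong n λ t _ → trans (*-comm _ _) (*-congʳ (δ-sym t j)))
    (∑-δ n j f f≈0)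

module PowerSeries {c ℓ} (R : CommutativeSemiring c ℓ) where

  open CommutativeSemiring R hiding (zero)
  open Sums R
  open import Relation.Binary.Reasoning.Setoid setoid

  infixl 7 _⋆_
  _⋆_ : (ℕ → Carrier) → (ℕ → Carrier) → (ℕ → Carrier)
  (u ⋆ v) k = ∑ (suc k) λ t → u t * v (k ℕ.∸ t)

  ⋆-cong : ∀ {u u′ v v′} → (∀ t → u t ≈ u′ t) → (∀ t → v t ≈ v′ t) →
           ∀ k → (u ⋆ v) k ≈ (u′ ⋆ v′) k
  ⋆-cong u≈ v≈ k = ∑-cong (suc k) λ t _ → *-cong (u≈ t) (v≈ (k ℕ.∸ t))

  ⋆-distribʳ : ∀ w u v k → ((λ t → u t + v t) ⋆ w) k ≈ (u ⋆ w) k + (v ⋆ w) k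
  ⋆-distribʳ w u v k = trans (∑-cong (suc k) λ t _ → distribʳ _ _ _)
    (∑-+ (suc k) (λ t → u t * w (k ℕ.∸ t)) (λ t → v t * w (k ℕ.∸ t)))

  ⋆-scale : ∀ x u v k → ((λ t → x * u t) ⋆ v) k ≈ x * (u ⋆ v) k
  ⋆-scale x u v k = trans (∑-cong (suc k) λ t _ → *-assoc _ _ _)
    (sym (*-∑ (suc k) x λ t → u t * v (k ℕ.∸ t)))

  ⋆-suc : ∀ u v k → (u ⋆ v) (suc k) ≈ u 0 * v (suc k) + ((u ∘ suc) ⋆ v) k
  ⋆-suc u v k = ∑-suc (suc k) λ t → u t * v (suc k ℕ.∸ t)

  ⋆-zero : ∀ u v → (u ⋆ v) 0 ≈ u 0 * v 0
  ⋆-zero u v = trans (∑-suc 0 _) (trans (+-congˡ (∑-empty λ t → u (suc t) * v (0 ℕ.∸ suc t))) (+-identityʳ _))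

  -- Mirror image of `⋆-suc`. Commutativity needs both, since exchanging the factors exchanges the
  -- two ends of the sum.
  ⋆-last : ∀ u v k → (u ⋆ v) (suc k) ≈ (u ⋆ (v ∘ suc)) k + u (suc k) * v 0
  ⋆-last u v zero    = begin
    (u ⋆ v) 1                          ≈⟨ ⋆-suc u v 0 ⟩
    u 0 * v 1 + ((u ∘ suc) ⋆ v) 0      ≈⟨ +-cong (sym (⋆-zero u (v ∘ suc))) (⋆-zero (u ∘ suc) v) ⟩
    (u ⋆ (v ∘ suc)) 0 + u 1 * v 0      ∎
  ⋆-last u v (suc k) = begin
    (u ⋆ v) (2 ℕ.+ k)
      ≈⟨ ⋆-suc u v (suc k) ⟩
    u 0 * v (2 ℕ.+ k) + ((u ∘ suc) ⋆ v) (suc k)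
      ≈⟨ +-congˡ (⋆-last (u ∘ suc) v k) ⟩
    u 0 * v (2 ℕ.+ k) + (((u ∘ suc) ⋆ (v ∘ suc)) k + u (2 ℕ.+ k) * v 0)
      ≈⟨ +-assoc _ _ _ ⟨
    u 0 * v (2 ℕ.+ k) + ((u ∘ suc) ⋆ (v ∘ suc)) k + u (2 ℕ.+ k) * v 0
      ≈⟨ +-congʳ (⋆-suc u (v ∘ suc) k) ⟨
    (u ⋆ (v ∘ suc)) (suc k) + u (2 ℕ.+ k) * v 0 ∎

  ⋆-comm : ∀ u v k → (u ⋆ v) k ≈ (v ⋆ u) k
  ⋆-comm u v zero    = trans (⋆-zero u v) (trans (*-comm _ _) (sym (⋆-zero v u)))
  ⋆-comm u v (suc k) = begin
    (u ⋆ v) (suc k)                     ≈⟨ ⋆-suc u v k ⟩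
    u 0 * v (suc k) + ((u ∘ suc) ⋆ v) k ≈⟨ +-cong (*-comm _ _) (⋆-comm (u ∘ suc) v k) ⟩
    v (suc k) * u 0 + (v ⋆ (u ∘ suc)) k ≈⟨ +-comm _ _ ⟩
    (v ⋆ (u ∘ suc)) k + v (suc k) * u 0 ≈⟨ ⋆-last v u k ⟨
    (v ⋆ u) (suc k)                     ∎

  -- No double sum is reindexed: by `⋆-suc` the shift of `u ⋆ v` is `u 0` times the shift of `v`
  -- plus `(u ∘ suc) ⋆ v`, and the induction hypothesis applies to `u ∘ suc`.
  ⋆-assoc : ∀ u v w k → ((u ⋆ v) ⋆ w) k ≈ (u ⋆ (v ⋆ w)) k
  ⋆-assoc u v w zero    = begin
    ((u ⋆ v) ⋆ w) 0   ≈⟨ ⋆-zero (u ⋆ v) w ⟩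
    (u ⋆ v) 0 * w 0   ≈⟨ *-congʳ (⋆-zero u v) ⟩
    u 0 * v 0 * w 0   ≈⟨ *-assoc _ _ _ ⟩
    u 0 * (v 0 * w 0) ≈⟨ *-congˡ (⋆-zero v w) ⟨
    u 0 * (v ⋆ w) 0   ≈⟨ ⋆-zero u (v ⋆ w) ⟨
    (u ⋆ (v ⋆ w)) 0   ∎
  ⋆-assoc u v w (suc k) = begin
    ((u ⋆ v) ⋆ w) (suc k)
      ≈⟨ ⋆-suc (u ⋆ v) w k ⟩
    (u ⋆ v) 0 * w (suc k) + (((u ⋆ v) ∘ suc) ⋆ w) k
      ≈⟨ +-cong (trans (*-congʳ (⋆-zero u v)) (*-assoc _ _ _))
           (trans (⋆-cong {v = w} (⋆-suc u v) (λ _ → refl) k)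
                  (⋆-distribʳ w (λ t → u 0 * v (suc t)) ((u ∘ suc) ⋆ v) k)) ⟩
    u 0 * (v 0 * w (suc k)) + (((λ t → u 0 * v (suc t)) ⋆ w) k + (((u ∘ suc) ⋆ v) ⋆ w) k)
      ≈⟨ +-congˡ (+-cong (⋆-scale (u 0) (v ∘ suc) w k) (⋆-assoc (u ∘ suc) v w k)) ⟩
    u 0 * (v 0 * w (suc k)) + (u 0 * ((v ∘ suc) ⋆ w) k + ((u ∘ suc) ⋆ (v ⋆ w)) k)
      ≈⟨ +-assoc _ _ _ ⟨
    u 0 * (v 0 * w (suc k)) + u 0 * ((v ∘ suc) ⋆ w) k + ((u ∘ suc) ⋆ (v ⋆ w)) k
      ≈⟨ +-congʳ (distribˡ _ _ _) ⟨
    u 0 * (v 0 * w (suc k) + ((v ∘ suc) ⋆ w) k) + ((u ∘ suc) ⋆ (v ⋆ w)) k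
      ≈⟨ +-congʳ (*-congˡ (⋆-suc v w k)) ⟨
    u 0 * (v ⋆ w) (suc k) + ((u ∘ suc) ⋆ (v ⋆ w)) k
      ≈⟨ ⋆-suc u (v ⋆ w) k ⟨
    (u ⋆ (v ⋆ w)) (suc k) ∎

-- Banded recurrences over a ring with a degree

-- x ≈[ d ] y stands for deg (x - y) ≤ d.
record DegreeRing c ℓ : Set (Level.suc (c ⊔ ℓ)) where
  field
    commutativeRing : CommutativeRing c ℓ
  open CommutativeRing commutativeRing public hiding (zero)
  infix 4 _≈[_]_
  field
    z           : Carrier
    _≈[_]_      : Carrier → ℤ → Carrier → Set ℓ
    ≈⇒≈[]       : ∀ {x y} d → x ≈ y → x ≈[ d ] y
    sym[]       : ∀ {x y d} → x ≈[ d ] y → y ≈[ d ] x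
    trans[]     : ∀ {x y w d} → x ≈[ d ] y → y ≈[ d ] w → x ≈[ d ] w
    raise       : ∀ {x y d e} → d ℤ.≤ e → x ≈[ d ] y → x ≈[ e ] y
    separated   : ∀ {x y} d → (∀ k → x ≈[ d ℤ.- ℤ.+ k ] y) → x ≈ y
    +-cong[]    : ∀ {x x′ y y′ d} → x ≈[ d ] x′ → y ≈[ d ] y′ → x + y ≈[ d ] x′ + y′
    *-cong[]    : ∀ {a x y d} → a ≈[ 0ℤ ] 0# → x ≈[ d ] y → a * x ≈[ d ] a * y
    *-degree    : ∀ b → ∃ λ e → ∀ {x d} → x ≈[ d ] 0# → x * b ≈[ d ℤ.+ e ] 0#
    1-degree    : 1# ≈[ 0ℤ ] 0#
    z-cancel    : ∀ {x y d} → z * x ≈[ d ] z * y → x ≈[ d ℤ.- ℤ.+ 1 ] y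

module BandedInverse {c ℓ} (R : DegreeRing c ℓ) where

  open DegreeRing R
  open Sums commutativeSemiring public
  open CommutativeSemigroupProperties *-commutativeSemigroup using (x∙yz≈y∙xz)
  open RingProperties ring using (-‿distribˡ-*; [y-z]x≈yx-zx; -‿+-comm; -0#≈0#)
  open import Relation.Binary.Reasoning.Setoid setoid

  ∑-cong[] : ∀ N {f g d} → (∀ t → f t ≈[ d ] g t) → ∑ N f ≈[ d ] ∑ N g
  ∑-cong[] zero    f≈g = ≈⇒≈[] _ (trans (∑-empty _) (sym (∑-empty _)))
  ∑-cong[] (suc N) f≈g = trans[] (≈⇒≈[] _ (∑-suc N _))
    (trans[] (+-cong[] (f≈g 0) (∑-cong[] N λ t → f≈g (suc t))) (≈⇒≈[] _ (sym (∑-suc N _))))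

  +-degree : ∀ {x y d} → x ≈[ d ] 0# → y ≈[ d ] 0# → x + y ≈[ d ] 0#
  +-degree x≈0 y≈0 = trans[] (+-cong[] x≈0 y≈0) (≈⇒≈[] _ (+-identityʳ 0#))

  ∑-degree : ∀ N {f d} → (∀ t → f t ≈[ d ] 0#) → ∑ N f ≈[ d ] 0#
  ∑-degree N f≈0 = trans[] (∑-cong[] N f≈0) (≈⇒≈[] _ (∑-zero N λ _ _ → refl))

  ∑-neg : ∀ N (f : ℕ → Carrier) → ∑ N (λ t → - f t) ≈ - ∑ N f
  ∑-neg zero    f = trans (∑-empty _) (sym (trans (-‿cong (∑-empty f)) -0#≈0#))
  ∑-neg (suc N) f = begin
    ∑ (suc N) (λ t → - f t)         ≈⟨ ∑-suc N _ ⟩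
    - f 0 + ∑ N (λ t → - f (suc t)) ≈⟨ +-congˡ (∑-neg N (f ∘ suc)) ⟩
    - f 0 - ∑ N (λ t → f (suc t))   ≈⟨ -‿+-comm _ _ ⟩
    - (f 0 + ∑ N λ t → f (suc t))   ≈⟨ -‿cong (∑-suc N f) ⟨
    - ∑ (suc N) f                   ∎

  δ-degree : ∀ i j → δ i j ≈[ 0ℤ ] 0#
  δ-degree zero    zero    = 1-degree
  δ-degree zero    (suc j) = ≈⇒≈[] _ refl
  δ-degree (suc i) zero    = ≈⇒≈[] _ refl
  δ-degree (suc i) (suc j) = δ-degree i j

  -- The bound is uniform in the index: row `i` of an equation involves entries up to `i + w`, so
  -- the descent in `unique` has to lower the degree of all entries at once.
  Bounded : (ℕ → Carrier) → Set ℓ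
  Bounded x = ∃ λ d → ∀ i → x i ≈[ d ] 0#

  Bounded-+ : ∀ {x y} → Bounded x → Bounded y → Bounded λ i → x i + y i
  Bounded-+ (d , x≈0) (e , y≈0) = d ℤ.⊔ e , λ i →
    +-degree (raise (ℤ.i≤i⊔j d e) (x≈0 i)) (raise (ℤ.i≤j⊔i d e) (y≈0 i))

  Bounded-cong : ∀ {x y} → (∀ i → x i ≈ y i) → Bounded x → Bounded y
  Bounded-cong x≈y (d , x≈0) = d , λ i → trans[] (≈⇒≈[] d (sym (x≈y i))) (x≈0 i)

  Bounded-* : ∀ {x} b → Bounded x → Bounded λ i → x i * b
  Bounded-* b (d , x≈0) with *-degree b
  ... | e , bound = d ℤ.+ e , λ i → bound (x≈0 i)

  Bounded-∑ : ∀ P {ξ : ℕ → ℕ → Carrier} → (∀ m → Bounded λ i → ξ i m) →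
              Bounded λ i → ∑ P (ξ i)
  Bounded-∑ zero    b = 0ℤ , λ i → ≈⇒≈[] _ (∑-empty _)
  Bounded-∑ (suc P) b = Bounded-cong (λ i → sym (∑-suc P _))
    (Bounded-+ (b 0) (Bounded-∑ P λ m → b (suc m)))

  Small : (A : ℕ → ℕ → Carrier) → Set ℓ
  Small A = ∀ i j → A i j ≈[ 0ℤ ] 0#

  BoundedMatrix : (ζ : ℕ → ℕ → Carrier) → Set ℓ
  BoundedMatrix ζ = ∀ j → Bounded λ i → ζ i j

  module _ (w : ℕ) where

    -- (z I - A) x = b for a matrix A whose i-th row vanishes from column i + w + 1 on.
    Solves : (A : ℕ → ℕ → Carrier) (b x : ℕ → Carrier) → Set ℓ
    Solves A b x = ∀ i N → i ℕ.+ w < N → z * x i ≈ b i + ∑ N λ l → A i l * x l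

    RightInverse : (A ζ : ℕ → ℕ → Carrier) → Set ℓ
    RightInverse A ζ = ∀ j → Solves A (λ i → δ i j) (λ i → ζ i j)

    -- Two solutions that agree above degree d agree above degree d - 1.
    unique : ∀ {A b x y} → Small A → Bounded x → Bounded y →
             Solves A b x → Solves A b y → ∀ i → x i ≈ y i
    unique {A} {b} {x} {y} A-small (d , x≈0) (e , y≈0) x-solves y-solves i =
      separated (d ℤ.⊔ e) λ k → agree k i
      where
      agree : ∀ k i → x i ≈[ d ℤ.⊔ e ℤ.- ℤ.+ k ] y i
      agree zero    i = ≡.subst (λ f → x i ≈[ f ] y i) (≡.sym (ℤ.+-identityʳ _))
        (trans[] (raise (ℤ.i≤i⊔j d e) (x≈0 i)) (sym[] (raise (ℤ.i≤j⊔i d e) (y≈0 i))))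
      -- Multiplication by `A` raises no degree and multiplication by `z` raises it by one, so an
      -- error of degree e on the right-hand side leaves an error of degree e - 1 in `x i`.
      agree (suc k) i = ≡.subst (λ f → x i ≈[ f ] y i) lower (z-cancel
        (trans[] (≈⇒≈[] _ (x-solves i N ℕ.≤-refl))
        (trans[] (+-cong[] (≈⇒≈[] _ refl) (∑-cong[] N λ l → *-cong[] (A-small i l) (agree k l)))
                 (≈⇒≈[] _ (sym (y-solves i N ℕ.≤-refl))))))
        where
        N = suc (i ℕ.+ w)
        lower : d ℤ.⊔ e ℤ.- ℤ.+ k ℤ.- ℤ.+ 1 ≡.≡ d ℤ.⊔ e ℤ.- ℤ.+ suc k
        lower = ≡.trans (ℤ.+-assoc (d ℤ.⊔ e) (ℤ.- ℤ.+ k) (ℤ.- ℤ.+ 1))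
          (≡.cong (λ f → d ℤ.⊔ e ℤ.+ f)
            (≡.trans (≡.sym (ℤ.neg-distrib-+ (ℤ.+ k) (ℤ.+ 1))) (≡.cong (λ m → ℤ.- ℤ.+ m) (ℕ.+-comm k 1))))

    -- Linearity: the columns of `ζ` solve the equation for the unit vectors, and `b`, being 0 from
    -- `P` on, is a finite combination of these.
    superpose : ∀ {A ζ b} P → RightInverse A ζ → (∀ m → P ≤ m → b m ≈ 0#) →
                Solves A b λ i → ∑ P λ m → ζ i m * b m
    superpose {A} {ζ} {b} P ζ-inverse b≈0 i N i<N = begin
      z * ∑ P (λ m → ζ i m * b m)
        ≈⟨ *-∑ P z _ ⟩
      ∑ P (λ m → z * (ζ i m * b m))
        ≈⟨ ∑-cong P (λ m _ → trans (sym (*-assoc _ _ _)) (*-congʳ (ζ-inverse m i N i<N))) ⟩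
      ∑ P (λ m → (δ i m + ∑ N λ l → A i l * ζ l m) * b m)
        ≈⟨ ∑-cong P (λ m _ → trans (distribʳ _ _ _) (+-congˡ (∑-* N (b m) _))) ⟩
      ∑ P (λ m → δ i m * b m + ∑ N λ l → A i l * ζ l m * b m)
        ≈⟨ ∑-+ P _ _ ⟩
      ∑ P (λ m → δ i m * b m) + ∑ P (λ m → ∑ N λ l → A i l * ζ l m * b m)
        ≈⟨ +-cong (∑-δ P i b (b≈0 i)) (∑-swap P N _) ⟩
      b i + ∑ N (λ l → ∑ P λ m → A i l * ζ l m * b m)
        ≈⟨ +-congˡ (∑-cong N λ l _ → trans (∑-cong P λ m _ → *-assoc _ _ _) (sym (*-∑ P (A i l) _))) ⟩
      b i + ∑ N (λ l → A i l * ∑ P λ m → ζ l m * b m) ∎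

    -- Plays the part of multiplying the equation by `ζ` from the left, although only the right
    -- inverse property is at hand: `superpose` gives one bounded solution and `unique` leaves no
    -- other.
    solve : ∀ {A ζ b x} P → Small A → RightInverse A ζ → BoundedMatrix ζ →
            (∀ m → P ≤ m → b m ≈ 0#) → Bounded x → Solves A b x →
            ∀ i → x i ≈ ∑ P λ m → ζ i m * b m
    solve {b = b} P A-small ζ-inverse ζ-bounded b≈0 x-bounded x-solves =
      unique A-small x-bounded (Bounded-∑ P λ m → Bounded-* (b m) (ζ-bounded m))
        x-solves (superpose P ζ-inverse b≈0)

    -- With `j` fixed, both sides are functions of `i` that solve (z I - A) x = z e_j, where e_j is
    -- the unit vector: the left one because the equation of column `j` may be multiplied by `z`,
    -- the right one by superposition of the columns of `ζ` with the entries of column `j` of `A`.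
    leftInverse : ∀ {A ζ} → Small A → (∀ i j → i ℕ.+ w < j → A i j ≈ 0#) →
                  (∀ i j → j ℕ.+ w < i → A i j ≈ 0#) →
                  RightInverse A ζ → BoundedMatrix ζ →
                  ∀ i j N → j ℕ.+ w < N → z * ζ i j ≈ δ i j + ∑ N λ l → ζ i l * A l j
    leftInverse {A} {ζ} A-small upper lower ζ-inverse ζ-bounded i j N j<N =
      unique {b = λ i → z * δ i j} A-small x-bounded y-bounded x-solves y-solves i
      where
      x y : ℕ → Carrier
      x i = z * ζ i j
      y i = δ i j + ∑ N λ l → ζ i l * A l j

      δ-bounded : Bounded λ i → δ i j
      δ-bounded = 0ℤ , λ i → δ-degree i j

      x-bounded : Bounded x
      x-bounded with ζ-bounded j
      ... | d , ζ≈0 = 0ℤ ℤ.⊔ d , λ i → trans[] (≈⇒≈[] _ (ζ-inverse j i _ ℕ.≤-refl))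
        (+-degree (raise (ℤ.i≤i⊔j 0ℤ d) (δ-degree i j))
          (raise (ℤ.i≤j⊔i 0ℤ d) (∑-degree _ λ l →
            trans[] (*-cong[] (A-small i l) (ζ≈0 l)) (≈⇒≈[] _ (zeroʳ _)))))

      y-bounded : Bounded y
      y-bounded = Bounded-+ δ-bounded (Bounded-∑ N λ l → Bounded-* (A l j) (ζ-bounded l))

      x-solves : Solves A (λ i → z * δ i j) x
      x-solves i M i<M = begin
        z * (z * ζ i j)
          ≈⟨ *-congˡ (ζ-inverse j i M i<M) ⟩
        z * (δ i j + ∑ M λ l → A i l * ζ l j)
          ≈⟨ trans (distribˡ _ _ _) (+-congˡ (*-∑ M z _)) ⟩
        z * δ i j + ∑ M (λ l → z * (A i l * ζ l j))
          ≈⟨ +-congˡ (∑-cong M λ l _ → x∙yz≈y∙xz _ _ _) ⟩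
        z * δ i j + ∑ M (λ l → A i l * (z * ζ l j)) ∎

      y-solves : Solves A (λ i → z * δ i j) y
      y-solves i M i<M = begin
        z * (δ i j + ∑ N λ l → ζ i l * A l j)
          ≈⟨ distribˡ _ _ _ ⟩
        z * δ i j + z * ∑ N (λ l → ζ i l * A l j)
          ≈⟨ +-congˡ (superpose N ζ-inverse (λ m N≤m → lower m j (ℕ.<-≤-trans j<N N≤m)) i M i<M) ⟩
        z * δ i j + (A i j + ∑ M λ l → A i l * ∑ N λ m → ζ l m * A m j)
          -- The stray entry `A i j` becomes the δ part of `A` times `y`; if `j` lies beyond `M`,
          -- the entry is 0 by `upper`.
          ≈⟨ +-congˡ (+-congʳ (∑-*-δ M j (A i) λ M≤j → upper i j (ℕ.<-≤-trans i<M M≤j))) ⟨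
        z * δ i j + (∑ M (λ l → A i l * δ l j) + ∑ M λ l → A i l * ∑ N λ m → ζ l m * A m j)
          ≈⟨ +-congˡ (∑-+ M _ _) ⟨
        z * δ i j + ∑ M (λ l → A i l * δ l j + A i l * ∑ N λ m → ζ l m * A m j)
          ≈⟨ +-congˡ (∑-cong M λ l _ → distribˡ _ _ _) ⟨
        z * δ i j + ∑ M (λ l → A i l * y l) ∎

    -- The first equation and the first unknown are deleted; the contribution of `x 0` to the other
    -- rows moves to the right-hand side.
    Solves-tail : ∀ {A b x} → Solves A b x →
      Solves (λ i j → A (suc i) (suc j)) (λ i → b (suc i) + A (suc i) 0 * x 0) (x ∘ suc)
    Solves-tail {A} {b} {x} x-solves i N i<N = begin
      z * x (suc i)
        ≈⟨ x-solves (suc i) (suc N) (s≤s i<N) ⟩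
      b (suc i) + ∑ (suc N) (λ l → A (suc i) l * x l)
        ≈⟨ +-congˡ (∑-suc N _) ⟩
      b (suc i) + (A (suc i) 0 * x 0 + ∑ N λ l → A (suc i) (suc l) * x (suc l))
        ≈⟨ +-assoc _ _ _ ⟨
      b (suc i) + A (suc i) 0 * x 0 + ∑ N (λ l → A (suc i) (suc l) * x (suc l)) ∎

  -- Inversion by blocks with a 1 × 1 upper left block. In terms of (z I - A′)⁻¹ = `ζ′`, where A′ is
  -- `A` without its first row and column, `column` is `ζ′` times the first column of `A`, `row` is
  -- the first row of `A` times `ζ′`, and `pivot` is the Schur complement. All formulas are stated
  -- with factors `pivot` instead of divisions by `ζ 0 0`.
  module SchurComplement (w P Q : ℕ) (Q≤w : Q ≤ w) {A ζ ζ′ : ℕ → ℕ → Carrier}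
    (A-small : Small A)
    (lower : ∀ i → P ≤ i → A (suc i) 0 ≈ 0#)
    (upper : ∀ j → Q ≤ j → A 0 (suc j) ≈ 0#)
    (ζ-bounded : BoundedMatrix ζ) (ζ-inverse : RightInverse w A ζ)
    (ζ′-bounded : BoundedMatrix ζ′)
    (ζ′-inverse : RightInverse w (λ i j → A (suc i) (suc j)) ζ′) where

    column row : ℕ → Carrier
    column i = ∑ P λ m → ζ′ i m * A (suc m) 0
    row j    = ∑ Q λ l → A 0 (suc l) * ζ′ l j

    pivot : Carrier
    pivot = z - (A 0 0 + ∑ Q λ l → A 0 (suc l) * column l)

    A′-small : Small (λ i j → A (suc i) (suc j))
    A′-small i j = A-small (suc i) (suc j)

    tail-bounded : ∀ j → Bounded λ i → ζ (suc i) j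
    tail-bounded j with ζ-bounded j
    ... | d , ζ≈0 = d , λ i → ζ≈0 (suc i)

    ∑-column : ∀ i y → ∑ P (λ m → ζ′ i m * (A (suc m) 0 * y)) ≈ column i * y
    ∑-column i y = trans (∑-cong P λ m _ → sym (*-assoc _ _ _)) (sym (∑-* P y _))

    -- Below row 0 this column solves the system of A′, and its right-hand side is the first column
    -- of `A` times `ζ 0 0`, as the unit vector contributes only to row 0.
    firstColumn : ∀ i → ζ (suc i) 0 ≈ column i * ζ 0 0
    firstColumn i = trans
      (solve w P A′-small ζ′-inverse ζ′-bounded
        (λ m P≤m → trans (*-congʳ (lower m P≤m)) (zeroˡ _))
        (tail-bounded 0)
        (λ i N i<N → trans (Solves-tail w {b = λ i → δ i 0} (ζ-inverse 0) i N i<N) (+-congʳ (+-identityˡ _)))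
        i)
      (∑-column i (ζ 0 0))

    otherColumns : ∀ i j → ζ (suc i) (suc j) ≈ ζ′ i j + column i * ζ 0 (suc j)
    otherColumns i j = begin
      ζ (suc i) (suc j)
        ≈⟨ solve w M A′-small ζ′-inverse ζ′-bounded b≈0 (tail-bounded (suc j))
             (Solves-tail w {b = λ i → δ i (suc j)} (ζ-inverse (suc j))) i ⟩
      ∑ M (λ m → ζ′ i m * (δ m j + A (suc m) 0 * y))
        ≈⟨ trans (∑-cong M λ m _ → distribˡ _ _ _) (∑-+ M _ _) ⟩
      ∑ M (λ m → ζ′ i m * δ m j) + ∑ M (λ m → ζ′ i m * (A (suc m) 0 * y))
        ≈⟨ +-cong (∑-*-δ M j (ζ′ i) λ M≤j → contradiction (ℕ.≤-trans (ℕ.m≤m+n (suc j) P) M≤j) ℕ.1+n≰n)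
                  (∑-extend (ℕ.m≤n+m P (suc j)) λ m P≤m →
                    trans (*-congˡ (trans (*-congʳ (lower m P≤m)) (zeroˡ _))) (zeroʳ _)) ⟩
      ζ′ i j + ∑ P (λ m → ζ′ i m * (A (suc m) 0 * y))
        ≈⟨ +-congˡ (∑-column i y) ⟩
      ζ′ i j + column i * y ∎
      where
      -- Large enough to contain both the support {j} of the unit vector and the support below `P`
      -- of the first column of `A`.
      M = suc j ℕ.+ P
      y = ζ 0 (suc j)
      b≈0 : ∀ m → M ≤ m → δ m j + A (suc m) 0 * y ≈ 0#
      b≈0 m M≤m = trans
        (+-cong (δ-off (ℕ.<⇒≢ (ℕ.≤-trans (ℕ.m≤m+n (suc j) P) M≤m) ∘ ≡.sym))
                (trans (*-congʳ (lower m (ℕ.≤-trans (ℕ.m≤n+m P (suc j)) M≤m))) (zeroˡ _)))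
        (+-identityˡ _)

    firstRow : ∀ j → z * ζ 0 j ≈ δ 0 j + (A 0 0 * ζ 0 j + ∑ Q λ l → A 0 (suc l) * ζ (suc l) j)
    firstRow j = begin
      z * ζ 0 j
        ≈⟨ ζ-inverse j 0 (suc w) ℕ.≤-refl ⟩
      δ 0 j + ∑ (suc w) (λ l → A 0 l * ζ l j)
        ≈⟨ +-congˡ (∑-suc _ _) ⟩
      δ 0 j + (A 0 0 * ζ 0 j + ∑ w λ l → A 0 (suc l) * ζ (suc l) j)
        ≈⟨ +-congˡ (+-congˡ (∑-extend Q≤w λ l Q≤l →
             trans (*-congʳ (upper l Q≤l)) (zeroˡ _))) ⟩
      δ 0 j + (A 0 0 * ζ 0 j + ∑ Q λ l → A 0 (suc l) * ζ (suc l) j) ∎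

    -- The first row of the equation takes this form once the entries below row 0 are replaced by
    -- `column` times the entry in row 0, up to the summand `y`.
    pivot-* : ∀ {x y e} → z * x ≈ y + (A 0 0 * x + e * x) → (z - (A 0 0 + e)) * x ≈ y
    pivot-* {x} {y} {e} eq = begin
      (z - (A 0 0 + e)) * x                        ≈⟨ [y-z]x≈yx-zx _ _ _ ⟩
      z * x - (A 0 0 + e) * x                      ≈⟨ +-congʳ eq ⟩
      y + (A 0 0 * x + e * x) - (A 0 0 + e) * x    ≈⟨ +-congʳ (+-congˡ (distribʳ _ _ _)) ⟨
      y + (A 0 0 + e) * x - (A 0 0 + e) * x        ≈⟨ +-assoc _ _ _ ⟩
      y + ((A 0 0 + e) * x - (A 0 0 + e) * x)      ≈⟨ +-congˡ (-‿inverseʳ _) ⟩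
      y + 0#                                       ≈⟨ +-identityʳ _ ⟩
      y                                            ∎

    pivot-inverse : ζ 0 0 * pivot ≈ 1#
    pivot-inverse = trans (*-comm _ _) (pivot-* (trans (firstRow 0) (+-congˡ (+-congˡ (begin
      ∑ Q (λ l → A 0 (suc l) * ζ (suc l) 0)
        ≈⟨ ∑-cong Q (λ l _ → trans (*-congˡ (firstColumn l)) (sym (*-assoc _ _ _))) ⟩
      ∑ Q (λ l → A 0 (suc l) * column l * ζ 0 0)
        ≈⟨ ∑-* Q (ζ 0 0) _ ⟨
      ∑ Q (λ l → A 0 (suc l) * column l) * ζ 0 0 ∎)))))

    row-pivot : ∀ j → ζ 0 (suc j) * pivot ≈ row j
    row-pivot j = trans (*-comm _ _) (pivot-* (begin
      z * y
        ≈⟨ firstRow (suc j) ⟩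
      0# + (A 0 0 * y + ∑ Q λ l → A 0 (suc l) * ζ (suc l) (suc j))
        ≈⟨ +-identityˡ _ ⟩
      A 0 0 * y + ∑ Q (λ l → A 0 (suc l) * ζ (suc l) (suc j))
        ≈⟨ +-congˡ (∑-cong Q λ l _ → trans (*-congˡ (otherColumns l j))
             (trans (distribˡ _ _ _) (+-congˡ (sym (*-assoc _ _ _))))) ⟩
      A 0 0 * y + ∑ Q (λ l → A 0 (suc l) * ζ′ l j + A 0 (suc l) * column l * y)
        ≈⟨ +-congˡ (trans (∑-+ Q _ _) (+-congˡ (sym (∑-* Q y _)))) ⟩
      A 0 0 * y + (row j + e * y)
        ≈⟨ x∙yz+ _ _ _ ⟩
      row j + (A 0 0 * y + e * y) ∎))
      where
      y = ζ 0 (suc j)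
      e = ∑ Q λ l → A 0 (suc l) * column l
      open CommutativeSemigroupProperties +-commutativeSemigroup using () renaming (x∙yz≈y∙xz to x∙yz+)

    column-pivot : ∀ i → ζ (suc i) 0 * pivot ≈ column i
    column-pivot i = begin
      ζ (suc i) 0 * pivot           ≈⟨ *-congʳ (firstColumn i) ⟩
      column i * ζ 0 0 * pivot      ≈⟨ *-assoc _ _ _ ⟩
      column i * (ζ 0 0 * pivot)    ≈⟨ *-congˡ pivot-inverse ⟩
      column i * 1#                 ≈⟨ *-identityʳ _ ⟩
      column i                      ∎

    -- The `inner` entries of the pseudo-quotient. Both products contain `column i * y * x`; this
    -- rank one part cancels, and `pivot` removes the remaining factor `ζ 0 0`.
    complement : ∀ i j →
      (ζ (suc i) (suc j) * ζ 0 0 - ζ 0 (suc j) * ζ (suc i) 0) * pivot ≈ ζ′ i j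
    complement i j = begin
      (ζ (suc i) (suc j) * x - y * ζ (suc i) 0) * pivot
        ≈⟨ *-congʳ (+-cong (*-congʳ (otherColumns i j)) (-‿cong (*-congˡ (firstColumn i)))) ⟩
      ((ζ′ i j + column i * y) * x - y * (column i * x)) * pivot
        ≈⟨ *-congʳ (+-cong (distribʳ _ _ _) (-‿cong (trans (x∙yz≈y∙xz _ _ _) (sym (*-assoc _ _ _))))) ⟩
      (ζ′ i j * x + column i * y * x - column i * y * x) * pivot
        ≈⟨ *-congʳ (trans (+-assoc _ _ _) (trans (+-congˡ (-‿inverseʳ _)) (+-identityʳ _))) ⟩
      ζ′ i j * x * pivot
        ≈⟨ trans (*-assoc _ _ _) (trans (*-congˡ pivot-inverse) (*-identityʳ _)) ⟩
      ζ′ i j ∎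
      where
      x = ζ 0 0
      y = ζ 0 (suc j)

    -- The left side is the corner of β + β⁺ X β⁻, where the first row of `A` meets `ζ′` before the
    -- first column does; in `pivot` it is the other way round. The two agree by associativity of a
    -- finite triple product.
    corner : z - A 0 0 + ∑ P (λ m → - row m * A (suc m) 0) ≈ pivot
    corner = begin
      z - A 0 0 + ∑ P (λ m → - row m * A (suc m) 0)
        ≈⟨ +-congˡ (trans (∑-cong P λ m _ → sym (-‿distribˡ-* _ _)) (∑-neg P _)) ⟩
      z - A 0 0 - ∑ P (λ m → row m * A (suc m) 0)
        ≈⟨ trans (+-assoc _ _ _) (+-congˡ (-‿+-comm _ _)) ⟩
      z - (A 0 0 + ∑ P λ m → row m * A (suc m) 0)
        ≈⟨ +-congˡ (-‿cong (+-congˡ exchange)) ⟩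
      pivot ∎
      where
      exchange : ∑ P (λ m → row m * A (suc m) 0) ≈ ∑ Q (λ l → A 0 (suc l) * column l)
      exchange = begin
        ∑ P (λ m → row m * A (suc m) 0)
          ≈⟨ ∑-cong P (λ m _ → trans (∑-* Q _ _) (∑-cong Q λ l _ → *-assoc _ _ _)) ⟩
        ∑ P (λ m → ∑ Q λ l → A 0 (suc l) * (ζ′ l m * A (suc m) 0))
          ≈⟨ ∑-swap P Q _ ⟩
        ∑ Q (λ l → ∑ P λ m → A 0 (suc l) * (ζ′ l m * A (suc m) 0))
          ≈⟨ ∑-cong Q (λ l _ → sym (*-∑ P _ _)) ⟩
        ∑ Q (λ l → A 0 (suc l) * column l) ∎

-- Laurent series

i-[i-j]≡j : ∀ i j → i ℤ.- (i ℤ.- j) ≡ j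
i-[i-j]≡j = solve-∀

i<1+i : ∀ i → i ℤ.< 1ℤ ℤ.+ i
i<1+i i = ℤ.suc[i]≤j⇒i<j ℤ.≤-refl

i<j⇒i-j<0 : ∀ {i j} → i ℤ.< j → i ℤ.- j ℤ.< 0ℤ
i<j⇒i-j<0 {i} {j} i<j = ≡.subst (i ℤ.- j ℤ.<_) (ℤ.+-inverseʳ j) (ℤ.+-monoˡ-< (ℤ.- j) i<j)

i-j<0⇒i<j : ∀ {i j} → i ℤ.- j ℤ.< 0ℤ → i ℤ.< j
i-j<0⇒i<j {i} {j} lt = ≡.subst₂ ℤ._<_ (arith i j) (ℤ.+-identityˡ j) (ℤ.+-monoˡ-< j lt)
  where
  arith : ∀ i j → i ℤ.- j ℤ.+ j ≡ i
  arith = solve-∀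

above-or-below : ∀ T n → T ℤ.< n ⊎ ∃ λ k → n ≡ T ℤ.- + k
above-or-below T n with T ℤ.- n in eq
... | + k      = inj₂ (k , ≡.trans (≡.sym (i-[i-j]≡j T n)) (≡.cong (λ m → T ℤ.- m) eq))
... | -[1+ k ] = inj₁ (i-j<0⇒i<j (≡.subst (ℤ._< 0ℤ) (≡.sym eq) ℤ.-<+))

+[m∸n] : ∀ {m n} → n ≤ m → + (m ℕ.∸ n) ≡ + m ℤ.- + n
+[m∸n] {m} {n} n≤m = ≡.trans (≡.sym (ℤ.⊖-≥ n≤m)) (≡.sym (ℤ.m-n≡m⊖n m n))

module LaurentRing {c ℓ₁ ℓ₂} (F : HeytingField c ℓ₁ ℓ₂) where

  open LaurentSeries F
  open HeytingCommutativeRing heytingCommutativeRing using () renaming (commutativeRing to coefficientRing)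
  open CommutativeRing coefficientRing
    using (refl; sym; trans; reflexive; setoid; +-cong; +-congˡ; +-congʳ; +-assoc; +-comm; +-identityˡ; +-identityʳ;
           -‿cong; -‿inverseˡ; -‿inverseʳ; *-cong; *-congˡ; *-congʳ; *-identityˡ;
           zeroˡ; zeroʳ; commutativeSemiring)
  open Sums commutativeSemiring using (∑; ∑≡sum; ∑-empty; ∑-suc; ∑-cong; ∑-zero; ∑-last)
  open PowerSeries commutativeSemiring
  open import Relation.Binary.Reasoning.Setoid setoid

  -- Unlike the field `top`, this notion of degree bound respects `_≋_`.
  Degree≤ : ℤ → Laurent → Set ℓ₁
  Degree≤ T f = ∀ n → T ℤ.< n → coeff f n ≈ 0#

  Degree≤-mono : ∀ {T U} f → T ℤ.≤ U → Degree≤ T f → Degree≤ U f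
  Degree≤-mono f T≤U f≤T n U<n = f≤T n (ℤ.≤-<-trans T≤U U<n)

  -- `convolution` with a window given by arbitrary bounds T and S for the degrees.
  window : ℤ → ℤ → Laurent → Laurent → ℤ → C
  window T S f g n = ∑ (terms (T ℤ.+ S ℤ.- n)) λ t →
    coeff f (T ℤ.- + t) * coeff g (n ℤ.- (T ℤ.- + t))

  ⊛-window : ∀ f g n → coeff (f ⊛ g) n ≈ window (top f) (top g) f g n
  ⊛-window f g n = reflexive (≡.sym (∑≡sum (terms (top f ℤ.+ top g ℤ.- n)) λ t →
    coeff f (top f ℤ.- + t) * coeff g (n ℤ.- (top f ℤ.- + t))))

  -- `terms m` is max(m + 1, 0), so passing from m to m + 1 adds a term exactly when m ≥ -1; below
  -- that both sums are empty.
  ∑-terms-suc : ∀ m {φ : ℕ → C} → φ 0 ≈ 0# →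
                ∑ (terms (1ℤ ℤ.+ m)) φ ≈ ∑ (terms m) λ t → φ (suc t)
  ∑-terms-suc (+ k)          φ0≈0 = trans (∑-suc (suc k) _) (trans (+-congʳ φ0≈0) (+-identityˡ _))
  ∑-terms-suc -[1+ zero ]    φ0≈0 = trans (∑-suc 0 _) (trans (+-congʳ φ0≈0) (trans (+-identityˡ _)
    (trans (∑-empty _) (sym (∑-empty _)))))
  ∑-terms-suc -[1+ (suc k) ] φ0≈0 = trans (∑-empty _) (sym (∑-empty _))

  ∑-terms-last : ∀ m {φ : ℕ → C} → (∀ k → + k ≡ 1ℤ ℤ.+ m → φ k ≈ 0#) →
                 ∑ (terms (1ℤ ℤ.+ m)) φ ≈ ∑ (terms m) φ
  ∑-terms-last (+ k)          φ≈0 = trans (∑-last (suc k) _) (trans (+-congˡ (φ≈0 (suc k) ≡.refl)) (+-identityʳ _))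
  ∑-terms-last -[1+ zero ]    φ≈0 = trans (∑-last 0 _) (trans (+-congˡ (φ≈0 0 ≡.refl)) (+-identityʳ _))
  ∑-terms-last -[1+ (suc k) ] φ≈0 = refl

  -- Each unit by which the bound for `f` drops removes the first term of the window, in which the
  -- coefficient of `f` is 0.
  lowerˡ : ∀ k T S f g n → Degree≤ (T ℤ.- + k) f → window T S f g n ≈ window (T ℤ.- + k) S f g n
  lowerˡ zero    T S f g n f≤ = reflexive (≡.cong (λ U → window U S f g n) (≡.sym (ℤ.+-identityʳ T)))
  lowerˡ (suc k) T S f g n f≤ = trans
    (lowerˡ k T S f g n (Degree≤-mono f (≡.subst (T ℤ.- + suc k ℤ.≤_) (≡.sym step) (ℤ.i≤suc[i] _)) f≤))
    (trans (reflexive (≡.cong (λ U → window U S f g n) step)) lower1)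
    where
    U = T ℤ.- + suc k
    step : T ℤ.- + k ≡ 1ℤ ℤ.+ U
    step = arith T (+ k)
      where
      arith : ∀ T k → T ℤ.- k ≡ 1ℤ ℤ.+ (T ℤ.- (1ℤ ℤ.+ k))
      arith = solve-∀
    U<1+U : U ℤ.< 1ℤ ℤ.+ U ℤ.- + 0
    U<1+U = ≡.subst (U ℤ.<_) (≡.sym (ℤ.+-identityʳ _)) (i<1+i U)
    lower1 : window (1ℤ ℤ.+ U) S f g n ≈ window U S f g n
    lower1 = begin
      window (1ℤ ℤ.+ U) S f g n
        ≡⟨ ≡.cong (λ m → ∑ (terms m) λ t → coeff f (1ℤ ℤ.+ U ℤ.- + t) * coeff g (n ℤ.- (1ℤ ℤ.+ U ℤ.- + t)))
             (arith₁ U S n) ⟩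
      ∑ (terms (1ℤ ℤ.+ (U ℤ.+ S ℤ.- n))) (λ t → coeff f (1ℤ ℤ.+ U ℤ.- + t) * coeff g (n ℤ.- (1ℤ ℤ.+ U ℤ.- + t)))
        ≈⟨ ∑-terms-suc (U ℤ.+ S ℤ.- n) (trans (*-congʳ (f≤ _ U<1+U)) (zeroˡ _)) ⟩
      ∑ (terms (U ℤ.+ S ℤ.- n)) (λ t → coeff f (1ℤ ℤ.+ U ℤ.- + suc t) * coeff g (n ℤ.- (1ℤ ℤ.+ U ℤ.- + suc t)))
        ≈⟨ ∑-cong (terms (U ℤ.+ S ℤ.- n)) (λ t _ → reflexive
             (≡.cong (λ s → coeff f s * coeff g (n ℤ.- s)) (arith₂ U (+ t)))) ⟩
      window U S f g n ∎
      where
      arith₁ : ∀ U S n → 1ℤ ℤ.+ U ℤ.+ S ℤ.- n ≡ 1ℤ ℤ.+ (U ℤ.+ S ℤ.- n)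
      arith₁ = solve-∀
      arith₂ : ∀ U t → 1ℤ ℤ.+ U ℤ.- (1ℤ ℤ.+ t) ≡ U ℤ.- t
      arith₂ = solve-∀

  -- Here it is the last term that disappears: its coefficient of `g` has index 1 + U, just above
  -- the new bound U.
  lowerʳ : ∀ k T S f g n → Degree≤ (S ℤ.- + k) g → window T S f g n ≈ window T (S ℤ.- + k) f g n
  lowerʳ zero    T S f g n g≤ = reflexive (≡.cong (λ U → window T U f g n) (≡.sym (ℤ.+-identityʳ S)))
  lowerʳ (suc k) T S f g n g≤ = trans
    (lowerʳ k T S f g n (Degree≤-mono g (≡.subst (S ℤ.- + suc k ℤ.≤_) (≡.sym step) (ℤ.i≤suc[i] _)) g≤))
    (trans (reflexive (≡.cong (λ U → window T U f g n) step)) lower1)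
    where
    U = S ℤ.- + suc k
    step : S ℤ.- + k ≡ 1ℤ ℤ.+ U
    step = arith S (+ k)
      where
      arith : ∀ T k → T ℤ.- k ≡ 1ℤ ℤ.+ (T ℤ.- (1ℤ ℤ.+ k))
      arith = solve-∀
    lower1 : window T (1ℤ ℤ.+ U) f g n ≈ window T U f g n
    lower1 = trans
      (reflexive (≡.cong (λ m → ∑ (terms m) λ t → coeff f (T ℤ.- + t) * coeff g (n ℤ.- (T ℤ.- + t)))
        (arith₁ T U n)))
      (∑-terms-last (T ℤ.+ U ℤ.- n) λ k k≡ → trans
        (*-congˡ (g≤ _ (≡.subst (U ℤ.<_)
          (≡.trans (arith₂ T U n) (≡.cong (λ m → n ℤ.- (T ℤ.- m)) (≡.sym k≡))) (i<1+i U))))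
        (zeroʳ _))
      where
      arith₁ : ∀ T U n → T ℤ.+ (1ℤ ℤ.+ U) ℤ.- n ≡ 1ℤ ℤ.+ (T ℤ.+ U ℤ.- n)
      arith₁ = solve-∀
      arith₂ : ∀ T U n → 1ℤ ℤ.+ U ≡ n ℤ.- (T ℤ.- (1ℤ ℤ.+ (T ℤ.+ U ℤ.- n)))
      arith₂ = solve-∀

  window-irrelevantˡ : ∀ {T U} S f g n → T ℤ.≤ U → Degree≤ T f → window U S f g n ≈ window T S f g n
  window-irrelevantˡ {T} {U} S f g n T≤U f≤ with above-or-below U T
  ... | inj₁ U<T        = contradiction U<T (ℤ.≤⇒≯ T≤U)
  ... | inj₂ (k , T≡U-k) rewrite T≡U-k = lowerˡ k U S f g n f≤

  window-irrelevantʳ : ∀ {S U} T f g n → S ℤ.≤ U → Degree≤ S g → window T U f g n ≈ window T S f g n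
  window-irrelevantʳ {S} {U} T f g n S≤U g≤ with above-or-below U S
  ... | inj₁ U<S        = contradiction U<S (ℤ.≤⇒≯ S≤U)
  ... | inj₂ (k , S≡U-k) rewrite S≡U-k = lowerʳ k T U f g n g≤

  -- Makes multiplication independent of the recorded bounds. As windows can only be lowered, the
  -- given bounds and the recorded ones are compared through their maxima.
  coeff-⊛ : ∀ {T S f g} → Degree≤ T f → Degree≤ S g → ∀ n → coeff (f ⊛ g) n ≈ window T S f g n
  coeff-⊛ {T} {S} {f} {g} f≤ g≤ n = begin
    coeff (f ⊛ g) n
      ≈⟨ ⊛-window f g n ⟩
    window (top f) (top g) f g n
      ≈⟨ window-irrelevantˡ (top g) f g n (ℤ.i≤j⊔i T (top f)) (vanish f) ⟨
    window (T ℤ.⊔ top f) (top g) f g n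
      ≈⟨ window-irrelevantʳ (T ℤ.⊔ top f) f g n (ℤ.i≤j⊔i S (top g)) (vanish g) ⟨
    window (T ℤ.⊔ top f) (S ℤ.⊔ top g) f g n
      ≈⟨ window-irrelevantʳ (T ℤ.⊔ top f) f g n (ℤ.i≤i⊔j S (top g)) g≤ ⟩
    window (T ℤ.⊔ top f) S f g n
      ≈⟨ window-irrelevantˡ S f g n (ℤ.i≤i⊔j T (top f)) f≤ ⟩
    window T S f g n ∎

  -- f = z^T · ∑ₜ (digits T f t) z⁻ᵗ when deg f ≤ T.
  digits : ℤ → Laurent → ℕ → C
  digits T f t = coeff f (T ℤ.- + t)

  -- For n = T + S - k the window has k + 1 terms and the index in `g` is S - (k - t):
  -- multiplication becomes the Cauchy product of power series in 1/z, from which the ring laws are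
  -- transported.
  digits-⊛ : ∀ {T S f g} → Degree≤ T f → Degree≤ S g →
             ∀ k → digits (T ℤ.+ S) (f ⊛ g) k ≈ (digits T f ⋆ digits S g) k
  digits-⊛ {T} {S} {f} {g} f≤ g≤ k = begin
    coeff (f ⊛ g) n
      ≈⟨ coeff-⊛ {f = f} {g = g} f≤ g≤ n ⟩
    ∑ (terms (T ℤ.+ S ℤ.- n)) (λ t → digits T f t * coeff g (n ℤ.- (T ℤ.- + t)))
      ≡⟨ ≡.cong (λ m → ∑ (terms m) λ t → digits T f t * coeff g (n ℤ.- (T ℤ.- + t))) (i-[i-j]≡j (T ℤ.+ S) (+ k)) ⟩
    ∑ (suc k) (λ t → digits T f t * coeff g (n ℤ.- (T ℤ.- + t)))
      ≈⟨ ∑-cong (suc k) (λ t t<k → *-congˡ (reflexive (≡.cong (coeff g)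
           (≡.trans (arith T S (+ k) (+ t)) (≡.cong (λ m → S ℤ.- m) (≡.sym (+[m∸n] (ℕ.≤-pred t<k)))))))) ⟩
    (digits T f ⋆ digits S g) k ∎
    where
    n = T ℤ.+ S ℤ.- + k
    arith : ∀ T S k t → T ℤ.+ S ℤ.- k ℤ.- (T ℤ.- t) ≡ S ℤ.- (k ℤ.- t)
    arith = solve-∀

  ⊛-degree : ∀ {T S f g} → Degree≤ T f → Degree≤ S g → Degree≤ (T ℤ.+ S) (f ⊛ g)
  ⊛-degree {T} {S} {f} {g} f≤ g≤ n T+S<n = trans (coeff-⊛ {f = f} {g = g} f≤ g≤ n) (empty _ _ (i<j⇒i-j<0 T+S<n))
    where
    empty : ∀ m φ → m ℤ.< 0ℤ → ∑ (terms m) φ ≈ 0#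
    empty (+ _)    φ (ℤ.+<+ ())
    empty -[1+ _ ] φ _ = ∑-empty φ

  digits-injective : ∀ {T f g} → Degree≤ T f → Degree≤ T g → (∀ k → digits T f k ≈ digits T g k) → f ≋ g
  digits-injective {T} f≤ g≤ f≈g n with above-or-below T n
  ... | inj₁ T<n            = trans (f≤ n T<n) (sym (g≤ n T<n))
  ... | inj₂ (k , ≡.refl)   = f≈g k

  coeff-0ᴸ : ∀ n → coeff 0ᴸ n ≈ 0#
  coeff-0ᴸ n with n ℤ.≟ 0ℤ
  ... | yes _ = refl
  ... | no _  = refl

  coeff-monomial : ∀ x d → coeff (monomial x d) d ≈ x
  coeff-monomial x d with d ℤ.≟ d
  ... | yes _  = refl
  ... | no d≢d = contradiction ≡.refl d≢d

  coeff-monomial-≢ : ∀ x {d n} → n ≢ d → coeff (monomial x d) n ≈ 0#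
  coeff-monomial-≢ x {d} {n} n≢d with n ℤ.≟ d
  ... | yes n≡d = contradiction n≡d n≢d
  ... | no _    = refl

  coeff-monomial-⊛ : ∀ x d f n → coeff (monomial x d ⊛ f) n ≈ x * coeff f (n ℤ.- d)
  coeff-monomial-⊛ x d f n with above-or-below (d ℤ.+ top f) n
  ... | inj₁ above = trans (⊛-degree {f = monomial x d} {g = f} (vanish (monomial x d)) (vanish f) n above)
    (sym (trans (*-congˡ (vanish f _ (≡.subst (ℤ._< n ℤ.- d) (arith d (top f)) (ℤ.+-monoˡ-< (ℤ.- d) above)))) (zeroʳ _)))
    where
    arith : ∀ d T → d ℤ.+ T ℤ.- d ≡ T
    arith = solve-∀
  ... | inj₂ (k , ≡.refl) = begin
    coeff (monomial x d ⊛ f) n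
      ≈⟨ digits-⊛ {f = monomial x d} {g = f} (vanish (monomial x d)) (vanish f) k ⟩
    (u ⋆ digits (top f) f) k
      ≈⟨ ∑-suc k _ ⟩
    u 0 * digits (top f) f k + ∑ k (λ t → u (suc t) * digits (top f) f (k ℕ.∸ suc t))
      ≈⟨ +-cong (*-cong u0≈x (reflexive (≡.cong (coeff f) (arith d (top f) (+ k)))))
                (∑-zero k λ t _ → trans (*-congʳ (u≈0 t)) (zeroˡ _)) ⟩
    x * coeff f (n ℤ.- d) + 0#
      ≈⟨ +-identityʳ _ ⟩
    x * coeff f (n ℤ.- d) ∎
    where
    u = digits d (monomial x d)
    u0≈x : u 0 ≈ x
    u0≈x = trans (reflexive (≡.cong (coeff (monomial x d)) (ℤ.+-identityʳ d))) (coeff-monomial x d)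
    u≈0 : ∀ t → u (suc t) ≈ 0#
    u≈0 t = coeff-monomial-≢ x (ℤ.<⇒≢ (≡.subst (d ℤ.- + suc t ℤ.<_) (ℤ.+-identityʳ d) (ℤ.+-monoʳ-< d ℤ.-<+)))
    arith : ∀ d T k → T ℤ.- k ≡ d ℤ.+ T ℤ.- k ℤ.- d
    arith = solve-∀

  coeff-const-⊛ : ∀ x f n → coeff (const x ⊛ f) n ≈ x * coeff f n
  coeff-const-⊛ x f n = trans (coeff-monomial-⊛ x 0ℤ f n)
    (*-congˡ (reflexive (≡.cong (coeff f) (ℤ.+-identityʳ n))))

  coeff-z-⊛ : ∀ f n → coeff (z ⊛ f) n ≈ coeff f (n ℤ.- 1ℤ)
  coeff-z-⊛ f n = trans (coeff-monomial-⊛ 1# 1ℤ f n) (*-identityˡ _)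

  Degree≤-cong : ∀ {T f g} → f ≋ g → Degree≤ T f → Degree≤ T g
  Degree≤-cong f≋g f≤ n T<n = trans (sym (f≋g n)) (f≤ n T<n)

  ⊛-cong : ∀ {f f′ g g′} → f ≋ f′ → g ≋ g′ → f ⊛ g ≋ f′ ⊛ g′
  ⊛-cong {f} {f′} {g} {g′} f≋f′ g≋g′ n = begin
    coeff (f ⊛ g) n
      ≈⟨ coeff-⊛ {f = f} {g = g} (vanish f) (vanish g) n ⟩
    window (top f) (top g) f g n
      ≈⟨ ∑-cong (terms (top f ℤ.+ top g ℤ.- n)) (λ t _ → *-cong (f≋f′ _) (g≋g′ _)) ⟩
    window (top f) (top g) f′ g′ n
      -- `f′` and `g′` may record other values of `top`, but those of `f` and `g` bound their
      -- degrees too.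
      ≈⟨ coeff-⊛ {f = f′} {g = g′} (Degree≤-cong {f = f} {f′} f≋f′ (vanish f))
                                     (Degree≤-cong {f = g} {g′} g≋g′ (vanish g)) n ⟨
    coeff (f′ ⊛ g′) n ∎

  ⊛-comm : ∀ f g → f ⊛ g ≋ g ⊛ f
  ⊛-comm f g = digits-injective {T = top f ℤ.+ top g} {f ⊛ g} {g ⊛ f}
    (vanish (f ⊛ g)) (≡.subst (λ T → Degree≤ T (g ⊛ f)) T≡ (vanish (g ⊛ f))) λ k → begin
      digits (top f ℤ.+ top g) (f ⊛ g) k
        ≈⟨ digits-⊛ {f = f} {g = g} (vanish f) (vanish g) k ⟩
      (digits (top f) f ⋆ digits (top g) g) k
        ≈⟨ ⋆-comm (digits (top f) f) (digits (top g) g) k ⟩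
      (digits (top g) g ⋆ digits (top f) f) k
        ≈⟨ digits-⊛ {f = g} {g = f} (vanish g) (vanish f) k ⟨
      digits (top g ℤ.+ top f) (g ⊛ f) k
        ≡⟨ ≡.cong (λ T → digits T (g ⊛ f) k) T≡ ⟩
      digits (top f ℤ.+ top g) (g ⊛ f) k ∎
    where
    T≡ = ℤ.+-comm (top g) (top f)

  ⊛-assoc : ∀ f g h → (f ⊛ g) ⊛ h ≋ f ⊛ (g ⊛ h)
  ⊛-assoc f g h = digits-injective {T = T ℤ.+ S ℤ.+ U} {(f ⊛ g) ⊛ h} {f ⊛ (g ⊛ h)}
    (vanish ((f ⊛ g) ⊛ h)) (≡.subst (λ T → Degree≤ T (f ⊛ (g ⊛ h))) T≡ (vanish (f ⊛ (g ⊛ h)))) λ k → begin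
      digits (T ℤ.+ S ℤ.+ U) ((f ⊛ g) ⊛ h) k
        ≈⟨ digits-⊛ {f = f ⊛ g} {g = h} (vanish (f ⊛ g)) (vanish h) k ⟩
      (digits (T ℤ.+ S) (f ⊛ g) ⋆ digits U h) k
        ≈⟨ ⋆-cong {v = digits U h} (digits-⊛ {f = f} {g = g} (vanish f) (vanish g)) (λ _ → refl) k ⟩
      ((digits T f ⋆ digits S g) ⋆ digits U h) k
        ≈⟨ ⋆-assoc (digits T f) (digits S g) (digits U h) k ⟩
      (digits T f ⋆ (digits S g ⋆ digits U h)) k
        ≈⟨ ⋆-cong {u = digits T f} (λ _ → refl) (digits-⊛ {f = g} {g = h} (vanish g) (vanish h)) k ⟨
      (digits T f ⋆ digits (S ℤ.+ U) (g ⊛ h)) k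
        ≈⟨ digits-⊛ {f = f} {g = g ⊛ h} (vanish f) (vanish (g ⊛ h)) k ⟨
      digits (T ℤ.+ (S ℤ.+ U)) (f ⊛ (g ⊛ h)) k
        ≡⟨ ≡.cong (λ T → digits T (f ⊛ (g ⊛ h)) k) T≡ ⟩
      digits (T ℤ.+ S ℤ.+ U) (f ⊛ (g ⊛ h)) k ∎
    where
    T = top f
    S = top g
    U = top h
    T≡ = ≡.sym (ℤ.+-assoc T S U)

  ⊛-distribʳ : ∀ h f g → (f ⊕ g) ⊛ h ≋ f ⊛ h ⊕ g ⊛ h
  ⊛-distribʳ h f g = digits-injective {T = T ℤ.+ top h} {(f ⊕ g) ⊛ h} {f ⊛ h ⊕ g ⊛ h}
    (vanish ((f ⊕ g) ⊛ h))
    (λ n T<n → trans (+-cong (⊛-degree {f = f} {g = h} f≤ (vanish h) n T<n) (⊛-degree {f = g} {g = h} g≤ (vanish h) n T<n))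
                     (+-identityˡ 0#))
    λ k → begin
      digits (T ℤ.+ top h) ((f ⊕ g) ⊛ h) k
        ≈⟨ digits-⊛ {f = f ⊕ g} {g = h} (vanish (f ⊕ g)) (vanish h) k ⟩
      ((λ t → digits T f t + digits T g t) ⋆ digits (top h) h) k
        ≈⟨ ⋆-distribʳ (digits (top h) h) (digits T f) (digits T g) k ⟩
      (digits T f ⋆ digits (top h) h) k + (digits T g ⋆ digits (top h) h) k
        ≈⟨ +-cong (digits-⊛ {f = f} {g = h} f≤ (vanish h) k) (digits-⊛ {f = g} {g = h} g≤ (vanish h) k) ⟨
      digits (T ℤ.+ top h) (f ⊛ h ⊕ g ⊛ h) k ∎
    where
    T = top f ℤ.⊔ top g
    f≤ : Degree≤ T f
    f≤ = Degree≤-mono f (ℤ.i≤i⊔j (top f) (top g)) (vanish f)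
    g≤ : Degree≤ T g
    g≤ = Degree≤-mono g (ℤ.i≤j⊔i (top f) (top g)) (vanish g)

  ⊛-identityˡ : ∀ f → 1ᴸ ⊛ f ≋ f
  ⊛-identityˡ f n = trans (coeff-const-⊛ 1# f n) (*-identityˡ _)

  ≋-trans : ∀ {f g h} → f ≋ g → g ≋ h → f ≋ h
  ≋-trans f≋g g≋h n = trans (f≋g n) (g≋h n)

  -- Opaque, so that two copies of the ring are compared without unfolding the proofs of the axioms.
  opaque
    ⊕-⊛-isCommutativeRing : IsCommutativeRing _≋_ _⊕_ _⊛_ ⊝_ 0ᴸ 1ᴸ
    ⊕-⊛-isCommutativeRing = record
      { isRing = record
        { +-isAbelianGroup = record
          { isGroup = record
            { isMonoid = record
              { isSemigroup = record
                { isMagma = record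
                  { isEquivalence = record
                    { refl  = λ n → refl
                    ; sym   = λ f≋g n → sym (f≋g n)
                    ; trans = λ {f} {g} {h} → ≋-trans {f} {g} {h}
                    }
                  ; ∙-cong = λ f≋ g≋ n → +-cong (f≋ n) (g≋ n)
                  }
                ; assoc = λ f g h n → +-assoc _ _ _
                }
              ; identity = (λ f n → trans (+-congʳ (coeff-0ᴸ n)) (+-identityˡ _))
                         , (λ f n → trans (+-congˡ (coeff-0ᴸ n)) (+-identityʳ _))
              }
            ; inverse = (λ f n → trans (-‿inverseˡ _) (sym (coeff-0ᴸ n)))
                      , (λ f n → trans (-‿inverseʳ _) (sym (coeff-0ᴸ n)))
            ; ⁻¹-cong = λ f≋ n → -‿cong (f≋ n)
            }
          ; comm = λ f g n → +-comm _ _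
          }
        ; *-cong = λ {f} {f′} {g} {g′} → ⊛-cong {f} {f′} {g} {g′}
        ; *-assoc = ⊛-assoc
        ; *-identity = ⊛-identityˡ , (λ f → ≋-trans {f ⊛ 1ᴸ} {1ᴸ ⊛ f} {f} (⊛-comm f 1ᴸ) (⊛-identityˡ f))
        ; distrib = (λ f g h → ≋-trans {f ⊛ (g ⊕ h)} {(g ⊕ h) ⊛ f} {f ⊛ g ⊕ f ⊛ h} (⊛-comm f (g ⊕ h))
                       (≋-trans {(g ⊕ h) ⊛ f} {g ⊛ f ⊕ h ⊛ f} {f ⊛ g ⊕ f ⊛ h} (⊛-distribʳ f g h)
                         λ n → +-cong (⊛-comm g f n) (⊛-comm h f n)))
                  , ⊛-distribʳ
        }
      ; *-comm = ⊛-comm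
      }

  laurentRing : CommutativeRing _ _
  laurentRing = record { isCommutativeRing = ⊕-⊛-isCommutativeRing }

  _≋[_]_ : Laurent → ℤ → Laurent → Set ℓ₁
  f ≋[ d ] g = ∀ n → d ℤ.< n → coeff f n ≈ coeff g n

  ≋[]⇒Degree≤ : ∀ {f d} → f ≋[ d ] 0ᴸ → Degree≤ d f
  ≋[]⇒Degree≤ f≋0 n d<n = trans (f≋0 n d<n) (coeff-0ᴸ n)

  Degree≤⇒≋[] : ∀ {f d} → Degree≤ d f → f ≋[ d ] 0ᴸ
  Degree≤⇒≋[] f≤d n d<n = trans (f≤d n d<n) (sym (coeff-0ᴸ n))

  laurentDegreeRing : DegreeRing _ _
  laurentDegreeRing = record
    { commutativeRing = laurentRing
    ; z         = z
    ; _≈[_]_    = _≋[_]_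
    ; ≈⇒≈[]     = λ _ f≋g n _ → f≋g n
    ; sym[]     = λ f≋g n d<n → sym (f≋g n d<n)
    ; trans[]   = λ f≋g g≋h n d<n → trans (f≋g n d<n) (g≋h n d<n)
    ; raise     = λ d≤e f≋g n e<n → f≋g n (ℤ.≤-<-trans d≤e e<n)
    ; separated = λ {f} {g} → separated {f} {g}
    ; +-cong[]  = λ f≋ g≋ n d<n → +-cong (f≋ n d<n) (g≋ n d<n)
    ; *-cong[]  = λ {a} {f} {g} → *-cong[] {a} {f} {g}
    ; *-degree  = λ b → top b , λ {f} f≋0 → Degree≤⇒≋[] {f ⊛ b}
                    (⊛-degree {f = f} {g = b} (≋[]⇒Degree≤ {f} f≋0) (vanish b))
    ; 1-degree  = Degree≤⇒≋[] {1ᴸ} (vanish 1ᴸ)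
    ; z-cancel  = λ {f} {g} → z-cancel {f} {g}
    }
    where
    separated : ∀ {f g} d → (∀ k → f ≋[ d ℤ.- + k ] g) → f ≋ g
    separated d f≋g n with above-or-below d n
    ... | inj₁ d<n          = f≋g 0 n (≡.subst (ℤ._< n) (≡.sym (ℤ.+-identityʳ d)) d<n)
    ... | inj₂ (k , ≡.refl) = f≋g (suc k) n (ℤ.+-monoʳ-< d (ℤ.neg-mono-< (ℤ.+<+ (ℕ.n<1+n k))))

    -- Since `a` has no coefficient of positive index, the coefficient of zⁿ in `a ⊛ f` involves
    -- only coefficients of `f` of index at least n.
    *-cong[] : ∀ {a f g d} → a ≋[ 0ℤ ] 0ᴸ → f ≋[ d ] g → (a ⊛ f) ≋[ d ] (a ⊛ g)
    *-cong[] {a} {f} {g} {d} a≋0 f≋g n d<n = begin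
      coeff (a ⊛ f) n
        ≈⟨ coeff-⊛ {f = a} {g = f} a≤0 (Degree≤-mono f (ℤ.i≤i⊔j (top f) (top g)) (vanish f)) n ⟩
      window 0ℤ S a f n
        ≈⟨ ∑-cong (terms (0ℤ ℤ.+ S ℤ.- n)) (λ t _ → *-congˡ (f≋g _ (ℤ.<-≤-trans d<n (n≤ t)))) ⟩
      window 0ℤ S a g n
        ≈⟨ coeff-⊛ {f = a} {g = g} a≤0 (Degree≤-mono g (ℤ.i≤j⊔i (top f) (top g)) (vanish g)) n ⟨
      coeff (a ⊛ g) n ∎
      where
      S = top f ℤ.⊔ top g
      a≤0 : Degree≤ 0ℤ a
      a≤0 = ≋[]⇒Degree≤ {a} a≋0
      n≤ : ∀ t → n ℤ.≤ n ℤ.- (0ℤ ℤ.- + t)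
      n≤ t = ≡.subst (n ℤ.≤_) (arith n (+ t)) (ℤ.i≤i+j n (+ t))
        where
        arith : ∀ n t → n ℤ.+ t ≡ n ℤ.- (0ℤ ℤ.- t)
        arith = solve-∀

    z-cancel : ∀ {f g d} → (z ⊛ f) ≋[ d ] (z ⊛ g) → f ≋[ d ℤ.- + 1 ] g
    z-cancel {f} {g} {d} zf≋zg n d-1<n = begin
      coeff f n
        ≡⟨ ≡.cong (coeff f) (arith n) ⟩
      coeff f (n ℤ.+ 1ℤ ℤ.- 1ℤ)
        ≈⟨ coeff-z-⊛ f (n ℤ.+ 1ℤ) ⟨
      coeff (z ⊛ f) (n ℤ.+ 1ℤ)
        ≈⟨ zf≋zg (n ℤ.+ 1ℤ) (≡.subst (ℤ._< n ℤ.+ 1ℤ) (arith′ d) (ℤ.+-monoˡ-< 1ℤ d-1<n)) ⟩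
      coeff (z ⊛ g) (n ℤ.+ 1ℤ)
        ≈⟨ coeff-z-⊛ g (n ℤ.+ 1ℤ) ⟩
      coeff g (n ℤ.+ 1ℤ ℤ.- 1ℤ)
        ≡⟨ ≡.cong (coeff g) (arith n) ⟨
      coeff g n ∎
      where
      arith : ∀ n → n ≡ n ℤ.+ 1ℤ ℤ.- 1ℤ
      arith = solve-∀
      arith′ : ∀ d → d ℤ.- 1ℤ ℤ.+ 1ℤ ≡ d
      arith′ = solve-∀

-- Lattice paths

module ListSums {c ℓ} (R : CommutativeSemiring c ℓ) where

  open CommutativeSemiring R hiding (zero)
  open SemiringSum semiring using (sum)
  open import Relation.Binary.Reasoning.Setoid setoid

  private variable
    A B D : Set

  Σᴸ : List A → (A → Carrier) → Carrier
  Σᴸ xs f = List.foldr _+_ 0# (List.map f xs)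

  Σᴸ-cong : ∀ (xs : List A) {f g : A → Carrier} → (∀ x → f x ≈ g x) → Σᴸ xs f ≈ Σᴸ xs g
  Σᴸ-cong []       f≈g = refl
  Σᴸ-cong (x ∷ xs) f≈g = +-cong (f≈g x) (Σᴸ-cong xs f≈g)

  Σᴸ-++ : ∀ (xs ys : List A) (f : A → Carrier) → Σᴸ (xs List.++ ys) f ≈ Σᴸ xs f + Σᴸ ys f
  Σᴸ-++ []       ys f = sym (+-identityˡ _)
  Σᴸ-++ (x ∷ xs) ys f = trans (+-congˡ (Σᴸ-++ xs ys f)) (sym (+-assoc _ _ _))

  Σᴸ-map : ∀ (g : A → B) xs (f : B → Carrier) → Σᴸ (List.map g xs) f ≈ Σᴸ xs (f ∘ g)
  Σᴸ-map g []       f = refl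
  Σᴸ-map g (x ∷ xs) f = +-congˡ (Σᴸ-map g xs f)

  *-Σᴸ : ∀ y (xs : List A) (f : A → Carrier) → y * Σᴸ xs f ≈ Σᴸ xs (λ x → y * f x)
  *-Σᴸ y []       f = zeroʳ y
  *-Σᴸ y (x ∷ xs) f = trans (distribˡ _ _ _) (+-congˡ (*-Σᴸ y xs f))

  Σᴸ-product : ∀ (_∙_ : A → B → D) xs ys (f : D → Carrier) →
               Σᴸ (List.cartesianProductWith _∙_ xs ys) f ≈ Σᴸ xs λ x → Σᴸ ys λ y → f (x ∙ y)
  Σᴸ-product _∙_ []       ys f = refl
  Σᴸ-product _∙_ (x ∷ xs) ys f = trans (Σᴸ-++ (List.map (x ∙_) ys) _ f)
    (+-cong (Σᴸ-map (x ∙_) ys f) (Σᴸ-product _∙_ xs ys f))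

  Σᴸ-tabulate : ∀ {n} (g : Fin n → A) (f : A → Carrier) → Σᴸ (List.tabulate g) f ≈ sum (f ∘ g)
  Σᴸ-tabulate {n = zero}  g f = refl
  Σᴸ-tabulate {n = suc n} g f = +-congˡ (Σᴸ-tabulate (g ∘ suc) f)

  Σᴸ-filter : ∀ {p} {P : Pred A p} (P? : Decidable P) xs (f : A → Carrier) →
              Σᴸ (List.filter P? xs) f ≈ Σᴸ xs λ x → if does (P? x) then f x else 0#
  Σᴸ-filter P? []       f = refl
  Σᴸ-filter P? (x ∷ xs) f with does (P? x)
  ... | true  = +-congˡ (Σᴸ-filter P? xs f)
  ... | false = trans (Σᴸ-filter P? xs f) (sym (+-identityˡ _))

module IntegerSums {c ℓ} (R : CommutativeSemiring c ℓ) where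

  open CommutativeSemiring R hiding (zero)
  open Sums R
  open import Relation.Binary.Reasoning.Setoid setoid

  -- The sum over the integers in [-N , N), split at 0 so as to fit the block form in which the
  -- negative heights are eliminated.
  Σᶻ : ℕ → (ℤ → Carrier) → Carrier
  Σᶻ N f = ∑ N (λ t → f (+ t)) + ∑ N (λ t → f -[1+ t ])

  ∑-negative : ∀ N (f : ℤ → Carrier) → ∑ N (λ s → f (ℤ.- + N ℤ.+ + s)) ≈ ∑ N λ t → f -[1+ t ]
  ∑-negative zero    f = trans (∑-empty _) (sym (∑-empty _))
  ∑-negative (suc N) f = begin
    ∑ (suc N) (λ s → f (-[1+ N ] ℤ.+ + s))
      ≈⟨ ∑-suc N _ ⟩
    f -[1+ N ] + ∑ N (λ s → f (-[1+ N ] ℤ.+ + suc s))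
      ≈⟨ +-congˡ (∑-cong N λ s _ → reflexive (≡.cong f (arith (+ N) (+ s)))) ⟩
    f -[1+ N ] + ∑ N (λ s → f (ℤ.- + N ℤ.+ + s))
      ≈⟨ +-congˡ (∑-negative N f) ⟩
    f -[1+ N ] + ∑ N (λ t → f -[1+ t ])
      ≈⟨ +-comm _ _ ⟩
    ∑ N (λ t → f -[1+ t ]) + f -[1+ N ]
      ≈⟨ ∑-last N _ ⟨
    ∑ (suc N) (λ t → f -[1+ t ]) ∎
    where
    arith : ∀ N s → ℤ.- (1ℤ ℤ.+ N) ℤ.+ (1ℤ ℤ.+ s) ≡ ℤ.- N ℤ.+ s
    arith = solve-∀

  ∑-symmetric : ∀ N (f : ℤ → Carrier) → ∑ (N ℕ.+ N) (λ s → f (ℤ.- + N ℤ.+ + s)) ≈ Σᶻ N f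
  ∑-symmetric N f = begin
    ∑ (N ℕ.+ N) (λ s → f (ℤ.- + N ℤ.+ + s))
      ≈⟨ ∑-split N _ ⟩
    ∑ N (λ s → f (ℤ.- + N ℤ.+ + s)) + ∑ N (λ t → f (ℤ.- + N ℤ.+ (+ N ℤ.+ + t)))
      ≈⟨ +-cong (∑-negative N f) (∑-cong N λ t _ → reflexive (≡.cong f (arith (+ N) (+ t)))) ⟩
    ∑ N (λ t → f -[1+ t ]) + ∑ N (λ t → f (+ t))
      ≈⟨ +-comm _ _ ⟩
    Σᶻ N f ∎
    where
    arith : ∀ N t → ℤ.- N ℤ.+ (N ℤ.+ t) ≡ t
    arith = solve-∀

  -- The window is padded with zeros on both sides, by `r` terms on the left. This lets the steps
  -- from all heights be summed over one common range.
  ∑-window : ∀ lo M N (f : ℤ → Carrier) → ℤ.- + N ℤ.≤ lo → lo ℤ.+ + M ℤ.≤ + N →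
             (∀ u → u ℤ.< lo ⊎ lo ℤ.+ + M ℤ.≤ u → f u ≈ 0#) →
             ∑ M (λ s → f (lo ℤ.+ + s)) ≈ Σᶻ N f
  ∑-window lo M N f -N≤lo hi≤N f≈0 with above-or-below lo (ℤ.- + N)
  ... | inj₁ lo<-N          = contradiction lo<-N (ℤ.≤⇒≯ -N≤lo)
  ... | inj₂ (r , -N≡lo-r) = begin
    ∑ M (λ s → f (lo ℤ.+ + s))
      ≈⟨ ∑-extend (ℕ.m+n≤o⇒m≤o∸n M (≡.subst (ℕ._≤ N ℕ.+ N) (ℕ.+-comm r M) r+M≤2N))
           (λ s M≤s → f≈0 _ (inj₂ (ℤ.+-monoʳ-≤ lo (ℤ.+≤+ M≤s)))) ⟨
    ∑ (N ℕ.+ N ℕ.∸ r) (λ s → f (lo ℤ.+ + s))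
      ≈⟨ ∑-cong (N ℕ.+ N ℕ.∸ r) (λ s _ → reflexive (≡.cong f (shifted s))) ⟩
    ∑ (N ℕ.+ N ℕ.∸ r) (λ s → f (ℤ.- + N ℤ.+ + (r ℕ.+ s)))
      ≈⟨ ∑-shift r (λ s s<r → f≈0 _ (inj₁ (below s s<r))) ⟨
    ∑ (r ℕ.+ (N ℕ.+ N ℕ.∸ r)) (λ s → f (ℤ.- + N ℤ.+ + s))
      ≡⟨ ≡.cong (λ m → ∑ m λ s → f (ℤ.- + N ℤ.+ + s)) (ℕ.m+[n∸m]≡n (ℕ.m+n≤o⇒m≤o r r+M≤2N)) ⟩
    ∑ (N ℕ.+ N) (λ s → f (ℤ.- + N ℤ.+ + s))
      ≈⟨ ∑-symmetric N f ⟩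
    Σᶻ N f ∎
    where
    lo≡ : lo ≡ ℤ.- + N ℤ.+ + r
    lo≡ = ≡.trans (arith lo (+ r)) (≡.cong (ℤ._+ + r) (≡.sym -N≡lo-r))
      where
      arith : ∀ lo r → lo ≡ lo ℤ.- r ℤ.+ r
      arith = solve-∀
    shifted : ∀ s → lo ℤ.+ + s ≡ ℤ.- + N ℤ.+ + (r ℕ.+ s)
    shifted s = ≡.trans (≡.cong (ℤ._+ + s) lo≡) (ℤ.+-assoc (ℤ.- + N) (+ r) (+ s))
    below : ∀ s → s < r → ℤ.- + N ℤ.+ + s ℤ.< lo
    below s s<r = ≡.subst (ℤ.- + N ℤ.+ + s ℤ.<_) (≡.sym lo≡) (ℤ.+-monoʳ-< (ℤ.- + N) (ℤ.+<+ s<r))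
    r+M≤2N : r ℕ.+ M ≤ N ℕ.+ N
    r+M≤2N = ℤ.drop‿+≤+ (≡.subst (ℤ._≤ + N ℤ.+ + N)
      (≡.trans (≡.cong (λ lo → + N ℤ.+ (lo ℤ.+ + M)) lo≡) (arith (+ N) (+ r) (+ M)))
      (ℤ.+-monoʳ-≤ (+ N) hi≤N))
      where
      arith : ∀ N r M → N ℤ.+ (ℤ.- N ℤ.+ r ℤ.+ M) ≡ r ℤ.+ M
      arith = solve-∀

module Walks {c ℓ₁ ℓ₂} (F : HeytingField c ℓ₁ ℓ₂) (p′ q′ : ℕ)
  (a : ℤ → ℤ → HeytingField.Carrier F) where

  open ContinuedFraction F p′ q′ a
  open HeytingCommutativeRing heytingCommutativeRing using () renaming (commutativeRing to coefficientRing)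
  open CommutativeRing coefficientRing
    using (refl; sym; trans; reflexive; setoid; +-identityʳ; *-congˡ; *-congʳ; zeroˡ; zeroʳ; commutativeSemiring)
  open Sums commutativeSemiring using (∑; ∑≡sum; ∑-cong; sum-cong)
  open ListSums commutativeSemiring
  open IntegerSums commutativeSemiring
  open import Relation.Binary.Reasoning.Setoid setoid

  InRange : ℤ → Set
  InRange k = ℤ.- + p ℤ.≤ k × k ℤ.≤ + q

  -- The weight of the step from height x to height u, and 0 if there is no such step.
  ω : ℤ → ℤ → C
  ω x u = if does (ℤ.- + p ℤ.≤? u ℤ.- x) ∧ does (u ℤ.- x ℤ.≤? + q) then stepWeight x (u ℤ.- x) else 0#

  ω-step : ∀ x u → InRange (u ℤ.- x) → ω x u ≡ stepWeight x (u ℤ.- x)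
  ω-step x u (lo , hi) with ℤ.- + p ℤ.≤? u ℤ.- x | u ℤ.- x ℤ.≤? + q
  ... | yes _ | yes _ = ≡.refl
  ... | yes _ | no ¬hi = contradiction hi ¬hi
  ... | no ¬lo | _     = contradiction lo ¬lo

  ω-none : ∀ x u → u ℤ.< x ℤ.- + p ⊎ x ℤ.+ + q ℤ.< u → ω x u ≡ 0#
  ω-none x u out with ℤ.- + p ℤ.≤? u ℤ.- x | u ℤ.- x ℤ.≤? + q
  ... | no _   | _     = ≡.refl
  ... | yes _  | no _  = ≡.refl
  ... | yes lo | yes hi = contradiction out λ
    { (inj₁ u<) → ℤ.<-irrefl ≡.refl (ℤ.<-≤-trans u< (≡.subst₂ ℤ._≤_ (ℤ.+-comm (ℤ.- + p) x) (arith u x) (ℤ.+-monoˡ-≤ x lo)))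
    ; (inj₂ <u) → ℤ.<-irrefl ≡.refl (ℤ.<-≤-trans <u (≡.subst₂ ℤ._≤_ (arith u x) (ℤ.+-comm (+ q) x) (ℤ.+-monoˡ-≤ x hi))) }
    where
    arith : ∀ u x → u ℤ.- x ℤ.+ x ≡ u
    arith = solve-∀

  ω-increment : ∀ x s → ω x (x ℤ.+ increment s) ≡ stepWeight x (increment s)
  ω-increment x s = ≡.trans
    (ω-step x (x ℤ.+ increment s) (≡.subst InRange (≡.sym x+k-x≡k) (lo , hi)))
    (≡.cong (stepWeight x) x+k-x≡k)
    where
    x+k-x≡k : x ℤ.+ increment s ℤ.- x ≡ increment s
    x+k-x≡k = arith x (increment s)
      where
      arith : ∀ x k → x ℤ.+ k ℤ.- x ≡ k
      arith = solve-∀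
    lo : ℤ.- + p ℤ.≤ increment s
    lo = ≡.subst (ℤ._≤ increment s) (ℤ.+-identityˡ _) (ℤ.+-monoˡ-≤ (ℤ.- + p) (ℤ.+≤+ (z≤n {toℕ s})))
    hi : increment s ℤ.≤ + q
    hi = ≡.subst (increment s ℤ.≤_) (arith (+ p) (+ q))
      (ℤ.+-monoˡ-≤ (ℤ.- + p) (ℤ.+≤+ (ℕ.≤-pred (Fin.toℕ<n s))))
      where
      arith : ∀ p q → p ℤ.+ q ℤ.- p ≡ q
      arith = solve-∀

  ωIn : (ℤ → Bool) → ℤ → ℤ → C
  ωIn S x u = if S u then ω x u else 0#

  ωIn-none : ∀ S x u → u ℤ.< x ℤ.- + p ⊎ x ℤ.+ + q ℤ.< u → ωIn S x u ≡ 0#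
  ωIn-none S x u out with S u
  ... | true  = ω-none x u out
  ... | false = ≡.refl

  -- The total weight of the paths of length n from x to j whose heights after the first lie in S.
  walk : (ℤ → Bool) → ℕ → ℤ → ℤ → C
  walk S zero    x j = if does (x ℤ.≟ j) then 1# else 0#
  walk S (suc n) x j = sumC λ s → ωIn S x (x ℤ.+ increment s) * walk S n (x ℤ.+ increment s) j

  -- The condition on the final height is included, so that both kinds of path collections reduce to
  -- the single recursion `walk`.
  stays : (ℤ → Bool) → ℤ → ∀ {n} → ℤ → Vec Step n → Bool
  stays S j x []      = does (x ℤ.≟ j)
  stays S j x (s ∷ γ) = S (x ℤ.+ increment s) ∧ stays S j (x ℤ.+ increment s) γ

  Σᴸ-stays : ∀ S j n x →
    Σᴸ (allPaths n) (λ γ → if stays S j x γ then weight x γ else 0#) ≈ walk S n x j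
  Σᴸ-stays S j zero    x = +-identityʳ _
  Σᴸ-stays S j (suc n) x = begin
    Σᴸ (allPaths (suc n)) (λ γ → if stays S j x γ then weight x γ else 0#)
      ≈⟨ Σᴸ-product {A = Step} {D = Vec Step (suc n)} Vec._∷_ (List.allFin _) (allPaths n)
           (λ γ → if stays S j x γ then weight x γ else 0#) ⟩
    Σᴸ (List.allFin _) (λ s → Σᴸ (allPaths n) λ γ →
      if S (y s) ∧ stays S j (y s) γ then stepWeight x (increment s) * weight (y s) γ else 0#)
      ≈⟨ Σᴸ-tabulate id (λ s → Σᴸ (allPaths n) λ γ →
           if S (y s) ∧ stays S j (y s) γ then stepWeight x (increment s) * weight (y s) γ else 0#) ⟩
    sumC (λ s → Σᴸ (allPaths n) λ γ →
      if S (y s) ∧ stays S j (y s) γ then stepWeight x (increment s) * weight (y s) γ else 0#)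
      ≈⟨ sum-cong (λ s → Σᴸ-cong (allPaths n)
           {λ γ → if S (y s) ∧ stays S j (y s) γ then stepWeight x (increment s) * weight (y s) γ else 0#}
           {λ γ → ωIn S x (y s) * (if stays S j (y s) γ then weight (y s) γ else 0#)} λ γ → trans
           (if-∧ (S (y s)) (stays S j (y s) γ))
           (*-congʳ (reflexive (≡.cong (λ v → if S (y s) then v else 0#) (≡.sym (ω-increment x s)))))) ⟩
    sumC (λ s → Σᴸ (allPaths n) λ γ →
      ωIn S x (y s) * (if stays S j (y s) γ then weight (y s) γ else 0#))
      ≈⟨ sum-cong (λ s → sym (*-Σᴸ (ωIn S x (y s)) (allPaths n) λ γ → if stays S j (y s) γ then weight (y s) γ else 0#)) ⟩
    sumC (λ s → ωIn S x (y s) * Σᴸ (allPaths n) λ γ → if stays S j (y s) γ then weight (y s) γ else 0#)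
      ≈⟨ sum-cong (λ s → *-congˡ {x = ωIn S x (y s)} (Σᴸ-stays S j n (y s))) ⟩
    walk S (suc n) x j ∎
    where
    y : Step → ℤ
    y s = x ℤ.+ increment s
    if-∧ : ∀ b b′ {v w} → (if b ∧ b′ then v * w else 0#) ≈ (if b then v else 0#) * (if b′ then w else 0#)
    if-∧ true  true  = refl
    if-∧ true  false = sym (zeroʳ _)
    if-∧ false b′    = sym (zeroˡ _)

  totalWeight-𝒫 : ∀ S → (∀ u → S u ≡ true) → ∀ n x j → totalWeight x (𝒫 n x j) ≈ walk S n x j
  totalWeight-𝒫 S all n x j = begin
    totalWeight x (𝒫 n x j)
      ≈⟨ Σᴸ-filter (λ γ → finalHeight x γ ℤ.≟ j) (allPaths n) (weight x) ⟩
    Σᴸ (allPaths n) (λ γ → if does (finalHeight x γ ℤ.≟ j) then weight x γ else 0#)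
      ≈⟨ Σᴸ-cong (allPaths n) (λ γ → reflexive (≡.cong (λ b → if b then weight x γ else 0#) (final x γ))) ⟩
    Σᴸ (allPaths n) (λ γ → if stays S j x γ then weight x γ else 0#)
      ≈⟨ Σᴸ-stays S j n x ⟩
    walk S n x j ∎
    where
    final : ∀ {n} x (γ : Vec Step n) → does (finalHeight x γ ℤ.≟ j) ≡ stays S j x γ
    final x []      = ≡.refl
    final x (s ∷ γ) rewrite all (x ℤ.+ increment s) = final (x ℤ.+ increment s) γ

  negative : ℤ → Bool
  negative u = does (u ℤ.≤? -1ℤ)

  -- The filter tests every height, `walk` all but the first. The initial height is negative by its
  -- form, so `negative x` evaluates to `true` and the two conditions agree.
  totalWeight-𝒟̂ : ∀ n t j → totalWeight -[1+ t ] (𝒟̂ n -[1+ t ] j) ≈ walk negative n -[1+ t ] j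
  totalWeight-𝒟̂ n t j = begin
    totalWeight x (𝒟̂ n x j)
      ≈⟨ Σᴸ-filter (λ γ → All.all? (ℤ._≤? -1ℤ) (heights x γ)) (𝒫 n x j) (weight x) ⟩
    Σᴸ (𝒫 n x j) (λ γ → if below x γ then weight x γ else 0#)
      ≈⟨ Σᴸ-filter (λ γ → finalHeight x γ ℤ.≟ j) (allPaths n) _ ⟩
    Σᴸ (allPaths n) (λ γ → if does (finalHeight x γ ℤ.≟ j) then (if below x γ then weight x γ else 0#) else 0#)
      ≈⟨ Σᴸ-cong (allPaths n) (λ γ → reflexive (≡.trans
           (if-if (below x γ) (does (finalHeight x γ ℤ.≟ j)))
           (≡.cong (λ b → if b then weight x γ else 0#) (below-final x γ)))) ⟩
    Σᴸ (allPaths n) (λ γ → if stays negative j x γ then weight x γ else 0#)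
      ≈⟨ Σᴸ-stays negative j n x ⟩
    walk negative n x j ∎
    where
    x = -[1+ t ]
    below : ∀ {n} → ℤ → Vec Step n → Bool
    below x γ = does (All.all? (ℤ._≤? -1ℤ) (heights x γ))
    if-if : ∀ b b′ {v : C} → (if b′ then (if b then v else 0#) else 0#) ≡ (if b ∧ b′ then v else 0#)
    if-if true  b′    = ≡.refl
    if-if false true  = ≡.refl
    if-if false false = ≡.refl
    below-final : ∀ {n} x (γ : Vec Step n) →
      below x γ ∧ does (finalHeight x γ ℤ.≟ j) ≡ negative x ∧ stays negative j x γ
    below-final x []      = ≡.cong (_∧ does (x ℤ.≟ j)) (Bool.∧-identityʳ (negative x))
    below-final x (s ∷ γ) = ≡.trans (Bool.∧-assoc (negative x) _ _)
      (≡.cong (negative x ∧_) (below-final (x ℤ.+ increment s) γ))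

  -- All steps from x end in [-N , N).
  Fits : ℕ → ℤ → Set
  Fits N x = ℤ.- + N ℤ.≤ x ℤ.- + p × x ℤ.+ + suc q ℤ.≤ + N

  walk-suc : ∀ S n N x j → Fits N x → walk S (suc n) x j ≈ Σᶻ N λ u → ωIn S x u * walk S n u j
  walk-suc S n N x j (-N≤ , ≤N) = begin
    sumC (λ s → f (x ℤ.+ increment s))
      ≡⟨ ∑≡sum (suc (p ℕ.+ q)) (λ s → f (x ℤ.+ (+ s ℤ.- + p))) ⟨
    ∑ (suc (p ℕ.+ q)) (λ s → f (x ℤ.+ (+ s ℤ.- + p)))
      ≈⟨ ∑-cong (suc (p ℕ.+ q)) (λ s _ → reflexive (≡.cong f (arith x (+ s) (+ p)))) ⟩
    ∑ (suc (p ℕ.+ q)) (λ s → f (x ℤ.- + p ℤ.+ + s))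
      ≈⟨ ∑-window (x ℤ.- + p) (suc (p ℕ.+ q)) N f -N≤ (≡.subst (ℤ._≤ + N) (≡.sym end) ≤N) f≈0 ⟩
    Σᶻ N f ∎
    where
    f : ℤ → C
    f u = ωIn S x u * walk S n u j
    arith : ∀ x s p → x ℤ.+ (s ℤ.- p) ≡ x ℤ.- p ℤ.+ s
    arith = solve-∀
    end : x ℤ.- + p ℤ.+ + suc (p ℕ.+ q) ≡ x ℤ.+ + suc q
    end = arith′ x (+ p) (+ q)
      where
      arith′ : ∀ x p q → x ℤ.- p ℤ.+ (1ℤ ℤ.+ (p ℤ.+ q)) ≡ x ℤ.+ (1ℤ ℤ.+ q)
      arith′ = solve-∀
    f≈0 : ∀ u → u ℤ.< x ℤ.- + p ⊎ x ℤ.- + p ℤ.+ + suc (p ℕ.+ q) ℤ.≤ u → f u ≈ 0#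
    f≈0 u out = trans (*-congʳ (reflexive (ωIn-none S x u (outside out)))) (zeroˡ _)
      where
      outside : u ℤ.< x ℤ.- + p ⊎ x ℤ.- + p ℤ.+ + suc (p ℕ.+ q) ℤ.≤ u → u ℤ.< x ℤ.- + p ⊎ x ℤ.+ + q ℤ.< u
      outside (inj₁ u<) = inj₁ u<
      outside (inj₂ ≤u) = inj₂ (ℤ.<-≤-trans (ℤ.+-monoʳ-< x (ℤ.+<+ (ℕ.n<1+n q)))
        (≡.subst (ℤ._≤ u) end ≤u))

-- Elimination of the negative heights

module Resolvent {c ℓ} (R : DegreeRing c ℓ) where

  open DegreeRing R
  open BandedInverse R
  open RingProperties ring using ([y-z]x≈yx-zx; x[y-z]≈xy-xz)
  open import Relation.Binary.Reasoning.Setoid setoid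

  -- Translates between products with the matrix z I - A, as in `IsProduct`, and the recurrence form
  -- in `RightInverse`; `i < N` puts the diagonal term in range.
  row-product : ∀ (A ζ : ℕ → ℕ → Carrier) i j N → i < N →
    ∑ N (λ l → (z * δ i l - A i l) * ζ l j) ≈ z * ζ i j - ∑ N λ l → A i l * ζ l j
  row-product A ζ i j N i<N = begin
    ∑ N (λ l → (z * δ i l - A i l) * ζ l j)
      ≈⟨ ∑-cong N (λ l _ → trans ([y-z]x≈yx-zx _ _ _) (+-congʳ (*-assoc _ _ _))) ⟩
    ∑ N (λ l → z * (δ i l * ζ l j) - A i l * ζ l j)
      ≈⟨ ∑-+ N _ _ ⟩
    ∑ N (λ l → z * (δ i l * ζ l j)) + ∑ N (λ l → - (A i l * ζ l j))
      ≈⟨ +-cong (sym (*-∑ N z _)) (∑-neg N _) ⟩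
    z * ∑ N (λ l → δ i l * ζ l j) - ∑ N (λ l → A i l * ζ l j)
      ≈⟨ +-congʳ (*-congˡ (∑-δ N i (λ l → ζ l j) λ N≤i → contradiction i<N (ℕ.≤⇒≯ N≤i))) ⟩
    z * ζ i j - ∑ N (λ l → A i l * ζ l j) ∎

  column-product : ∀ (A ζ : ℕ → ℕ → Carrier) i j N → j < N →
    ∑ N (λ l → ζ i l * (z * δ l j - A l j)) ≈ z * ζ i j - ∑ N λ l → ζ i l * A l j
  column-product A ζ i j N j<N = begin
    ∑ N (λ l → ζ i l * (z * δ l j - A l j))
      ≈⟨ ∑-cong N (λ l _ → trans (x[y-z]≈xy-xz _ _ _) (+-congʳ (x∙yz≈y∙xz _ _ _))) ⟩
    ∑ N (λ l → z * (ζ i l * δ l j) - ζ i l * A l j)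
      ≈⟨ ∑-+ N _ _ ⟩
    ∑ N (λ l → z * (ζ i l * δ l j)) + ∑ N (λ l → - (ζ i l * A l j))
      ≈⟨ +-cong (sym (*-∑ N z _)) (∑-neg N _) ⟩
    z * ∑ N (λ l → ζ i l * δ l j) - ∑ N (λ l → ζ i l * A l j)
      ≈⟨ +-congʳ (*-congˡ (∑-*-δ N j (ζ i) λ N≤j → contradiction j<N (ℕ.≤⇒≯ N≤j))) ⟩
    z * ζ i j - ∑ N (λ l → ζ i l * A l j) ∎
    where open CommutativeSemigroupProperties *-commutativeSemigroup using (x∙yz≈y∙xz)

  difference : ∀ {x y e} → x - y ≈ e → x ≈ e + y
  difference {x} {y} {e} eq = begin
    x           ≈⟨ +-identityʳ _ ⟨
    x + 0#      ≈⟨ +-congˡ (-‿inverseˡ y) ⟨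
    x + (- y + y) ≈⟨ +-assoc _ _ _ ⟨
    x - y + y   ≈⟨ +-congʳ eq ⟩
    e + y       ∎

  difference⁻¹ : ∀ {x y e} → x ≈ e + y → x - y ≈ e
  difference⁻¹ {x} {y} {e} eq = begin
    x - y         ≈⟨ +-congʳ eq ⟩
    e + y - y     ≈⟨ +-assoc _ _ _ ⟩
    e + (y - y)   ≈⟨ +-congˡ (-‿inverseʳ y) ⟩
    e + 0#        ≈⟨ +-identityʳ _ ⟩
    e             ∎

  -- B and X are the restrictions to the indices ≥ 0 and < 0 of a solution of the recurrence with
  -- matrix [[H, U], [E, D]].  Since (z I - D) X = E B, we have X = (z I - D)⁻¹ E B, and eliminating X
  -- adds U (z I - D)⁻¹ E to H.
  module FirstExit (w p q : ℕ) (p≤w : p ≤ w) (q≤w : q ≤ w)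
    {D V E U H : ℕ → ℕ → Carrier} {b B X : ℕ → Carrier}
    (D-small : Small D) (V-inverse : RightInverse w D V) (V-bounded : BoundedMatrix V)
    -- A step from -1-t to s rises by t + s + 1, which is at most q; a step from i to -1-v falls by
    -- at least v + 1, which is at most p.
    (E≈0 : ∀ t s → q ≤ t ℕ.+ s → E t s ≈ 0#) (U≈0 : ∀ i v → p ≤ v → U i v ≈ 0#)
    (X-bounded : Bounded X)
    (X-step : ∀ t N → t ℕ.+ w < N → z * X t ≈ ∑ N (λ s → E t s * B s) + ∑ N (λ v → D t v * X v))
    (B-step : ∀ i N → i ℕ.+ w < N → z * B i ≈ b i + (∑ N (λ s → H i s * B s) + ∑ N (λ v → U i v * X v)))
    where

    -- The entries of H + U V E, with the factors reordered as in `correction`.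
    K : ℕ → ℕ → Carrier
    K i s = H i s + ∑ p λ v → ∑ q λ u → U i v * E u s * V v u

    -- The paths from the negative height with index `u` whose very first step leads to a height ≥
    -- 0.
    exit : ℕ → Carrier
    exit u = ∑ q λ s → E u s * B s

    q≤N : ∀ {t N} → t ℕ.+ w < N → q ≤ N
    q≤N {t} t<N = ℕ.≤-trans q≤w (ℕ.≤-trans (ℕ.m≤n+m w t) (ℕ.<⇒≤ t<N))

    p≤N : ∀ {t N} → t ℕ.+ w < N → p ≤ N
    p≤N {t} t<N = ℕ.≤-trans p≤w (ℕ.≤-trans (ℕ.m≤n+m w t) (ℕ.<⇒≤ t<N))

    E*B≈0 : ∀ t s → q ≤ t ℕ.+ s → E t s * B s ≈ 0#
    E*B≈0 t s q≤ = trans (*-congʳ (E≈0 t s q≤)) (zeroˡ _)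

    -- Decomposition at the first exit: `exit` is supported below `q`, because no step from a lower
    -- height reaches 0, so the system for `X` with matrix `D` is solved by finitely many columns of
    -- `V`.
    X-exit : ∀ t → X t ≈ ∑ q λ u → V t u * exit u
    X-exit = solve w q D-small V-inverse V-bounded
      (λ u q≤u → ∑-zero q λ s _ → E*B≈0 u s (ℕ.≤-trans q≤u (ℕ.m≤m+n u s)))
      X-bounded
      (λ t N t<N → trans (X-step t N t<N) (+-congʳ (∑-extend (q≤N {t} t<N) λ s q≤s →
        E*B≈0 t s (ℕ.≤-trans q≤s (ℕ.m≤n+m s t)))))

    ∑-U*X : ∀ i N → q ≤ N → p ≤ N →
      ∑ N (λ v → U i v * X v) ≈ ∑ N λ s → (∑ p λ v → ∑ q λ u → U i v * E u s * V v u) * B s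
    ∑-U*X i N q≤N p≤N = begin
      ∑ N (λ v → U i v * X v)
        ≈⟨ ∑-extend p≤N (λ v p≤v → trans (*-congʳ (U≈0 i v p≤v)) (zeroˡ _)) ⟩
      ∑ p (λ v → U i v * X v)
        ≈⟨ ∑-cong p (λ v _ → trans (*-congˡ (X-exit v)) (*-∑ q _ _)) ⟩
      ∑ p (λ v → ∑ q λ u → U i v * (V v u * exit u))
        ≈⟨ ∑-cong p (λ v _ → ∑-cong q λ u _ → begin
             U i v * (V v u * exit u)
               ≈⟨ *-assoc _ _ _ ⟨
             U i v * V v u * exit u
               ≈⟨ *-∑ q _ _ ⟩
             ∑ q (λ s → U i v * V v u * (E u s * B s))
               ≈⟨ ∑-extend q≤N (λ s q≤s → trans (*-congˡ (E*B≈0 u s (ℕ.≤-trans q≤s (ℕ.m≤n+m s u)))) (zeroʳ _)) ⟨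
             ∑ N (λ s → U i v * V v u * (E u s * B s))
               ≈⟨ ∑-cong N (λ s _ → trans (sym (*-assoc _ _ _)) (*-congʳ (xy∙z≈xz∙y _ _ _))) ⟩
             ∑ N (λ s → U i v * E u s * V v u * B s) ∎) ⟩
      ∑ p (λ v → ∑ q λ u → ∑ N λ s → U i v * E u s * V v u * B s)
        ≈⟨ ∑-cong p (λ v _ → ∑-swap q N _) ⟩
      ∑ p (λ v → ∑ N λ s → ∑ q λ u → U i v * E u s * V v u * B s)
        ≈⟨ ∑-swap p N _ ⟩
      ∑ N (λ s → ∑ p λ v → ∑ q λ u → U i v * E u s * V v u * B s)
        ≈⟨ ∑-cong N (λ s _ → trans (∑-cong p λ v _ → sym (∑-* q (B s) _)) (sym (∑-* p (B s) _))) ⟩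
      ∑ N (λ s → (∑ p λ v → ∑ q λ u → U i v * E u s * V v u) * B s) ∎
      where
      open CommutativeSemigroupProperties *-commutativeSemigroup using (xy∙z≈xz∙y)

    eliminate : Solves w K b B
    eliminate i N i<N = begin
      z * B i
        ≈⟨ B-step i N i<N ⟩
      b i + (∑ N (λ s → H i s * B s) + ∑ N (λ v → U i v * X v))
        ≈⟨ +-congˡ (+-congˡ (∑-U*X i N (q≤N {i} i<N) (p≤N {i} i<N))) ⟩
      b i + (∑ N (λ s → H i s * B s) + ∑ N (λ s → (∑ p λ v → ∑ q λ u → U i v * E u s * V v u) * B s))
        ≈⟨ +-congˡ (∑-+ N _ _) ⟨
      b i + ∑ N (λ s → H i s * B s + (∑ p λ v → ∑ q λ u → U i v * E u s * V v u) * B s)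
        ≈⟨ +-congˡ (∑-cong N λ s _ → sym (distribʳ _ _ _)) ⟩
      b i + ∑ N (λ s → K i s * B s) ∎

    -- When no height below `r` can be entered, the rows from `r` on form a closed system for the
    -- unknowns from `r` on.
    eliminate-from : ∀ r → (∀ i s → s < r → K i s ≈ 0#) →
      Solves w (λ i l → K (r ℕ.+ i) (r ℕ.+ l)) (λ i → b (r ℕ.+ i)) (λ i → B (r ℕ.+ i))
    eliminate-from r K≈0 i N i<N = trans
      (eliminate (r ℕ.+ i) (r ℕ.+ N) (≡.subst (ℕ._< r ℕ.+ N) (≡.sym (ℕ.+-assoc r i w)) (ℕ.+-monoʳ-< r i<N)))
      (+-congˡ (∑-shift r λ s s<r → trans (*-congʳ (K≈0 _ s s<r)) (zeroˡ _)))

-- The continued fraction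

m<n∸o⇒m+o<n : ∀ {m n o} → m < n ℕ.∸ o → m ℕ.+ o < n
m<n∸o⇒m+o<n {m} {n} {o} m<n∸o = ℕ.m≤o∸n⇒m+n≤o (suc m)
  (ℕ.<⇒≤ (ℕ.m∸n≢0⇒n<m λ n∸o≡0 → ℕ.n≮0 (≡.subst (m <_) n∸o≡0 m<n∸o))) m<n∸o

module Expansion {c ℓ₁ ℓ₂} (F : HeytingField c ℓ₁ ℓ₂) (p′ q′ : ℕ)
  (a : ℤ → ℤ → HeytingField.Carrier F) where

  open ContinuedFraction F p′ q′ a
  open LaurentRing F
  open Walks F p′ q′ a
  open HeytingCommutativeRing heytingCommutativeRing using () renaming (commutativeRing to coefficientRing)
  module C where
    open CommutativeRing coefficientRing public
    open Sums commutativeSemiring public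
  module L where
    open DegreeRing laurentDegreeRing public hiding (z)
    open Sums commutativeSemiring public
  open L using (∑; ∑≡sum; ∑-empty; ∑-suc; ∑-cong; ∑-zero; ∑-extend; δ)
  open IntegerSums C.commutativeSemiring using (Σᶻ)
  open BandedInverse laurentDegreeRing
    using (RightInverse; Small; BoundedMatrix; unique; leftInverse; ∑-neg; ∑-degree; δ-degree; module SchurComplement)
  open Resolvent laurentDegreeRing using (row-product; column-product; difference; difference⁻¹; module FirstExit)
  open RingProperties L.ring using (-‿distribˡ-*)
  open import Relation.Binary.Reasoning.Setoid L.setoid

  -- Bounds the length of every step, up or down, so that one width serves for both sides of the
  -- band and for truncating the recurrences on both sides of 0.
  w : ℕ
  w = p ℕ.+ q

  coeff-∑ : ∀ N f n → coeff (∑ N f) n ≈ C.∑ N λ t → coeff (f t) n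
  coeff-∑ zero    f n = C.trans (∑-empty f n) (C.trans (coeff-0ᴸ n) (C.sym (C.∑-empty λ t → coeff (f t) n)))
  coeff-∑ (suc N) f n = C.trans (∑-suc N f n) (C.trans
    (C.+-congˡ (coeff-∑ N (f ∘ suc) n))
    (C.sym (C.∑-suc N λ t → coeff (f t) n)))

  const-cong : ∀ {x y} → x ≈ y → const x ≋ const y
  const-cong x≈y n with n ℤ.≟ 0ℤ
  ... | yes _ = x≈y
  ... | no _  = C.refl

  const-0 : ∀ {x} f → x ≡ 0# → const x ⊛ f ≋ 0ᴸ
  const-0 f ≡.refl = L.zeroˡ f

  const≋0 : ∀ {x} → x ≡ 0# → const x ≋ 0ᴸ
  const≋0 ≡.refl n = C.refl

  const-* : ∀ x y → const (x * y) ≋ const x ⊛ const y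
  const-* x y n = C.sym (C.trans (coeff-const-⊛ x (const y) n) scaled)
    where
    scaled : x * coeff (const y) n ≈ coeff (const (x * y)) n
    scaled with n ℤ.≟ 0ℤ
    ... | yes _ = C.refl
    ... | no _  = C.zeroʳ x

  const-small : ∀ x → const x ≋[ 0ℤ ] 0ᴸ
  const-small x = Degree≤⇒≋[] {const x} (vanish (const x))

  -- First-step recurrences of the generating functions

  Y : (ℤ → Bool) → ℤ → ℤ → Laurent
  Y S x j = generating λ n → walk S n x j

  Y-degree : ∀ S x j → Y S x j ≋[ -1ℤ ] 0ᴸ
  Y-degree S x j = Degree≤⇒≋[] {Y S x j} (vanish (Y S x j))

  δᶻ : ℤ → ℤ → Laurent
  δᶻ x j = if does (x ℤ.≟ j) then 1ᴸ else 0ᴸ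

  -- At 1/zⁿ with n ≥ 1 this is `walk-suc`. At z⁰ only the path of length zero contributes, giving
  -- δᶻ, and at positive powers everything vanishes.
  Y-step : ∀ S N x j → Fits N x → z ⊛ Y S x j ≋
    δᶻ x j ⊕ (∑ N (λ t → const (ωIn S x (+ t)) ⊛ Y S (+ t) j) ⊕ ∑ N (λ t → const (ωIn S x -[1+ t ]) ⊛ Y S -[1+ t ] j))
  Y-step S N x j fits n = C.trans (coeff-z-⊛ (Y S x j) n) (C.trans (compare n) (C.sym (C.+-congˡ expand)))
    where
    term : ℤ → Laurent
    term u = const (ωIn S x u) ⊛ Y S u j
    expand : coeff (∑ N (λ t → term (+ t)) ⊕ ∑ N (λ t → term -[1+ t ])) n ≈ Σᶻ N λ u → ωIn S x u * coeff (Y S u j) n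
    expand = C.+-cong
      (C.trans (coeff-∑ N _ n) (C.∑-cong N λ t _ → coeff-const-⊛ _ (Y S (+ t) j) n))
      (C.trans (coeff-∑ N _ n) (C.∑-cong N λ t _ → coeff-const-⊛ _ (Y S -[1+ t ] j) n))
    Σᶻ-0 : Σᶻ N (λ u → ωIn S x u * 0#) ≈ 0#
    Σᶻ-0 = C.trans (C.+-cong (C.∑-zero N λ t _ → C.zeroʳ _) (C.∑-zero N λ t _ → C.zeroʳ _)) (C.+-identityˡ 0#)
    δᶻ-≢0 : ∀ n → n ≢ 0ℤ → coeff (δᶻ x j) n ≈ 0#
    δᶻ-≢0 n n≢0 with does (x ℤ.≟ j)
    ... | true  = coeff-monomial-≢ 1# n≢0
    ... | false = coeff-0ᴸ n
    compare : ∀ n → coeff (Y S x j) (n ℤ.- 1ℤ) ≈ coeff (δᶻ x j) n + Σᶻ N λ u → ωIn S x u * coeff (Y S u j) n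
    compare (+ zero)  = C.sym (C.trans (C.+-cong δᶻ-0 Σᶻ-0) (C.+-identityʳ _))
      where
      δᶻ-0 : coeff (δᶻ x j) 0ℤ ≈ (if does (x ℤ.≟ j) then 1# else 0#)
      δᶻ-0 with does (x ℤ.≟ j)
      ... | true  = C.refl
      ... | false = C.refl
    compare (+ suc k) = C.sym (C.trans (C.+-cong (δᶻ-≢0 (+ suc k) λ ()) Σᶻ-0) (C.+-identityʳ _))
    compare -[1+ k ]  = C.trans
      (C.reflexive (≡.cong (λ m → walk S (suc m) x j) (ℕ.+-identityʳ k)))
      (C.trans (walk-suc S k N x j fits) (C.sym (C.trans (C.+-congʳ (δᶻ-≢0 -[1+ k ] λ ())) (C.+-identityˡ _))))

  fits⁺ : ∀ i N → i ℕ.+ w < N → Fits N (+ i)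
  fits⁺ i N i<N =
      ℤ.≤-trans (ℤ.neg-mono-≤ (ℤ.+≤+ (ℕ.≤-trans (ℕ.m≤m+n p q) (ℕ.≤-trans (ℕ.m≤n+m w i) (ℕ.<⇒≤ i<N)))))
                (ℤ.i≤j+i (ℤ.- + p) (+ i))
    , ℤ.+≤+ (ℕ.≤-trans (ℕ.+-monoʳ-≤ i (s≤s (ℕ.m≤n+m q p′))) (ℕ.<⇒≤ i<N))

  fits⁻ : ∀ t N → t ℕ.+ w < N → Fits N -[1+ t ]
  fits⁻ t N t<N =
      ℤ.neg-mono-≤ (ℤ.+≤+ (ℕ.≤-trans (s≤s (≡.subst (_≤ t ℕ.+ w) (ℕ.+-suc t p′) (ℕ.+-monoʳ-≤ t (ℕ.m≤m+n p q)))) t<N))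
    , ℤ.≤-trans (ℤ.+-monoˡ-≤ (+ suc q) (ℤ.-≤+ {t} {0}))
                (ℤ.+≤+ (ℕ.≤-trans (s≤s (ℕ.m≤n+m q p′)) (ℕ.≤-trans (ℕ.m≤n+m w t) (ℕ.<⇒≤ t<N))))

  -- Step weights and the entries of K

  ω-down-none : ∀ i v → p ≤ v ℕ.+ i → ω (+ i) -[1+ v ] ≡ 0#
  ω-down-none i v p≤ = ω-none (+ i) -[1+ v ] (inj₁ (ℤ.<-≤-trans (i<1+i -[1+ v ])
    (≡.subst (ℤ._≤ + i ℤ.- + p) (arith (+ v) (+ i)) (ℤ.+-monoʳ-≤ (+ i) (ℤ.neg-mono-≤ (ℤ.+≤+ p≤))))))
    where
    arith : ∀ v i → i ℤ.- (v ℤ.+ i) ≡ 1ℤ ℤ.+ ℤ.- (1ℤ ℤ.+ v)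
    arith = solve-∀

  ω-up-none : ∀ u j → q ≤ u ℕ.+ j → ω -[1+ u ] (+ j) ≡ 0#
  ω-up-none u j q≤ = ω-none -[1+ u ] (+ j) (inj₂ (ℤ.≤-<-trans (ℤ.+-monoʳ-≤ -[1+ u ] (ℤ.+≤+ q≤))
    (≡.subst (-[1+ u ] ℤ.+ + (u ℕ.+ j) ℤ.<_) (arith (+ u) (+ j)) (i<1+i _))))
    where
    arith : ∀ u j → 1ℤ ℤ.+ (ℤ.- (1ℤ ℤ.+ u) ℤ.+ (u ℤ.+ j)) ≡ j
    arith = solve-∀

  -- With l = v + 1 this is the first coefficient in a term of `correction`: it weighs the step from
  -- height i down to -l. In the same way `ω-up` identifies the second coefficient with a step from
  -- -m up to j.
  ω-down : ∀ i v → v < p ℕ.∸ i → ω (+ i) -[1+ v ] ≡ a (ℤ.- + (suc v ℕ.+ i)) (ℤ.- + suc v)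
  ω-down i v v<p∸i = ≡.trans (ω-step (+ i) -[1+ v ] (≡.subst InRange (≡.sym k≡) range))
    (≡.trans (≡.cong (stepWeight (+ i)) k≡) (≡.cong (a -[1+ v ℕ.+ i ]) (arith′ (+ v) (+ i))))
    where
    k≡ : -[1+ v ] ℤ.- + i ≡ -[1+ v ℕ.+ i ]
    k≡ = arith (+ v) (+ i)
      where
      arith : ∀ v i → ℤ.- (1ℤ ℤ.+ v) ℤ.- i ≡ ℤ.- (1ℤ ℤ.+ (v ℤ.+ i))
      arith = solve-∀
    arith′ : ∀ v i → i ℤ.- (1ℤ ℤ.+ (v ℤ.+ i)) ≡ ℤ.- (1ℤ ℤ.+ v)
    arith′ = solve-∀
    range : InRange -[1+ v ℕ.+ i ]
    range = ℤ.neg-mono-≤ (ℤ.+≤+ (m<n∸o⇒m+o<n v<p∸i)) , ℤ.-≤+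

  ω-up : ∀ u j → u < q ℕ.∸ j → ω -[1+ u ] (+ j) ≡ a (+ (suc u ℕ.+ j)) (ℤ.- + suc u)
  ω-up u j u<q∸j = ≡.trans (ω-step -[1+ u ] (+ j) (≡.subst InRange (≡.sym k≡) range))
    (≡.cong (stepWeight -[1+ u ]) k≡)
    where
    k≡ : + j ℤ.- -[1+ u ] ≡ + (suc u ℕ.+ j)
    k≡ = ≡.cong +_ (ℕ.+-comm j (suc u))
    range : InRange (+ (suc u ℕ.+ j))
    range = ℤ.-≤+ , ℤ.+≤+ (m<n∸o⇒m+o<n u<q∸j)

  -- The index `i ⊓ j` is the lower end of the step: a step up is weighted according to its initial
  -- height, a step down according to its final one.
  h≡ω : ∀ i j → h i j ≡ ω (+ i) (+ j)
  h≡ω i j = ≡.cong (λ v → if does (ℤ.- + p ℤ.≤? + j ℤ.- + i) ∧ does (+ j ℤ.- + i ℤ.≤? + q) then v else 0#)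
    (≡.sym (stepWeight≡ (+ j ℤ.- + i) ≡.refl))
    where
    stepWeight≡ : ∀ k → + j ℤ.- + i ≡ k → stepWeight (+ i) k ≡ a k (+ (i ℕ.⊓ j))
    stepWeight≡ (+ k) eq = ≡.cong (λ m → a (+ k) (+ m)) (≡.sym (ℕ.m≤n⇒m⊓n≡m (ℤ.drop‿+≤+ (ℤ.0≤i-j⇒j≤i
      (≡.subst (0ℤ ℤ.≤_) (≡.sym eq) (ℤ.+≤+ z≤n))))))
    stepWeight≡ -[1+ k ] eq = ≡.cong (a -[1+ k ]) (≡.trans
      (≡.trans (≡.cong (λ m → + i ℤ.+ m) (≡.sym eq)) (arith (+ i) (+ j)))
      (≡.cong +_ (≡.sym (ℕ.m≥n⇒m⊓n≡n (ℤ.drop‿+≤+ (ℤ.<⇒≤ (i-j<0⇒i<j {+ j} {+ i}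
        (≡.subst (ℤ._< 0ℤ) (≡.sym eq) ℤ.-<+))))))))
      where
      arith : ∀ i j → i ℤ.+ (j ℤ.- i) ≡ j
      arith = solve-∀

  h-up : ∀ k i → i ≤ q → h k (k ℕ.+ i) ≡ a (+ i) (+ k)
  h-up k i i≤q = ≡.trans (h≡ω k (k ℕ.+ i)) (≡.trans
    (ω-step (+ k) (+ (k ℕ.+ i)) (≡.subst InRange (≡.sym k≡) (ℤ.-≤+ , ℤ.+≤+ i≤q)))
    (≡.cong (stepWeight (+ k)) k≡))
    where
    k≡ : + (k ℕ.+ i) ℤ.- + k ≡ + i
    k≡ = arith (+ k) (+ i)
      where
      arith : ∀ k i → k ℤ.+ i ℤ.- k ≡ i
      arith = solve-∀

  h-down : ∀ k j → suc j ≤ p → h (k ℕ.+ suc j) k ≡ a (ℤ.- + suc j) (+ k)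
  h-down k j j<p = ≡.trans (h≡ω (k ℕ.+ suc j) k) (≡.trans
    (ω-step (+ (k ℕ.+ suc j)) (+ k) (≡.subst InRange (≡.sym k≡) (ℤ.neg-mono-≤ (ℤ.+≤+ j<p) , ℤ.-≤+)))
    (≡.trans (≡.cong (stepWeight (+ (k ℕ.+ suc j))) k≡) (≡.cong (a -[1+ j ]) (arith′ (+ k) (+ j)))))
    where
    k≡ : + k ℤ.- + (k ℕ.+ suc j) ≡ -[1+ j ]
    k≡ = arith (+ k) (+ j)
      where
      arith : ∀ k j → k ℤ.- (k ℤ.+ (1ℤ ℤ.+ j)) ≡ ℤ.- (1ℤ ℤ.+ j)
      arith = solve-∀
    arith′ : ∀ k j → k ℤ.+ (1ℤ ℤ.+ j) ℤ.- (1ℤ ℤ.+ j) ≡ k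
    arith′ = solve-∀

  V⁻ : ℕ → ℕ → Laurent
  V⁻ t u = Y negative -[1+ t ] -[1+ u ]

  V≋V⁻ : ∀ t u → V -[1+ t ] -[1+ u ] ≋ V⁻ t u
  V≋V⁻ t u (+ n)    = C.refl
  V≋V⁻ t u -[1+ n ] = totalWeight-𝒟̂ n t -[1+ u ]

  ∑-nested : ∀ m n (f : ℕ → ℕ → Laurent) →
             sumᴸ {m} (λ s → sumᴸ {n} λ t → f (toℕ s) (toℕ t)) ≋ ∑ m λ s → ∑ n (f s)
  ∑-nested m n f = begin
    sumᴸ {m} (λ s → sumᴸ {n} λ t → f (toℕ s) (toℕ t))
      ≈⟨ L.sum-cong {n = m} {f = λ s → sumᴸ {n} λ t → f (toℕ s) (toℕ t)} {g = λ s → ∑ n (f (toℕ s))}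
           (λ s → L.reflexive (≡.sym (∑≡sum n (f (toℕ s))))) ⟩
    sumᴸ {m} (λ s → ∑ n (f (toℕ s)))
      ≡⟨ ∑≡sum m (λ s → ∑ n (f s)) ⟨
    ∑ m (λ s → ∑ n (f s)) ∎

  zero-⊛ : ∀ {f} g → f ≋ 0ᴸ → f ⊛ g ≋ 0ᴸ
  zero-⊛ {f} g f≋0 = begin
    f ⊛ g   ≈⟨ L.*-cong {f} {0ᴸ} {g} {g} f≋0 (L.refl {g}) ⟩
    0ᴸ ⊛ g  ≈⟨ L.zeroˡ g ⟩
    0ᴸ      ∎

  ⊛-zero : ∀ f {g} → g ≋ 0ᴸ → f ⊛ g ≋ 0ᴸ
  ⊛-zero f {g} g≋0 = begin
    f ⊛ g   ≈⟨ L.*-cong {f} {f} {g} {0ᴸ} (L.refl {f}) g≋0 ⟩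
    f ⊛ 0ᴸ  ≈⟨ L.zeroʳ f ⟩
    0ᴸ      ∎

  -- Written with step weights, the terms outside v < p - i, u < q - j vanish of their own accord.
  -- Hence the ranges can be fixed to p and q for all i and j, which is the shape that `FirstExit`
  -- produces.
  correction-term : ℕ → ℕ → ℕ → ℕ → Laurent
  correction-term i j v u = const (ω (+ i) -[1+ v ]) ⊛ const (ω -[1+ u ] (+ j)) ⊛ V⁻ v u

  correction-term-v : ∀ i j v u → p ≤ v ℕ.+ i → correction-term i j v u ≋ 0ᴸ
  correction-term-v i j v u p≤ = zero-⊛ {x ⊛ y} (V⁻ v u) (const-0 y (ω-down-none i v p≤))
    where
    x = const (ω (+ i) -[1+ v ])
    y = const (ω -[1+ u ] (+ j))

  correction-term-u : ∀ i j v u → q ≤ u ℕ.+ j → correction-term i j v u ≋ 0ᴸ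
  correction-term-u i j v u q≤ = zero-⊛ {x ⊛ y} (V⁻ v u)
    (⊛-zero x {y} (const≋0 (ω-up-none u j q≤)))
    where
    x = const (ω (+ i) -[1+ v ])
    y = const (ω -[1+ u ] (+ j))

  correction≋ : ∀ i j → correction i j ≋ ∑ p λ v → ∑ q λ u → correction-term i j v u
  correction≋ i j = begin
    correction i j
      ≈⟨ ∑-nested (p ℕ.∸ i) (q ℕ.∸ j) term ⟩
    ∑ (p ℕ.∸ i) (λ v → ∑ (q ℕ.∸ j) (term v))
      ≈⟨ ∑-cong (p ℕ.∸ i) (λ v v< → ∑-cong (q ℕ.∸ j) λ u u< → term≋ v u v< u<) ⟩
    ∑ (p ℕ.∸ i) (λ v → ∑ (q ℕ.∸ j) (correction-term i j v))
      ≈⟨ ∑-cong (p ℕ.∸ i) (λ v _ → ∑-extend (ℕ.m∸n≤m q j) λ u q∸j≤u →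
           correction-term-u i j v u (fill q j u q∸j≤u)) ⟨
    ∑ (p ℕ.∸ i) (λ v → ∑ q (correction-term i j v))
      ≈⟨ ∑-extend (ℕ.m∸n≤m p i) (λ v p∸i≤v → ∑-zero q λ u _ →
           correction-term-v i j v u (fill p i v p∸i≤v)) ⟨
    ∑ p (λ v → ∑ q (correction-term i j v)) ∎
    where
    term : ℕ → ℕ → Laurent
    term v u = const (a (ℤ.- + (suc v ℕ.+ i)) (ℤ.- + suc v) * a (+ (suc u ℕ.+ j)) (ℤ.- + suc u))
               ⊛ V (ℤ.- + suc v) (ℤ.- + suc u)
    term≋ : ∀ v u → v < p ℕ.∸ i → u < q ℕ.∸ j → term v u ≋ correction-term i j v u
    term≋ v u v< u< = L.*-cong {x = const (x′ * y′)} {y = const x ⊛ const y} {u = V -[1+ v ] -[1+ u ]} {v = V⁻ v u}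
      (begin
        const (x′ * y′)   ≈⟨ const-cong (C.*-cong (C.reflexive (ω-down i v v<)) (C.reflexive (ω-up u j u<))) ⟨
        const (x * y)     ≈⟨ const-* x y ⟩
        const x ⊛ const y ∎)
      (V≋V⁻ v u)
      where
      x x′ y y′ : C
      x  = ω (+ i) -[1+ v ]
      x′ = a (ℤ.- + (suc v ℕ.+ i)) (ℤ.- + suc v)
      y  = ω -[1+ u ] (+ j)
      y′ = a (+ (suc u ℕ.+ j)) (ℤ.- + suc u)
    fill : ∀ m n o → m ℕ.∸ n ≤ o → m ≤ o ℕ.+ n
    fill m n o le = ≡.subst (m ≤_) (ℕ.+-comm n o) (ℕ.≤-trans (ℕ.m≤n+m∸n m n) (ℕ.+-monoʳ-≤ n le))

  -- Negative heights remain allowed: a path may jump across the forbidden heights 0, ..., r - 1 and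
  -- back, which accounts for the corrections in K_r.
  above : ℕ → ℤ → Bool
  above r (+ n)    = does (r ℕ.≤? n)
  above r -[1+ _ ] = true

  ωIn-above : ∀ r x s → r ≤ s → ωIn (above r) x (+ s) ≡ ω x (+ s)
  ωIn-above r x s r≤s = ≡.cong (λ b → if b then ω x (+ s) else 0#) (dec-true (r ℕ.≤? s) r≤s)

  ωIn-below : ∀ r x s → s < r → ωIn (above r) x (+ s) ≡ 0#
  ωIn-below r x s s<r = ≡.cong (λ b → if b then ω x (+ s) else 0#) (dec-false (r ℕ.≤? s) (ℕ.<⇒≱ s<r))

  ωIn-up-none : ∀ S u j → q ≤ u ℕ.+ j → ωIn S -[1+ u ] (+ j) ≡ 0#
  ωIn-up-none S u j q≤ with S (+ j)
  ... | true  = ω-up-none u j q≤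
  ... | false = ≡.refl

  D : ℕ → ℕ → Laurent
  D t v = const (ω -[1+ t ] -[1+ v ])

  D-small : Small D
  D-small t v = const-small _

  V⁻-bounded : BoundedMatrix V⁻
  V⁻-bounded u = -1ℤ , λ t → Y-degree negative -[1+ t ] -[1+ u ]

  -- For paths confined to negative heights, steps to heights ≥ 0 get weight 0, so only the sum with
  -- matrix `D` survives in `Y-step`.
  V⁻-inverse : RightInverse w D V⁻
  V⁻-inverse u t N t<N = begin
    z ⊛ V⁻ t u
      ≈⟨ Y-step negative N -[1+ t ] -[1+ u ] (fits⁻ t N t<N) ⟩
    δ t u ⊕ (∑ N (λ s → const 0# ⊛ Y negative (+ s) -[1+ u ]) ⊕ S₂)
      ≈⟨ L.+-cong {δ t u} {δ t u} {S₁ ⊕ S₂} {S₂} (L.refl {δ t u}) (begin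
           S₁ ⊕ S₂ ≈⟨ L.+-cong {S₁} {0ᴸ} {S₂} {S₂}
                        (∑-zero N λ s _ → const-0 (Y negative (+ s) -[1+ u ]) ≡.refl) (L.refl {S₂}) ⟩
           0ᴸ ⊕ S₂ ≈⟨ L.+-identityˡ S₂ ⟩
           S₂      ∎) ⟩
    δ t u ⊕ S₂ ∎
    where
    S₁ S₂ : Laurent
    S₁ = ∑ N λ s → const 0# ⊛ Y negative (+ s) -[1+ u ]
    S₂ = ∑ N λ v → D t v ⊛ V⁻ v u

  K-formula : ∀ i j → K i j ≋ const (ω (+ i) (+ j)) ⊕ ∑ p λ v → ∑ q λ u → correction-term i j v u
  K-formula i j n = C.+-cong (const-cong (C.reflexive (h≡ω i j)) n) (correction≋ i j n)

  K-lower : ∀ i j → j ℕ.+ p < i → K i j ≋ 0ᴸ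
  K-lower i j j+p<i = begin
    K i j
      ≈⟨ K-formula i j ⟩
    x ⊕ y
      ≈⟨ L.+-cong {x} {0ᴸ} {y} {0ᴸ} (const≋0 (ω-none (+ i) (+ j) (inj₁ below)))
           (∑-zero p λ v _ → ∑-zero q λ u _ → correction-term-v i j v u
             (ℕ.≤-trans (ℕ.m≤n+m p j) (ℕ.≤-trans (ℕ.<⇒≤ j+p<i) (ℕ.m≤n+m i v)))) ⟩
    0ᴸ ⊕ 0ᴸ
      ≈⟨ L.+-identityˡ 0ᴸ ⟩
    0ᴸ ∎
    where
    x y : Laurent
    x = const (ω (+ i) (+ j))
    y = ∑ p λ v → ∑ q λ u → correction-term i j v u
    below : + j ℤ.< + i ℤ.- + p
    below = ≡.subst (ℤ._< + i ℤ.- + p) (arith (+ j) (+ p)) (ℤ.+-monoˡ-< (ℤ.- + p) (ℤ.+<+ j+p<i))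
      where
      arith : ∀ j p → j ℤ.+ p ℤ.- p ≡ j
      arith = solve-∀

  K-upper : ∀ i j → i ℕ.+ q < j → K i j ≋ 0ᴸ
  K-upper i j i+q<j = begin
    K i j
      ≈⟨ K-formula i j ⟩
    x ⊕ y
      ≈⟨ L.+-cong {x} {0ᴸ} {y} {0ᴸ} (const≋0 (ω-none (+ i) (+ j) (inj₂ (ℤ.+<+ i+q<j))))
           (∑-zero p λ v _ → ∑-zero q λ u _ → correction-term-u i j v u
             (ℕ.≤-trans (ℕ.m≤n+m q i) (ℕ.≤-trans (ℕ.<⇒≤ i+q<j) (ℕ.m≤n+m j u)))) ⟩
    0ᴸ ⊕ 0ᴸ
      ≈⟨ L.+-identityˡ 0ᴸ ⟩
    0ᴸ ∎
    where
    x y : Laurent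
    x = const (ω (+ i) (+ j))
    y = ∑ p λ v → ∑ q λ u → correction-term i j v u

  K-small : Small K
  K-small i j n 0<n = C.trans (K-formula i j n) (C.trans
    (C.+-cong (const-small (ω (+ i) (+ j)) n 0<n)
      (∑-degree p {λ v → ∑ q (correction-term i j v)} (λ v → ∑-degree q {correction-term i j v} (term-small v)) n 0<n))
    (L.+-identityˡ 0ᴸ n))
    where
    term-small : ∀ v u → correction-term i j v u ≋[ 0ℤ ] 0ᴸ
    term-small v u n 0<n = C.trans (vanish (correction-term i j v u) n (ℤ.≤-<-trans ℤ.-≤+ 0<n)) (C.sym (coeff-0ᴸ n))

  -- The matrices K_r and their resolvents

  A : ℕ → ℕ → ℕ → Laurent
  A r i j = K (r ℕ.+ i) (r ℕ.+ j)

  A-small : ∀ r → Small (A r)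
  A-small r i j = K-small (r ℕ.+ i) (r ℕ.+ j)

  A-lower : ∀ r i j → j ℕ.+ p < i → A r i j ≋ 0ᴸ
  A-lower r i j j+p<i = K-lower (r ℕ.+ i) (r ℕ.+ j)
    (≡.subst (_< r ℕ.+ i) (≡.sym (ℕ.+-assoc r j p)) (ℕ.+-monoʳ-< r j+p<i))

  A-upper : ∀ r i j → i ℕ.+ q < j → A r i j ≋ 0ᴸ
  A-upper r i j i+q<j = K-upper (r ℕ.+ i) (r ℕ.+ j)
    (≡.subst (_< r ℕ.+ j) (≡.sym (ℕ.+-assoc r i q)) (ℕ.+-monoʳ-< r i+q<j))

  -- (z I - K_r)⁻¹ counts the paths that do not visit the heights 0, …, r - 1.
  resolvent : ℕ → ℕ → ℕ → Laurent
  resolvent r i j = Y (above r) (+ (r ℕ.+ i)) (+ (r ℕ.+ j))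

  resolvent-bounded : ∀ r → BoundedMatrix (resolvent r)
  resolvent-bounded r j = -1ℤ , λ i → Y-degree (above r) (+ (r ℕ.+ i)) (+ (r ℕ.+ j))

  δ-+ : ∀ r i j → δ (r ℕ.+ i) (r ℕ.+ j) ≡ δ i j
  δ-+ zero    i j = ≡.refl
  δ-+ (suc r) i j = δ-+ r i j

  -- Forbidding heights restricts the target of a step, hence only columns: eliminating the negative
  -- heights yields `K` with its first `r` columns replaced by 0. The first `r` rows are then
  -- dropped by `eliminate-from`.
  resolvent-inverse : ∀ r → RightInverse w (A r) (resolvent r)
  resolvent-inverse r j i N i<N = begin
    z ⊛ resolvent r i j
      ≈⟨ eliminate-from r K′-below i N i<N ⟩
    δ (r ℕ.+ i) (r ℕ.+ j) ⊕ ∑ N (λ l → K′ (r ℕ.+ i) (r ℕ.+ l) ⊛ resolvent r l j)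
      ≈⟨ L.+-cong {δ (r ℕ.+ i) (r ℕ.+ j)} {δ i j} {S₁} {S₂}
           (L.reflexive (δ-+ r i j))
           (∑-cong N λ l _ → L.*-cong {K′ (r ℕ.+ i) (r ℕ.+ l)} {A r i l} {resolvent r l j} {resolvent r l j}
             (K′-above (r ℕ.+ i) (r ℕ.+ l) (ℕ.m≤m+n r l)) (L.refl {resolvent r l j})) ⟩
    δ i j ⊕ ∑ N (λ l → A r i l ⊛ resolvent r l j) ∎
    where
    J : ℤ
    J = + (r ℕ.+ j)
    E U H : ℕ → ℕ → Laurent
    E t s = const (ωIn (above r) -[1+ t ] (+ s))
    U i v = const (ω (+ i) -[1+ v ])
    H i s = const (ωIn (above r) (+ i) (+ s))
    B X : ℕ → Laurent
    B s = Y (above r) (+ s) J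
    X t = Y (above r) -[1+ t ] J

    X-step : ∀ t N → t ℕ.+ w < N → z ⊛ X t ≋ ∑ N (λ s → E t s ⊛ B s) ⊕ ∑ N (λ v → D t v ⊛ X v)
    X-step t N t<N = begin
      z ⊛ X t    ≈⟨ Y-step (above r) N -[1+ t ] J (fits⁻ t N t<N) ⟩
      0ᴸ ⊕ sums  ≈⟨ L.+-identityˡ sums ⟩
      sums       ∎
      where
      sums : Laurent
      sums = ∑ N (λ s → E t s ⊛ B s) ⊕ ∑ N (λ v → D t v ⊛ X v)

    open FirstExit w p q (ℕ.m≤m+n p q) (ℕ.m≤n+m q p) {D} {V⁻} {E} {U} {H} {λ i → δ i (r ℕ.+ j)} {B} {X}
      D-small V⁻-inverse V⁻-bounded
      (λ t s q≤ → const≋0 (ωIn-up-none (above r) t s q≤))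
      (λ i v p≤v → const≋0 (ω-down-none i v (ℕ.≤-trans p≤v (ℕ.m≤m+n v i))))
      (-1ℤ , λ t → Y-degree (above r) -[1+ t ] J)
      X-step
      (λ i N i<N → Y-step (above r) N (+ i) J (fits⁺ i N i<N))
      using (eliminate-from) renaming (K to K′)

    S₁ S₂ : Laurent
    S₁ = ∑ N λ l → K′ (r ℕ.+ i) (r ℕ.+ l) ⊛ resolvent r l j
    S₂ = ∑ N λ l → A r i l ⊛ resolvent r l j

    K′-term : ℕ → ℕ → ℕ → ℕ → Laurent
    K′-term i s v u = U i v ⊛ E u s ⊛ V⁻ v u

    K′-below : ∀ i s → s < r → K′ i s ≋ 0ᴸ
    K′-below i s s<r = begin
      H i s ⊕ ∑ p (λ v → ∑ q (K′-term i s v))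
        ≈⟨ L.+-cong {H i s} {0ᴸ} {∑ p λ v → ∑ q (K′-term i s v)} {0ᴸ} (const≋0 (ωIn-below r (+ i) s s<r))
             (∑-zero p λ v _ → ∑-zero q λ u _ → zero-⊛ {U i v ⊛ E u s} (V⁻ v u)
               (⊛-zero (U i v) {E u s} (const≋0 (ωIn-below r -[1+ u ] s s<r)))) ⟩
      0ᴸ ⊕ 0ᴸ
        ≈⟨ L.+-identityˡ 0ᴸ ⟩
      0ᴸ ∎

    K′-above : ∀ i s → r ≤ s → K′ i s ≋ K i s
    K′-above i s r≤s = begin
      H i s ⊕ ∑ p (λ v → ∑ q (K′-term i s v))
        ≈⟨ L.+-cong {H i s} {x} {∑ p λ v → ∑ q (K′-term i s v)} {∑ p λ v → ∑ q (correction-term i s v)}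
             (const-cong (C.reflexive (ωIn-above r (+ i) s r≤s)))
             (∑-cong p λ v _ → ∑-cong q λ u _ → L.reflexive
               (≡.cong (λ y → U i v ⊛ const y ⊛ V⁻ v u) (ωIn-above r -[1+ u ] s r≤s))) ⟩
      x ⊕ ∑ p (λ v → ∑ q (correction-term i s v))
        ≈⟨ K-formula i s ⟨
      K i s ∎
      where
      x : Laurent
      x = const (ω (+ i) (+ s))

  -- Inverses of z I - K_r in the ring of infinite matrices

  walk-none : ∀ S n x j → j ℤ.+ + (n ℕ.* p) ℤ.< x → walk S n x j ≈ 0#
  walk-none S zero    x j j<x with x ℤ.≟ j
  ... | yes x≡j = contradiction (≡.trans (ℤ.+-identityʳ j) (≡.sym x≡j)) (ℤ.<⇒≢ j<x)
  ... | no _    = C.refl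
  walk-none S (suc n) x j j<x = C.trans
    (C.reflexive (≡.sym (C.∑≡sum (suc (p ℕ.+ q)) λ s → ωIn S x (y s) * walk S n (y s) j)))
    (C.∑-zero (suc (p ℕ.+ q)) λ s _ → C.trans
      (C.*-congˡ (walk-none S n (y s) j (ℤ.<-≤-trans
        (≡.subst (ℤ._< x ℤ.- + p) (arith j (+ p) (+ (n ℕ.* p))) (ℤ.+-monoˡ-< (ℤ.- + p) j<x))
        (ℤ.+-monoʳ-≤ x (ℤ.i≤j+i (ℤ.- + p) (+ s))))))
      (C.zeroʳ _))
    where
    y : ℕ → ℤ
    y s = x ℤ.+ (+ s ℤ.- + p)
    arith : ∀ j p m → j ℤ.+ (p ℤ.+ m) ℤ.- p ≡ j ℤ.+ m
    arith = solve-∀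

  zI-K-lower : ∀ r i j → j ℕ.+ w < i → zI-K r i j ≋ 0ᴸ
  zI-K-lower r i j j<i = begin
    z ⊛ I∞ i j ⊝ A r i j
      ≈⟨ L.+-cong {z ⊛ I∞ i j} {0ᴸ} {⊝ A r i j} {⊝ 0ᴸ}
           (⊛-zero z {I∞ i j} (L.δ-off {i} {j} λ i≡j → ℕ.<⇒≢ (ℕ.≤-<-trans (ℕ.m≤m+n j w) j<i) (≡.sym i≡j)))
           (L.-‿cong {A r i j} {0ᴸ} (A-lower r i j (ℕ.≤-<-trans (ℕ.+-monoʳ-≤ j (ℕ.m≤m+n p q)) j<i))) ⟩
    0ᴸ ⊝ 0ᴸ
      ≈⟨ L.-‿inverseʳ 0ᴸ ⟩
    0ᴸ ∎

  zI-K-upper : ∀ r i j → i ℕ.+ w < j → zI-K r i j ≋ 0ᴸ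
  zI-K-upper r i j i<j = begin
    z ⊛ I∞ i j ⊝ A r i j
      ≈⟨ L.+-cong {z ⊛ I∞ i j} {0ᴸ} {⊝ A r i j} {⊝ 0ᴸ}
           (⊛-zero z {I∞ i j} (L.δ-off {i} {j} (ℕ.<⇒≢ (ℕ.≤-<-trans (ℕ.m≤m+n i w) i<j))))
           (L.-‿cong {A r i j} {0ᴸ} (A-upper r i j (ℕ.≤-<-trans (ℕ.+-monoʳ-≤ i (ℕ.m≤n+m q p)) i<j))) ⟩
    0ᴸ ⊝ 0ᴸ
      ≈⟨ L.-‿inverseʳ 0ᴸ ⟩
    0ᴸ ∎

  -- The band makes the partial sums stationary: row `i` of z I - K_r has no entry to the right of
  -- column `i + w`, and column `j` none below row `j + w`.
  resolvent-isInverse : ∀ r → IsInverse (zI-K r) (resolvent r)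
  resolvent-isInverse r = record
    { f∈ring = record
      { d = 1ℤ
      ; degree≤d = λ i j n 1<n → C.trans
          (C.+-cong
            (⊛-degree {1ℤ} {0ℤ} {z} {I∞ i j} (vanish z) (≋[]⇒Degree≤ {I∞ i j} (δ-degree i j)) n 1<n)
            (C.-‿cong (≋[]⇒Degree≤ {A r i j} (A-small r i j) n (ℤ.≤-<-trans (ℤ.+≤+ z≤n) 1<n))))
          (C.-‿inverseʳ 0#)
      ; columnFinite = λ n _ j → suc (j ℕ.+ w) , λ i j<i → C.trans (zI-K-lower r i j j<i n) (coeff-0ᴸ n)
      }
    ; g∈ring = record
      { d = -1ℤ
      ; degree≤d = λ i j → vanish (resolvent r i j)
      ; columnFinite = columnFinite
      }
    ; inverseʳ = λ i j n → suc (i ℕ.+ w) , λ N i<N → productʳ i j N i<N n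
    ; inverseˡ = λ i j n → suc (j ℕ.+ w) , λ N j<N → productˡ i j N j<N n
    }
    where
    columnFinite : ∀ n → n ℤ.≤ -1ℤ → ∀ j → ∃ λ ℓ → ∀ i → ℓ ≤ i → coeff (resolvent r i j) n ≈ 0#
    -- The coefficient counts paths of length n, which descend by at most n p in total and so cannot
    -- reach r + j from a height above r + j + n p.
    columnFinite -[1+ n ] _ j = suc (j ℕ.+ n ℕ.* p) , λ i j<i →
      walk-none (above r) n (+ (r ℕ.+ i)) (+ (r ℕ.+ j))
        (ℤ.+<+ (≡.subst (_< r ℕ.+ i) (≡.sym (ℕ.+-assoc r j (n ℕ.* p))) (ℕ.+-monoʳ-< r j<i)))

    productʳ : ∀ i j N → i ℕ.+ w < N → sumᴸ {N} (λ l → zI-K r i (toℕ l) ⊛ resolvent r (toℕ l) j) ≋ I∞ i j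
    productʳ i j N i<N = begin
      sumᴸ {N} (λ l → zI-K r i (toℕ l) ⊛ resolvent r (toℕ l) j)
        ≡⟨ ∑≡sum N (λ l → zI-K r i l ⊛ resolvent r l j) ⟨
      ∑ N (λ l → zI-K r i l ⊛ resolvent r l j)
        ≈⟨ row-product (A r) (resolvent r) i j N (ℕ.≤-<-trans (ℕ.m≤m+n i w) i<N) ⟩
      z ⊛ resolvent r i j ⊝ ∑ N (λ l → A r i l ⊛ resolvent r l j)
        ≈⟨ difference⁻¹ {z ⊛ resolvent r i j} {∑ N λ l → A r i l ⊛ resolvent r l j} {δ i j}
             (resolvent-inverse r j i N i<N) ⟩
      I∞ i j ∎

    productˡ : ∀ i j N → j ℕ.+ w < N → sumᴸ {N} (λ l → resolvent r i (toℕ l) ⊛ zI-K r (toℕ l) j) ≋ I∞ i j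
    productˡ i j N j<N = begin
      sumᴸ {N} (λ l → resolvent r i (toℕ l) ⊛ zI-K r (toℕ l) j)
        ≡⟨ ∑≡sum N (λ l → resolvent r i l ⊛ zI-K r l j) ⟨
      ∑ N (λ l → resolvent r i l ⊛ zI-K r l j)
        ≈⟨ column-product (A r) (resolvent r) i j N (ℕ.≤-<-trans (ℕ.m≤m+n j w) j<N) ⟩
      z ⊛ resolvent r i j ⊝ ∑ N (λ l → resolvent r i l ⊛ A r l j)
        ≈⟨ difference⁻¹ {z ⊛ resolvent r i j} {∑ N λ l → resolvent r i l ⊛ A r l j} {δ i j}
             (leftInverse w {A r} {resolvent r} (A-small r)
               (λ i j i<j → A-upper r i j (ℕ.≤-<-trans (ℕ.+-monoʳ-≤ i (ℕ.m≤n+m q p)) i<j))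
               (λ i j j<i → A-lower r i j (ℕ.≤-<-trans (ℕ.+-monoʳ-≤ j (ℕ.m≤m+n p q)) j<i))
               (resolvent-inverse r) (resolvent-bounded r) i j N j<N) ⟩
      I∞ i j ∎

  isInverse⇒bounded : ∀ r ζ → IsInverse (zI-K r) ζ → BoundedMatrix ζ
  isInverse⇒bounded r ζ inverse j = d , λ i → Degree≤⇒≋[] {ζ i j} (degree≤d i j)
    where open InRing (IsInverse.g∈ring inverse)

  -- `HasSum` gives, for each coefficient, the value only from an unknown stage `M` on. Beyond `N`
  -- the terms vanish by the band, so the partial sum at `N` equals the one at `M ⊔ N`.
  isInverse⇒rightInverse : ∀ r ζ → IsInverse (zI-K r) ζ → RightInverse w (A r) ζ
  isInverse⇒rightInverse r ζ inverse j i N i<N =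
    difference {z ⊛ ζ i j} {∑ N λ l → A r i l ⊛ ζ l j} {δ i j} (begin
      z ⊛ ζ i j ⊝ ∑ N (λ l → A r i l ⊛ ζ l j)
        ≈⟨ row-product (A r) ζ i j N (ℕ.≤-<-trans (ℕ.m≤m+n i w) i<N) ⟨
      ∑ N (λ l → zI-K r i l ⊛ ζ l j)
        ≈⟨ partial-sum ⟩
      I∞ i j ∎)
    where
    partial-sum : ∑ N (λ l → zI-K r i l ⊛ ζ l j) ≋ I∞ i j
    partial-sum n with IsInverse.inverseʳ inverse i j n
    ... | M , stable = C.trans
      (C.sym (∑-extend {N} {M ℕ.⊔ N} (ℕ.m≤n⊔m M N)
        (λ l N≤l → zero-⊛ {zI-K r i l} (ζ l j) (zI-K-upper r i l (ℕ.<-≤-trans i<N N≤l))) n))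
      (C.trans (C.reflexive (≡.cong (λ f → coeff f n) (∑≡sum (M ℕ.⊔ N) λ l → zI-K r i l ⊛ ζ l j)))
        (stable (M ℕ.⊔ N) (ℕ.m≤m⊔n M N)))

  -- The matrices β and the pseudo-quotient

  sumᴸ-≋0 : ∀ {n} {f : Fin n → Laurent} → (∀ l → f l ≋ 0ᴸ) → sumᴸ f ≋ 0ᴸ
  sumᴸ-≋0 {zero}      f≋0 = L.refl {0ᴸ}
  sumᴸ-≋0 {suc n} {f} f≋0 = begin
    f zero ⊕ sumᴸ {n} (f ∘ suc)
      ≈⟨ L.+-cong {f zero} {0ᴸ} {sumᴸ {n} (f ∘ suc)} {0ᴸ} (f≋0 zero) (sumᴸ-≋0 {n} {f ∘ suc} (f≋0 ∘ suc)) ⟩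
    0ᴸ ⊕ 0ᴸ
      ≈⟨ L.+-identityˡ 0ᴸ ⟩
    0ᴸ ∎

  δᶠ : ∀ {n} → Fin n → Fin n → Laurent
  δᶠ i j = if does (i Fin.≟ j) then 1ᴸ else 0ᴸ

  sumᴸ-δᶠ : ∀ {n} (i : Fin n) (f : Fin n → Laurent) → sumᴸ (λ l → δᶠ i l ⊛ f l) ≋ f i
  sumᴸ-δᶠ {suc n} zero    f = begin
    1ᴸ ⊛ f zero ⊕ rest
      ≈⟨ L.+-cong {1ᴸ ⊛ f zero} {f zero} {rest} {0ᴸ} (L.*-identityˡ (f zero))
           (sumᴸ-≋0 {n} {λ l → 0ᴸ ⊛ f (suc l)} λ l → L.zeroˡ (f (suc l))) ⟩
    f zero ⊕ 0ᴸ
      ≈⟨ L.+-identityʳ (f zero) ⟩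
    f zero ∎
    where
    rest : Laurent
    rest = sumᴸ {n} λ l → 0ᴸ ⊛ f (suc l)
  sumᴸ-δᶠ {suc n} (suc i) f = begin
    0ᴸ ⊛ f zero ⊕ rest
      ≈⟨ L.+-cong {0ᴸ ⊛ f zero} {0ᴸ} {rest} {f (suc i)} (L.zeroˡ (f zero)) (sumᴸ-δᶠ i (f ∘ suc)) ⟩
    0ᴸ ⊕ f (suc i)
      ≈⟨ L.+-identityˡ (f (suc i)) ⟩
    f (suc i) ∎
    where
    rest : Laurent
    rest = sumᴸ {n} λ l → δᶠ i l ⊛ f (suc l)

  δᶠ-sym : ∀ {n} (i j : Fin n) → δᶠ i j ≡ δᶠ j i
  δᶠ-sym zero    zero    = ≡.refl
  δᶠ-sym zero    (suc j) = ≡.refl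
  δᶠ-sym (suc i) zero    = ≡.refl
  δᶠ-sym (suc i) (suc j) = δᶠ-sym i j

  sumᴸ-δᶠʳ : ∀ {n} (j : Fin n) (f : Fin n → Laurent) → sumᴸ (λ l → f l ⊛ δᶠ l j) ≋ f j
  sumᴸ-δᶠʳ {n} j f = begin
    sumᴸ {n} (λ l → f l ⊛ δᶠ l j)
      ≈⟨ L.sum-cong {n} {f = λ l → f l ⊛ δᶠ l j} {g = λ l → δᶠ j l ⊛ f l} (λ l → begin
           f l ⊛ δᶠ l j  ≈⟨ L.*-comm (f l) (δᶠ l j) ⟩
           δᶠ l j ⊛ f l  ≡⟨ ≡.cong (_⊛ f l) (δᶠ-sym l j) ⟩
           δᶠ j l ⊛ f l  ∎) ⟩
    sumᴸ {n} (λ l → δᶠ j l ⊛ f l)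
      ≈⟨ sumᴸ-δᶠ j f ⟩
    f j ∎

  last-≟ : ∀ n → does (fromℕ n Fin.≟ fromℕ n) ≡ true
  last-≟ n = dec-true (fromℕ n Fin.≟ fromℕ n) ≡.refl

  inject₁-≟ : ∀ {n} (i : Fin n) → does (inject₁ i Fin.≟ fromℕ n) ≡ false
  inject₁-≟ {n} i = dec-false (inject₁ i Fin.≟ fromℕ n) (Fin.fromℕ≢inject₁ ∘ ≡.sym)

  module _ (k : ℕ) where

    β⁺-inject₁ : ∀ i l → β⁺ k (inject₁ i) l ≡ δᶠ (inject₁ i) l
    β⁺-inject₁ i l rewrite inject₁-≟ i = ≡.refl

    β⁺-last : ∀ l → β⁺ k (fromℕ q′) l ≡ ⊝ d⁺ k (suc (toℕ l))
    β⁺-last l rewrite last-≟ q′ = ≡.refl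

    β⁻-inject₁ : ∀ l j → β⁻ k l (inject₁ j) ≡ δᶠ l (inject₁ j)
    β⁻-inject₁ l j rewrite inject₁-≟ j = ≡.refl

    β⁻-last : ∀ l → β⁻ k l (fromℕ p′) ≡ d⁻ k (suc (toℕ l))
    β⁻-last l rewrite last-≟ p′ = ≡.refl

    β-inject₁ˡ : ∀ i j → β k (inject₁ i) j ≡ 0ᴸ
    β-inject₁ˡ i j rewrite inject₁-≟ i = ≡.refl

    β-inject₁ʳ : ∀ i j → β k i (inject₁ j) ≡ 0ᴸ
    β-inject₁ʳ i j rewrite inject₁-≟ j | Bool.∧-zeroʳ (does (i Fin.≟ fromℕ q′)) = ≡.refl

    β-last : β k (fromℕ q′) (fromℕ p′) ≡ z ⊝ d⁺ k 0
    β-last rewrite last-≟ q′ | last-≟ p′ = ≡.refl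

    β⁺⊛-inject₁ : ∀ (X : Matrix q p) i j → (β⁺ k ⊛ᴹ X) (inject₁ i) j ≋ X (inject₁ i) j
    β⁺⊛-inject₁ X i j = begin
      sumᴸ (λ l → β⁺ k (inject₁ i) l ⊛ X l j)
        ≈⟨ L.sum-cong {q} {f = λ l → β⁺ k (inject₁ i) l ⊛ X l j} {g = λ l → δᶠ (inject₁ i) l ⊛ X l j}
             (λ l → L.reflexive (≡.cong (_⊛ X l j) (β⁺-inject₁ i l))) ⟩
      sumᴸ (λ l → δᶠ (inject₁ i) l ⊛ X l j)
        ≈⟨ sumᴸ-δᶠ (inject₁ i) (λ l → X l j) ⟩
      X (inject₁ i) j ∎

    ⊛β⁻-inject₁ : ∀ (X : Matrix q p) i j → (X ⊛ᴹ β⁻ k) i (inject₁ j) ≋ X i (inject₁ j)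
    ⊛β⁻-inject₁ X i j = begin
      sumᴸ (λ l → X i l ⊛ β⁻ k l (inject₁ j))
        ≈⟨ L.sum-cong {p} {f = λ l → X i l ⊛ β⁻ k l (inject₁ j)} {g = λ l → X i l ⊛ δᶠ l (inject₁ j)}
             (λ l → L.reflexive (≡.cong (X i l ⊛_) (β⁻-inject₁ l j))) ⟩
      sumᴸ (λ l → X i l ⊛ δᶠ l (inject₁ j))
        ≈⟨ sumᴸ-δᶠʳ (inject₁ j) (X i) ⟩
      X i (inject₁ j) ∎

    d⁺≋A : ∀ j → j ≤ q → d⁺ k j ≋ A k 0 j
    d⁺≋A j j≤q = begin
      const (a (+ j) (+ k)) ⊕ correction k (k ℕ.+ j)
        ≡⟨ ≡.cong (λ x → const x ⊕ correction k (k ℕ.+ j)) (h-up k j j≤q) ⟨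
      K k (k ℕ.+ j)
        ≡⟨ ≡.cong (λ i → K i (k ℕ.+ j)) (ℕ.+-identityʳ k) ⟨
      A k 0 j ∎

    d⁻≋A : ∀ j → j < p → d⁻ k (suc j) ≋ A k (suc j) 0
    d⁻≋A j j<p = begin
      const (a (ℤ.- + suc j) (+ k)) ⊕ correction (k ℕ.+ suc j) k
        ≡⟨ ≡.cong (λ x → const x ⊕ correction (k ℕ.+ suc j) k) (h-down k j j<p) ⟨
      K (k ℕ.+ suc j) k
        ≡⟨ ≡.cong (K (k ℕ.+ suc j)) (ℕ.+-identityʳ k) ⟨
      A k (suc j) 0 ∎

    -- Multiplying X = `block ζ′` by β⁺ and β⁻ changes only its last row, which becomes - `row`, and
    -- its last column, which becomes `column`; in the corner, `β` adds z - K_{k,k}, which completes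
    -- `pivot`. These are the Schur complement expressions for T of `block ζ`, as K_{k+1} is K_k
    -- without its first row and column.
    τ-step : ∀ {ζ ζ′} → BoundedMatrix ζ → RightInverse w (A k) ζ →
             BoundedMatrix ζ′ → RightInverse w (A (suc k)) ζ′ →
             (∃ λ n → coeff (ζ 0 0) n # 0#) → τ k (block ζ′) (block ζ)
    τ-step {ζ} {ζ′} ζ-bounded ζ-inverse ζ′-bounded ζ′-inverse ζ₀₀≠0 = record
      { a₀₀≠0     = ζ₀₀≠0
      ; a₀₀⁻¹     = pivot
      ; isInverse = pivot-inverse
      ; inner     = λ i j → begin
          β k (inject₁ i) (inject₁ j) ⊕ (B₁ ⊛ᴹ β⁻ k) (inject₁ i) (inject₁ j)
            ≈⟨ drop ((B₁ ⊛ᴹ β⁻ k) (inject₁ i) (inject₁ j)) (B₁ (inject₁ i) (inject₁ j))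
                 (β-inject₁ˡ i (inject₁ j)) (⊛β⁻-inject₁ B₁ (inject₁ i) j) ⟩
          B₁ (inject₁ i) (inject₁ j)
            ≈⟨ β⁺⊛-inject₁ X i (inject₁ j) ⟩
          X (inject₁ i) (inject₁ j)
            ≡⟨ ≡.cong₂ ζ′ (Fin.toℕ-inject₁ i) (Fin.toℕ-inject₁ j) ⟩
          ζ′ (toℕ i) (toℕ j)
            ≈⟨ complement (toℕ i) (toℕ j) ⟨
          (Z (suc i) (suc j) ⊛ Z zero zero ⊝ Z zero (suc j) ⊛ Z (suc i) zero) ⊛ pivot ∎
      ; lastRow   = λ j → begin
          β k (fromℕ q′) (inject₁ j) ⊕ (B₁ ⊛ᴹ β⁻ k) (fromℕ q′) (inject₁ j)
            ≈⟨ drop ((B₁ ⊛ᴹ β⁻ k) (fromℕ q′) (inject₁ j)) (B₁ (fromℕ q′) (inject₁ j))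
                 (β-inject₁ʳ (fromℕ q′) j) (⊛β⁻-inject₁ B₁ (fromℕ q′) j) ⟩
          B₁ (fromℕ q′) (inject₁ j)
            ≈⟨ B₁-last (inject₁ j) ⟩
          ⊝ row (toℕ (inject₁ j))
            ≡⟨ ≡.cong (λ j → ⊝ row j) (Fin.toℕ-inject₁ j) ⟩
          ⊝ row (toℕ j)
            ≈⟨ L.-‿cong {Z zero (suc j) ⊛ pivot} {row (toℕ j)} (row-pivot (toℕ j)) ⟨
          ⊝ (Z zero (suc j) ⊛ pivot) ∎
      ; lastCol   = λ i → begin
          β k (inject₁ i) (fromℕ p′) ⊕ (B₁ ⊛ᴹ β⁻ k) (inject₁ i) (fromℕ p′)
            ≈⟨ drop ((B₁ ⊛ᴹ β⁻ k) (inject₁ i) (fromℕ p′)) (column (toℕ i)) (β-inject₁ˡ i (fromℕ p′))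
                 (last-column B₁ (inject₁ i) (λ l → ζ′ (toℕ i) l) λ l → begin
                 B₁ (inject₁ i) l  ≈⟨ β⁺⊛-inject₁ X i l ⟩
                 X (inject₁ i) l   ≡⟨ ≡.cong (λ i → ζ′ i (toℕ l)) (Fin.toℕ-inject₁ i) ⟩
                 ζ′ (toℕ i) (toℕ l) ∎) ⟩
          column (toℕ i)
            ≈⟨ column-pivot (toℕ i) ⟨
          Z (suc i) zero ⊛ pivot ∎
      ; corner    = begin
          β k (fromℕ q′) (fromℕ p′) ⊕ (B₁ ⊛ᴹ β⁻ k) (fromℕ q′) (fromℕ p′)
            ≈⟨ L.+-cong {β k (fromℕ q′) (fromℕ p′)} {z ⊝ A k 0 0}
                        {(B₁ ⊛ᴹ β⁻ k) (fromℕ q′) (fromℕ p′)} {∑ p λ m → ⊝ row m ⊛ A k (suc m) 0}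
                 (begin
                   β k (fromℕ q′) (fromℕ p′)  ≡⟨ β-last ⟩
                   z ⊝ d⁺ k 0                 ≈⟨ L.+-cong {z} {z} {⊝ d⁺ k 0} {⊝ A k 0 0} (L.refl {z})
                                                   (L.-‿cong {d⁺ k 0} {A k 0 0} (d⁺≋A 0 z≤n)) ⟩
                   z ⊝ A k 0 0 ∎)
                 (last-column B₁ (fromℕ q′) (λ m → ⊝ row m) B₁-last) ⟩
          z ⊝ A k 0 0 ⊕ ∑ p (λ m → ⊝ row m ⊛ A k (suc m) 0)
            ≈⟨ corner ⟩
          pivot ∎
      }
      where
      X Z B₁ : Matrix q p
      X  = block ζ′
      Z  = block ζ
      B₁ = β⁺ k ⊛ᴹ X

      A-suc : ∀ i j → A (suc k) i j ≡ A k (suc i) (suc j)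
      A-suc i j = ≡.sym (≡.cong₂ K (ℕ.+-suc k i) (ℕ.+-suc k j))

      ζ′-inverse′ : RightInverse w (λ i j → A k (suc i) (suc j)) ζ′
      ζ′-inverse′ j i N i<N = begin
        z ⊛ ζ′ i j
          ≈⟨ ζ′-inverse j i N i<N ⟩
        δ i j ⊕ S₁
          ≈⟨ L.+-cong {δ i j} {δ i j} {S₁} {S₂} (L.refl {δ i j})
               (∑-cong N λ l _ → L.reflexive (≡.cong (_⊛ ζ′ l j) (A-suc i l))) ⟩
        δ i j ⊕ S₂ ∎
        where
        S₁ S₂ : Laurent
        S₁ = ∑ N λ l → A (suc k) i l ⊛ ζ′ l j
        S₂ = ∑ N λ l → A k (suc i) (suc l) ⊛ ζ′ l j

      open SchurComplement w p q (ℕ.m≤n+m q p) {A k} {ζ} {ζ′} (A-small k)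
        (λ i p≤i → A-lower k (suc i) 0 (s≤s p≤i))
        (λ j q≤j → A-upper k 0 (suc j) (s≤s q≤j))
        ζ-bounded ζ-inverse ζ′-bounded ζ′-inverse′

      drop : ∀ {b} x y → b ≡ 0ᴸ → x ≋ y → b ⊕ x ≋ y
      drop x y ≡.refl x≋y = begin
        0ᴸ ⊕ x  ≈⟨ L.+-identityˡ x ⟩
        x       ≈⟨ x≋y ⟩
        y       ∎

      last-column : ∀ (Y : Matrix q p) i (f : ℕ → Laurent) → (∀ l → Y i l ≋ f (toℕ l)) →
        (Y ⊛ᴹ β⁻ k) i (fromℕ p′) ≋ ∑ p λ m → f m ⊛ A k (suc m) 0
      last-column Y i f Y≋f = begin
        sumᴸ (λ l → Y i l ⊛ β⁻ k l (fromℕ p′))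
          ≈⟨ L.sum-cong {p} {f = λ l → Y i l ⊛ β⁻ k l (fromℕ p′)} {g = λ l → f (toℕ l) ⊛ A k (suc (toℕ l)) 0} (λ l →
               L.*-cong {Y i l} {f (toℕ l)} {β⁻ k l (fromℕ p′)} {A k (suc (toℕ l)) 0} (Y≋f l) (begin
                 β⁻ k l (fromℕ p′)    ≡⟨ β⁻-last l ⟩
                 d⁻ k (suc (toℕ l))   ≈⟨ d⁻≋A (toℕ l) (Fin.toℕ<n l) ⟩
                 A k (suc (toℕ l)) 0  ∎)) ⟩
        sumᴸ {p} (λ l → f (toℕ l) ⊛ A k (suc (toℕ l)) 0)
          ≡⟨ ∑≡sum p (λ m → f m ⊛ A k (suc m) 0) ⟨
        ∑ p (λ m → f m ⊛ A k (suc m) 0) ∎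

      B₁-last : ∀ j → B₁ (fromℕ q′) j ≋ ⊝ row (toℕ j)
      B₁-last j = begin
        sumᴸ (λ l → β⁺ k (fromℕ q′) l ⊛ X l j)
          ≈⟨ L.sum-cong {q} {f = λ l → β⁺ k (fromℕ q′) l ⊛ X l j} {g = λ l → ⊝ (A k 0 (suc (toℕ l)) ⊛ X l j)} (λ l → begin
               β⁺ k (fromℕ q′) l ⊛ X l j
                 ≈⟨ L.*-cong {β⁺ k (fromℕ q′) l} {⊝ A k 0 (suc (toℕ l))} {X l j} {X l j} (begin
                      β⁺ k (fromℕ q′) l        ≡⟨ β⁺-last l ⟩
                      ⊝ d⁺ k (suc (toℕ l))     ≈⟨ L.-‿cong {d⁺ k (suc (toℕ l))} {A k 0 (suc (toℕ l))}
                                                    (d⁺≋A (suc (toℕ l)) (Fin.toℕ<n l)) ⟩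
                      ⊝ A k 0 (suc (toℕ l))    ∎) (L.refl {X l j}) ⟩
               ⊝ A k 0 (suc (toℕ l)) ⊛ X l j
                 ≈⟨ -‿distribˡ-* (A k 0 (suc (toℕ l))) (X l j) ⟨
               ⊝ (A k 0 (suc (toℕ l)) ⊛ X l j) ∎) ⟩
        sumᴸ {q} (λ l → ⊝ (A k 0 (suc (toℕ l)) ⊛ ζ′ (toℕ l) (toℕ j)))
          ≡⟨ ∑≡sum q (λ l → ⊝ (A k 0 (suc l) ⊛ ζ′ l (toℕ j))) ⟨
        ∑ q (λ l → ⊝ (A k 0 (suc l) ⊛ ζ′ l (toℕ j)))
          ≈⟨ ∑-neg q (λ l → A k 0 (suc l) ⊛ ζ′ l (toℕ j)) ⟩
        ⊝ row (toℕ j) ∎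

  -- The coefficient of 1/z comes from the path of length zero, of weight 1.
  resolvent₀₀≠0 : ∀ r → ∃ λ n → coeff (resolvent r 0 0) n # 0#
  resolvent₀₀≠0 r = -1ℤ , ≡.subst (λ b → (if b then 1# else 0#) # 0#)
    (≡.sym (dec-true (+ (r ℕ.+ 0) ℤ.≟ + (r ℕ.+ 0)) ≡.refl))
    (HeytingProperties.1#0 heytingCommutativeRing)

  resolvent≋W : ∀ i j → resolvent 0 i j ≋ W (+ i) (+ j)
  resolvent≋W i j (+ n)    = C.refl
  resolvent≋W i j -[1+ n ] = C.sym (totalWeight-𝒫 (above 0) (λ { (+ _) → ≡.refl ; -[1+ _ ] → ≡.refl }) n (+ i) (+ j))

  -- Only the innermost matrix comes from the given `ζ`; all others are blocks of resolvents, whose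
  -- upper left entries are known to be apart from 0. For k = 0, `unique` identifies `ζ` with the
  -- resolvent of K.
  expansion : ∀ k ζ → BoundedMatrix ζ → RightInverse w (A k) ζ → τ∘⋯∘τ k (block ζ) G
  expansion zero    ζ ζ-bounded ζ-inverse = lift λ i j → begin
    ζ (toℕ i) (toℕ j)
      ≈⟨ unique w {A 0} {λ i → δ i (toℕ j)} {λ i → ζ i (toℕ j)} {λ i → resolvent 0 i (toℕ j)} (A-small 0)
           (ζ-bounded (toℕ j)) (resolvent-bounded 0 (toℕ j)) (ζ-inverse (toℕ j)) (resolvent-inverse 0 (toℕ j)) (toℕ i) ⟩
    resolvent 0 (toℕ i) (toℕ j)
      ≈⟨ resolvent≋W (toℕ i) (toℕ j) ⟩
    G i j ∎
  expansion (suc k) ζ ζ-bounded ζ-inverse =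
      block (resolvent k)
    , τ-step k (resolvent-bounded k) (resolvent-inverse k) ζ-bounded ζ-inverse (resolvent₀₀≠0 k)
    , expansion k (resolvent k) (resolvent-bounded k) (resolvent-inverse k)

theorem6p4 : ∀ {c ℓ₁ ℓ₂} (F : HeytingField c ℓ₁ ℓ₂) (p′ q′ : ℕ)
    (a : ℤ → ℤ → HeytingField.Carrier F) →
    let open ContinuedFraction F p′ q′ a in
    (k : ℕ) → 1 ≤ k →
    ∃ (IsInverse (zI-K k)) ×
    (∀ ζ → IsInverse (zI-K k) ζ → τ∘⋯∘τ k (block ζ) G)
theorem6p4 F p′ q′ a k _ =
    (resolvent k , resolvent-isInverse k)
  , λ ζ inverse → expansion k ζ (isInverse⇒bounded k ζ inverse) (isInverse⇒rightInverse k ζ inverse)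
  where open Expansion F p′ q′ a
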